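{- For every positive integer $n$, $$\sum_{k=1}^{n-1} \left(\frac{k}{3}\right) \frac{(-1)^k}{[k]_q}\, q^{\frac{k}{3}\left(k-\left(\frac{k}{3}\right)\right) - \frac{(k-1)(k-2)}{6}} \equiv \left(\frac{n}{3}\right) \frac{\left(\frac{n}{3}\right) - n}{6}\, q^{\frac{n^2-1}{3}} (1-q) \pmod{\Phi_n(q)}.$$
   Context: For an integer $m$, $\left(\frac{m}{3}\right)$ denotes the Legendre symbol modulo 3: it equals $1$ if $m\equiv 1 \pmod 3$, $-1$ if $m\equiv 2\pmod 3$, and $0$ if $3\mid m$. In the exponent, $\frac{k}{3}\left(k-\left(\frac{k}{3}\right)\right)$ means the rational number $k/3$ multiplied by $k$ minus the Legendre symbol $\left(\frac{k}{3}\right)$; all exponents occurring with a nonzero coefficient are integers (when $3\mid n$ the right-hand side is $0$). The $q$-integer is $[k]_q=(1-q^k)/(1-q)$. $\Phi_n(q)=\prod_{1\le k\le n,\ \gcd(n,k)=1}(q-e^{2\pi i k/n})$ is the $n$th cyclotomic polynomial. For rational functions $A(q),B(q)$ with rational coefficients whose denominators are coprime to $\Phi_n(q)$, $A\equiv B \pmod{\Phi_n(q)}$ means that the numerator of $A-B$ (in lowest terms) is divisible by $\Phi_n(q)$ in $\mathbb{Q}[q]$. -}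

module Defs where

open import Data.Nat as ℕ using (ℕ; zero; suc; _∸_; _%_)
open import Data.Nat.Divisibility using (_∣_; _∣?_)
open import Data.Integer as ℤ using (ℤ; +_)
open import Data.Rational as ℚ using (ℚ; 0ℚ; 1ℚ)
open import Data.List using (List; []; _∷_; map; foldr; filter)
open import Data.List.Base using (upTo)
open import Data.Product using (_×_; _,_; proj₁; proj₂; ∃)
open import Relation.Binary.PropositionalEquality using (_≡_)

-- Polynomials over ℚ: coefficient lists in ascending order of degree.

Poly : Set
Poly = List ℚ

coeff : Poly → ℕ → ℚ
coeff []       _       = 0ℚ
coeff (a ∷ p)  zero    = a
coeff (a ∷ p)  (suc i) = coeff p i

-- equality of polynomials (trailing zeros ignored)
_≈P_ : Poly → Poly → Set
p ≈P r = ∀ i → coeff p i ≡ coeff r i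

_+P_ : Poly → Poly → Poly
[]      +P r       = r
(a ∷ p) +P []      = a ∷ p
(a ∷ p) +P (b ∷ r) = (a ℚ.+ b) ∷ (p +P r)

scaleP : ℚ → Poly → Poly
scaleP c = map (c ℚ.*_)

-P_ : Poly → Poly
-P p = scaleP (ℚ.- 1ℚ) p

_-P_ : Poly → Poly → Poly
p -P r = p +P (-P r)

_*P_ : Poly → Poly → Poly
[]      *P r = []
(a ∷ p) *P r = scaleP a r +P (0ℚ ∷ (p *P r))

constP : ℚ → Poly
constP c = c ∷ []

oneP : Poly
oneP = constP 1ℚ

qpow : ℕ → Poly
qpow zero    = oneP
qpow (suc k) = 0ℚ ∷ qpow k

prodP : List Poly → Poly
prodP = foldr _*P_ oneP

_∣P_ : Poly → Poly → Set
d ∣P p = ∃ λ r → p ≈P (r *P d)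

-- Cyclotomic polynomials, characterised by  q^m - 1 = ∏_{d ∣ m} Φ_d(q)
-- for all m ≥ 1 (this determines Φ_m uniquely in ℚ[q], by induction on m).

divisorsOf : ℕ → List ℕ
divisorsOf m = filter (λ d → d ∣? m) (map suc (upTo m))

IsCyclotomicFamily : (ℕ → Poly) → Set
IsCyclotomicFamily Φ =
  ∀ m → 1 ℕ.≤ m → prodP (map Φ (divisorsOf m)) ≈P (qpow m -P oneP)

Frac : Set
Frac = Poly × Poly

num den : Frac → Poly
num = proj₁
den = proj₂

_+F_ : Frac → Frac → Frac
(a , b) +F (c , d) = ((a *P d) +P (c *P b)) , (b *P d)

_*F_ : Frac → Frac → Frac
(a , b) *F (c , d) = (a *P c) , (b *P d)

polyF : Poly → Frac
polyF p = p , oneP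

zeroF : Frac
zeroF = polyF []

-- A ≡ B (mod m): the numerator of A - B = (num A·den B - num B·den A)/(den A·den B)
-- is divisible by m.  (Denominators in the theorem are coprime to Φ_n, so this agrees
-- with the definition via numerators in lowest terms.)
CongMod : Poly → Frac → Frac → Set
CongMod m A B = m ∣P ((num A *P den B) -P (num B *P den A))

qint : ℕ → Frac
qint k = (oneP -P qpow k) , (oneP -P qpow 1)

invF : Frac → Frac
invF (a , b) = b , a

leg3 : ℕ → ℤ
leg3 k with k % 3
... | 0 = + 0
... | 1 = + 1
... | _ = ℤ.- (+ 1)

kMinusLeg : ℕ → ℕ
kMinusLeg k with k % 3
... | 0 = k
... | 1 = k ∸ 1
... | _ = suc k

signZ : ℕ → ℤ
signZ zero    = + 1
signZ (suc k) = ℤ.- signZ k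

-- (k/3)(k - (k/3))/3 and (k-1)(k-2)/6 (exact divisions whenever (k/3) ≠ 0)
expoA : ℕ → ℕ
expoA k = (k ℕ.* kMinusLeg k) ℕ./ 3

expoB : ℕ → ℕ
expoB k = ((k ∸ 1) ℕ.* (k ∸ 2)) ℕ./ 6

-- the k-th summand  (k/3) (-1)^k / [k]_q · q^{expoA k - expoB k},
-- written with q^{expoB k} moved into the denominator
summand : ℕ → Frac
summand k =
  (polyF (scaleP ((leg3 k ℤ.* signZ k) ℚ./ 1) (qpow (expoA k))) *F invF (qint k))
    *F (oneP , qpow (expoB k))

sumF : ℕ → (ℕ → Frac) → Frac
sumF n f = foldr _+F_ zeroF (map f (filter (λ k → 1 ℕ.≤? k) (upTo n)))

LHS : ℕ → Frac
LHS n = sumF n summand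

RHS : ℕ → Frac
RHS n = polyF (scaleP ((leg3 n ℤ.* (leg3 n ℤ.- + n)) ℚ./ 6)
                      (qpow (((n ℕ.* n) ∸ 1) ℕ./ 3) *P (oneP -P qpow 1)))

{-# OPTIONS --safe #-}

-- Work in R = ℚ[q]/(Φₙ). Over every commutative ring, the finite form of Euler's pentagonal number
-- theorem
--   Σ_j (-1)^j q^{j(3j+1)/2} [n choose ⌊(n+3j+1)/2⌋] = 1
-- holds. Apply it over the dual numbers R[ε] with q replaced by q̂ = q(1 + ε). Since q̂ⁿ = 1 + nε,
-- absorption gives, for 0 < k < n,
--   [n choose k] = -nε [n-1 choose k-1] / (1 - q^k),
-- where [n-1 choose k-1] = (-1)^{k-1} q^{-k(k-1)/2} in R,
-- so the ε-component of the identity, divided by n, is the required sum up to a unit of R, while the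
-- exponent of the outermost term contributes the rational coefficient. The indices k that occur are
-- those prime to 3 when n ≡ 1 (mod 3), and become so after k ↦ n - k when n ≡ 2. When 3 divides n,
-- the summands at k and n - k cancel. That 1 - q^k is a unit of R follows from the fact that qⁿ - 1 =
-- Φₙ G evaluated at q̂ reads nε = ε q Φₙ′(q) G(q), so that G is a unit.

module Submission where

open import Algebra.Bundles using (CommutativeMonoid; CommutativeRing)
import Algebra.Properties.AbelianGroup
import Algebra.Properties.CommutativeSemigroup
import Algebra.Properties.Ring
import Algebra.Properties.Semiring.Exp
import Algebra.Properties.Semiring.Mult
import Algebra.Properties.Semiring.Mult.TCOptimised
import Algebra.Solver.Ring
open import Algebra.Solver.Ring.AlmostCommutativeRing using (fromCommutativeRing; _-Raw-AlmostCommutative⟶_)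
open import Data.Empty using (⊥-elim)
open import Data.Integer as ℤ using (ℤ; +_; -[1+_])
import Data.Integer.Properties as ℤₚ
open import Data.Integer.Solver using () renaming (module +-*-Solver to ℤ-Solver)
open import Data.List using (List; []; _∷_; _++_; map; filter; foldr; applyUpTo)
import Data.List.Properties as Listₚ
open import Data.Maybe using (Maybe; just; nothing)
open import Data.Nat as ℕ using (ℕ; zero; suc; _∸_; _%_; _≤_; z≤n; s≤s)
open import Data.Nat.Divisibility using (_∣_; _∣?_; ∣-trans; ∣-refl; ∣⇒≤; 0∣⇒≡0)
open import Data.Nat.DivMod using (m*n/n≡m)
open import Data.Nat.GCD using (gcd; gcd-GCD; module GCD; module Bézout)
import Data.Nat.Properties as ℕₚ
open import Data.Nat.Solver using (module +-*-Solver)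
open import Data.Product using (_×_; _,_; proj₁; proj₂; ∃)
open import Data.Rational as ℚ using (ℚ; 0ℚ; 1ℚ)
import Data.Rational.Properties as ℚₚ
open import Data.Rational.Unnormalised as ℚᵘ using (mkℚᵘ; *≡*)
import Data.Rational.Unnormalised.Properties as ℚᵘₚ
open import Data.Sum using (_⊎_; inj₁; inj₂)
open import Level using (0ℓ)
open import Relation.Binary.PropositionalEquality as ≡ using (_≡_)
import Relation.Binary.Reasoning.Setoid as SetoidReasoning
open import Relation.Nullary using (yes; no)
open import Relation.Unary using (Pred; Decidable)
open import Defs

-- Over R itself every interior [n choose k] vanishes, so there the identity only says (-1)^n =
-- -q^p, with p the outermost exponent. The sum of the 1/(1 - q^k) is first-order information around
-- the root, and this is what ε records. With q(1 + ε), ε acts as q d/dq, so an exponent e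
-- contributes the factor e. For n = 3j + 1 or n = 3j + 2 the outermost exponent is nj/2 or n(j +
-- 1)/2; hence the coefficient p/n, and the doubling of sums before they are compared.
--
-- The unit relating the two sums is not computed. The weighted binomials [n-1 choose k-1] and the
-- wanted numerators obey the same recursion along the indices prime to 3, so they are proportional.
-- At k = n the former is -q^p, which shows that the constant is a unit, and it then cancels.
--
-- When 3 divides n, the nonzero weights sit at k ≡ 0 and 2 (mod 3), so the identity does not see
-- the sum in question; the symmetry k ↦ n - k takes its place.

module IntegerCoefficients (R : CommutativeRing 0ℓ 0ℓ) where
  open CommutativeRing R
  open Algebra.Properties.Ring ring
  open Algebra.Properties.AbelianGroup +-abelianGroup using (⁻¹-∙-comm)
  open Algebra.Properties.Semiring.Mult.TCOptimised semiring using (×-homo-+; ×1-homo-*; 1+×) renaming (_×_ to _·_)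
  open SetoidReasoning setoid

  -- The ring solver compares coefficients, so they are taken in ℤ, where equality is decidable; the
  -- rings used below come without a decision procedure.
  ⟦_⟧ : ℤ → Carrier
  ⟦ + n ⟧      = n · 1#
  ⟦ -[1+ n ] ⟧ = - (suc n · 1#)

  ⟦⟧-neg : ∀ i → ⟦ ℤ.- i ⟧ ≈ - ⟦ i ⟧
  ⟦⟧-neg (+ zero)   = sym -0#≈0#
  ⟦⟧-neg (+ suc n)  = refl
  ⟦⟧-neg (-[1+ n ]) = sym (-‿involutive _)

  ⟦⟧-⊖ : ∀ m n → ⟦ m ℤ.⊖ n ⟧ ≈ m · 1# - n · 1#
  ⟦⟧-⊖ zero    zero    = sym (-‿inverseʳ _)
  ⟦⟧-⊖ zero    (suc n) = sym (+-identityˡ _)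
  ⟦⟧-⊖ (suc m) zero    = sym (trans (+-congˡ -0#≈0#) (+-identityʳ _))
  ⟦⟧-⊖ (suc m) (suc n) = begin
    ⟦ suc m ℤ.⊖ suc n ⟧                  ≡⟨ ≡.cong ⟦_⟧ (ℤₚ.[1+m]⊖[1+n]≡m⊖n m n) ⟩
    ⟦ m ℤ.⊖ n ⟧                          ≈⟨ ⟦⟧-⊖ m n ⟩
    a - b                                ≈⟨ +-congʳ (sym (+-identityˡ a)) ⟩
    0# + a - b                           ≈⟨ +-congʳ (+-congʳ (sym (-‿inverseʳ 1#))) ⟩
    1# - 1# + a - b                      ≈⟨ +-congʳ (+-assoc 1# (- 1#) a) ⟩
    1# + (- 1# + a) - b                  ≈⟨ +-congʳ (+-congˡ (+-comm (- 1#) a)) ⟩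
    1# + (a - 1#) - b                    ≈⟨ +-congʳ (+-assoc 1# a (- 1#)) ⟨
    1# + a - 1# - b                      ≈⟨ +-assoc _ _ _ ⟩
    1# + a + (- 1# - b)                  ≈⟨ +-congˡ (⁻¹-∙-comm 1# b) ⟩
    1# + a - (1# + b)                    ≈⟨ +-cong (1+× m 1#) (-‿cong (1+× n 1#)) ⟨
    suc m · 1# - suc n · 1#              ∎
    where
    a b : Carrier
    a = m · 1#
    b = n · 1#

  ⟦⟧-+ : ∀ i j → ⟦ i ℤ.+ j ⟧ ≈ ⟦ i ⟧ + ⟦ j ⟧
  ⟦⟧-+ (+ m)      (+ n)      = ×-homo-+ 1# m n
  ⟦⟧-+ (+ m)      (-[1+ n ]) = ⟦⟧-⊖ m (suc n)
  ⟦⟧-+ (-[1+ m ]) (+ n)      = trans (⟦⟧-⊖ n (suc m)) (+-comm _ _)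
  ⟦⟧-+ (-[1+ m ]) (-[1+ n ]) = trans (-‿cong (trans
    (reflexive (≡.cong (λ k → suc k · 1#) (≡.sym (ℕₚ.+-suc m n)))) (×-homo-+ 1# (suc m) (suc n))))
    (sym (⁻¹-∙-comm _ _))

  ⟦⟧-*-pos : ∀ m n → ⟦ + m ℤ.* + n ⟧ ≈ ⟦ + m ⟧ * ⟦ + n ⟧
  ⟦⟧-*-pos m n = trans (reflexive (≡.cong ⟦_⟧ (≡.sym (ℤₚ.pos-* m n)))) (×1-homo-* m n)

  ⟦⟧-*-posʳ : ∀ i n → ⟦ i ℤ.* + n ⟧ ≈ ⟦ i ⟧ * ⟦ + n ⟧
  ⟦⟧-*-posʳ (+ m)      n = ⟦⟧-*-pos m n
  ⟦⟧-*-posʳ (-[1+ m ]) n = begin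
    ⟦ -[1+ m ] ℤ.* + n ⟧       ≡⟨ ≡.cong ⟦_⟧ (≡.sym (ℤₚ.neg-distribˡ-* (+ suc m) (+ n))) ⟩
    ⟦ ℤ.- (+ suc m ℤ.* + n) ⟧  ≈⟨ ⟦⟧-neg (+ suc m ℤ.* + n) ⟩
    - ⟦ + suc m ℤ.* + n ⟧      ≈⟨ -‿cong (⟦⟧-*-pos (suc m) n) ⟩
    - (suc m · 1# * ⟦ + n ⟧)   ≈⟨ -‿distribˡ-* _ _ ⟩
    - (suc m · 1#) * ⟦ + n ⟧   ∎

  ⟦⟧-* : ∀ i j → ⟦ i ℤ.* j ⟧ ≈ ⟦ i ⟧ * ⟦ j ⟧
  ⟦⟧-* i (+ n)      = ⟦⟧-*-posʳ i n
  ⟦⟧-* i (-[1+ n ]) = begin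
    ⟦ i ℤ.* -[1+ n ] ⟧         ≡⟨ ≡.cong ⟦_⟧ (≡.sym (ℤₚ.neg-distribʳ-* i (+ suc n))) ⟩
    ⟦ ℤ.- (i ℤ.* + suc n) ⟧    ≈⟨ ⟦⟧-neg (i ℤ.* + suc n) ⟩
    - ⟦ i ℤ.* + suc n ⟧        ≈⟨ -‿cong (⟦⟧-*-posʳ i (suc n)) ⟩
    - (⟦ i ⟧ * ⟦ + suc n ⟧)    ≈⟨ -‿distribʳ-* _ _ ⟩
    ⟦ i ⟧ * ⟦ -[1+ n ] ⟧       ∎

  morphism : ℤ.+-*-rawRing -Raw-AlmostCommutative⟶ fromCommutativeRing R
  morphism = record
    { ⟦_⟧    = ⟦_⟧
    ; +-homo = ⟦⟧-+
    ; *-homo = ⟦⟧-*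
    ; -‿homo = ⟦⟧-neg
    ; 0-homo = refl
    ; 1-homo = refl
    }

  ⟦⟧-≟ : ∀ i j → Maybe (⟦ i ⟧ ≈ ⟦ j ⟧)
  ⟦⟧-≟ i j with i ℤₚ.≟ j
  ... | yes i≡j = just (reflexive (≡.cong ⟦_⟧ i≡j))
  ... | no  _   = nothing

  open Algebra.Solver.Ring ℤ.+-*-rawRing (fromCommutativeRing R) morphism ⟦⟧-≟ public
    using (solve; _:+_; _:*_; _:-_; :-_; _:=_; con)

-- Dual numbers and quotients by one element.

module DualNumbers (R : CommutativeRing 0ℓ 0ℓ) where
  open CommutativeRing R hiding (zero)
  open IntegerCoefficients R

  dualNumbers : CommutativeRing 0ℓ 0ℓ
  dualNumbers = record
    { Carrier = Carrier × Carrier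
    ; _≈_ = λ x y → (proj₁ x ≈ proj₁ y) × (proj₂ x ≈ proj₂ y)
    ; _+_ = λ (a , b) (c , d) → (a + c) , (b + d)
    ; _*_ = λ (a , b) (c , d) → (a * c) , (a * d + b * c)
    ; -_  = λ (a , b) → (- a) , (- b)
    ; 0#  = 0# , 0#
    ; 1#  = 1# , 0#
    ; isCommutativeRing = record
      { isRing = record
        { +-isAbelianGroup = record
          { isGroup = record
            { isMonoid = record
              { isSemigroup = record
                { isMagma = record
                  { isEquivalence = record
                    { refl  = refl , refl
                    ; sym   = λ (p , r) → sym p , sym r
                    ; trans = λ (p , r) (p′ , r′) → trans p p′ , trans r r′
                    }
                  ; ∙-cong = λ (p , r) (p′ , r′) → +-cong p p′ , +-cong r r′
                  }
                ; assoc = λ _ _ _ → +-assoc _ _ _ , +-assoc _ _ _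
                }
              ; identity = (λ _ → +-identityˡ _ , +-identityˡ _) , (λ _ → +-identityʳ _ , +-identityʳ _)
              }
            ; inverse = (λ _ → -‿inverseˡ _ , -‿inverseˡ _) , (λ _ → -‿inverseʳ _ , -‿inverseʳ _)
            ; ⁻¹-cong = λ (p , r) → -‿cong p , -‿cong r
            }
          ; comm = λ _ _ → +-comm _ _ , +-comm _ _
          }
        ; *-cong = λ (p , r) (p′ , r′) → *-cong p p′ , +-cong (*-cong p r′) (*-cong r p′)
        ; *-assoc = λ (a , b) (c , d) (e , f) → *-assoc _ _ _ ,
            solve 6 (λ a b c d e f → a :* c :* f :+ (a :* d :+ b :* c) :* e
                                  := a :* (c :* f :+ d :* e) :+ b :* (c :* e)) refl a b c d e f
        ; *-identity =
            (λ (a , b) → *-identityˡ _ , solve 2 (λ a b → con (+ 1) :* b :+ con (+ 0) :* a := b) refl a b) ,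
            (λ (a , b) → *-identityʳ _ , solve 2 (λ a b → a :* con (+ 0) :+ b :* con (+ 1) := b) refl a b)
        ; distrib =
            (λ (a , b) (c , d) (e , f) → distribˡ _ _ _ ,
              solve 6 (λ a b c d e f → a :* (d :+ f) :+ b :* (c :+ e)
                                    := a :* d :+ b :* c :+ (a :* f :+ b :* e)) refl a b c d e f) ,
            (λ (a , b) (c , d) (e , f) → distribʳ _ _ _ ,
              solve 6 (λ a b c d e f → (c :+ e) :* b :+ (d :+ f) :* a
                                    := c :* b :+ d :* a :+ (e :* b :+ f :* a)) refl a b c d e f)
        }
      ; *-comm = λ (a , b) (c , d) → *-comm _ _ ,
          solve 4 (λ a b c d → a :* d :+ b :* c := c :* b :+ d :* a) refl a b c d
      }
    }

  private
    module D = CommutativeRing dualNumbers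

  open Algebra.Properties.Semiring.Exp semiring using (_^_)
  open Algebra.Properties.Semiring.Exp D.semiring using () renaming (_^_ to _^ᴰ_)
  open Algebra.Properties.Semiring.Mult semiring using (×-comm-*) renaming (_×_ to _·_)

  -- (x , x) is x (1 + ε)
  dual-^ : ∀ x k → ((x , x) ^ᴰ k) D.≈ (x ^ k , k · x ^ k)
  dual-^ x zero    = D.refl
  dual-^ x (suc k) = D.trans (D.*-congˡ {x , x} (dual-^ x k))
    (refl , trans (+-comm _ _) (+-congˡ (×-comm-* k x (x ^ k))))

module Quotient (R : CommutativeRing 0ℓ 0ℓ) (d : CommutativeRing.Carrier R) where
  open CommutativeRing R
  open IntegerCoefficients R
  open SetoidReasoning setoid

  infix 4 _∼_
  -- A record, so that x and y can be inferred from the type of a proof.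
  record _∼_ (x y : Carrier) : Set where
    constructor _,_
    field
      multiplier : Carrier
      difference : x - y ≈ multiplier * d

  ≈⇒∼ : ∀ {x y} → x ≈ y → x ∼ y
  ≈⇒∼ {x} {y} x≈y = 0# , (begin
    x - y   ≈⟨ +-congʳ x≈y ⟩
    y - y   ≈⟨ -‿inverseʳ y ⟩
    0#      ≈⟨ zeroˡ d ⟨
    0# * d  ∎)

  -- The carrier stays and only equality is coarsened: a polynomial is its own class, and a proof of
  -- equality carries the multiplier that `CongMod` asks for.
  quotient : CommutativeRing 0ℓ 0ℓ
  quotient = record
    { Carrier = Carrier
    ; _≈_ = _∼_
    ; _+_ = _+_
    ; _*_ = _*_
    ; -_  = -_
    ; 0#  = 0#
    ; 1#  = 1#
    ; isCommutativeRing = record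
      { isRing = record
        { +-isAbelianGroup = record
          { isGroup = record
            { isMonoid = record
              { isSemigroup = record
                { isMagma = record
                  { isEquivalence = record
                    { refl  = ≈⇒∼ refl
                    ; sym   = λ {x} {y} (r , p) → - r , (begin
                        y - x      ≈⟨ solve 2 (λ x y → y :- x := :- (x :- y)) refl x y ⟩
                        - (x - y)  ≈⟨ -‿cong p ⟩
                        - (r * d)  ≈⟨ solve 2 (λ r d → :- (r :* d) := :- r :* d) refl r d ⟩
                        - r * d    ∎)
                    ; trans = λ {x} {y} {z} (r , p) (s , p′) → r + s , (begin
                        x - z              ≈⟨ solve 3 (λ x y z → x :- z := x :- y :+ (y :- z)) refl x y z ⟩
                        (x - y) + (y - z)  ≈⟨ +-cong p p′ ⟩
                        r * d + s * d      ≈⟨ distribʳ d r s ⟨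
                        (r + s) * d        ∎)
                    }
                  ; ∙-cong = λ {x} {y} {u} {v} (r , p) (s , p′) → r + s , (begin
                      (x + u) - (y + v)  ≈⟨ solve 4 (λ x y u v → x :+ u :- (y :+ v) := x :- y :+ (u :- v)) refl x y u v ⟩
                      (x - y) + (u - v)  ≈⟨ +-cong p p′ ⟩
                      r * d + s * d      ≈⟨ distribʳ d r s ⟨
                      (r + s) * d        ∎)
                  }
                ; assoc = λ x y z → ≈⇒∼ (+-assoc x y z)
                }
              ; identity = (λ x → ≈⇒∼ (+-identityˡ x)) , (λ x → ≈⇒∼ (+-identityʳ x))
              }
            ; inverse = (λ x → ≈⇒∼ (-‿inverseˡ x)) , (λ x → ≈⇒∼ (-‿inverseʳ x))
            ; ⁻¹-cong = λ {x} {y} (r , p) → - r , (begin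
                - x - - y  ≈⟨ solve 2 (λ x y → :- x :- :- y := :- (x :- y)) refl x y ⟩
                - (x - y)  ≈⟨ -‿cong p ⟩
                - (r * d)  ≈⟨ solve 2 (λ r d → :- (r :* d) := :- r :* d) refl r d ⟩
                - r * d    ∎)
            }
          ; comm = λ x y → ≈⇒∼ (+-comm x y)
          }
        ; *-cong = λ {x} {y} {u} {v} (r , p) (s , p′) → r * u + y * s , (begin
            x * u - y * v              ≈⟨ solve 4 (λ x y u v → x :* u :- y :* v := (x :- y) :* u :+ y :* (u :- v)) refl x y u v ⟩
            (x - y) * u + y * (u - v)  ≈⟨ +-cong (*-congʳ p) (*-congˡ p′) ⟩
            r * d * u + y * (s * d)    ≈⟨ solve 5 (λ r s d u y → r :* d :* u :+ y :* (s :* d) := (r :* u :+ y :* s) :* d) refl r s d u y ⟩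
            (r * u + y * s) * d        ∎)
        ; *-assoc = λ x y z → ≈⇒∼ (*-assoc x y z)
        ; *-identity = (λ x → ≈⇒∼ (*-identityˡ x)) , (λ x → ≈⇒∼ (*-identityʳ x))
        ; distrib = (λ x y z → ≈⇒∼ (distribˡ x y z)) , (λ x y z → ≈⇒∼ (distribʳ x y z))
        }
      ; *-comm = λ x y → ≈⇒∼ (*-comm x y)
      }
    }

  d∼0 : d ∼ 0#
  d∼0 = 1# , solve 1 (λ d → d :- con (+ 0) := con (+ 1) :* d) refl d

-- The ring ℚ[q] and evaluation of its elements.

module PolynomialArithmetic where

  -- A record, so that the polynomials can be inferred from the type of a proof.
  infix 4 _≋_
  record _≋_ (p r : Poly) : Set where
    constructor mk≋
    field coeffs : p ≈P r
  open _≋_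

  coeff-+P : ∀ p r i → coeff (p +P r) i ≡ coeff p i ℚ.+ coeff r i
  coeff-+P []      r       i       = ≡.sym (ℚₚ.+-identityˡ _)
  coeff-+P (a ∷ p) []      i       = ≡.sym (ℚₚ.+-identityʳ _)
  coeff-+P (a ∷ p) (b ∷ r) zero    = ≡.refl
  coeff-+P (a ∷ p) (b ∷ r) (suc i) = coeff-+P p r i

  coeff-scaleP : ∀ c p i → coeff (scaleP c p) i ≡ c ℚ.* coeff p i
  coeff-scaleP c []      i       = ≡.sym (ℚₚ.*-zeroʳ c)
  coeff-scaleP c (a ∷ p) zero    = ≡.refl
  coeff-scaleP c (a ∷ p) (suc i) = coeff-scaleP c p i

  ≋-refl : ∀ {p} → p ≋ p
  ≋-refl = mk≋ λ _ → ≡.refl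

  ≋-sym : ∀ {p r} → p ≋ r → r ≋ p
  ≋-sym p≋r = mk≋ λ i → ≡.sym (coeffs p≋r i)

  ≋-trans : ∀ {p r s} → p ≋ r → r ≋ s → p ≋ s
  ≋-trans p≋r r≋s = mk≋ λ i → ≡.trans (coeffs p≋r i) (coeffs r≋s i)

  ∷-cong : ∀ {a b p r} → a ≡ b → p ≋ r → (a ∷ p) ≋ (b ∷ r)
  ∷-cong a≡b p≋r = mk≋ λ { zero → a≡b ; (suc i) → coeffs p≋r i }

  0∷[]≋[] : (0ℚ ∷ []) ≋ []
  0∷[]≋[] = mk≋ λ { zero → ≡.refl ; (suc i) → ≡.refl }

  +P-cong : ∀ {p p′ r r′} → p ≋ p′ → r ≋ r′ → (p +P r) ≋ (p′ +P r′)
  +P-cong {p} {p′} {r} {r′} e f = mk≋ λ i →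
    ≡.trans (coeff-+P p r i) (≡.trans (≡.cong₂ ℚ._+_ (coeffs e i) (coeffs f i)) (≡.sym (coeff-+P p′ r′ i)))

  +P-comm : ∀ p r → (p +P r) ≋ (r +P p)
  +P-comm p r = mk≋ λ i →
    ≡.trans (coeff-+P p r i) (≡.trans (ℚₚ.+-comm (coeff p i) (coeff r i)) (≡.sym (coeff-+P r p i)))

  +P-assoc : ∀ p r s → ((p +P r) +P s) ≋ (p +P (r +P s))
  +P-assoc []      r       s       = ≋-refl
  +P-assoc (a ∷ p) []      s       = ≋-refl
  +P-assoc (a ∷ p) (b ∷ r) []      = ≋-refl
  +P-assoc (a ∷ p) (b ∷ r) (c ∷ s) = ∷-cong (ℚₚ.+-assoc a b c) (+P-assoc p r s)

  +P-identityʳ : ∀ p → (p +P []) ≋ p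
  +P-identityʳ p = +P-comm p []

  scaleP-cong : ∀ c {p r} → p ≋ r → scaleP c p ≋ scaleP c r
  scaleP-cong c {p} {r} p≋r = mk≋ λ i →
    ≡.trans (coeff-scaleP c p i) (≡.trans (≡.cong (c ℚ.*_) (coeffs p≋r i)) (≡.sym (coeff-scaleP c r i)))

  scaleP-zero : ∀ p → scaleP 0ℚ p ≋ []
  scaleP-zero p = mk≋ λ i → ≡.trans (coeff-scaleP 0ℚ p i) (ℚₚ.*-zeroˡ (coeff p i))

  scaleP-one : ∀ p → scaleP 1ℚ p ≋ p
  scaleP-one p = mk≋ λ i → ≡.trans (coeff-scaleP 1ℚ p i) (ℚₚ.*-identityˡ (coeff p i))

  scaleP-*ℚ : ∀ c d p → scaleP (c ℚ.* d) p ≋ scaleP c (scaleP d p)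
  scaleP-*ℚ c d []      = ≋-refl
  scaleP-*ℚ c d (a ∷ p) = ∷-cong (ℚₚ.*-assoc c d a) (scaleP-*ℚ c d p)

  scaleP-+P : ∀ c p r → scaleP c (p +P r) ≋ (scaleP c p +P scaleP c r)
  scaleP-+P c []      r       = ≋-refl
  scaleP-+P c (a ∷ p) []      = ≋-refl
  scaleP-+P c (a ∷ p) (b ∷ r) = ∷-cong (ℚₚ.*-distribˡ-+ c a b) (scaleP-+P c p r)

  scaleP-+ℚ : ∀ c d p → scaleP (c ℚ.+ d) p ≋ (scaleP c p +P scaleP d p)
  scaleP-+ℚ c d []      = ≋-refl
  scaleP-+ℚ c d (a ∷ p) = ∷-cong (ℚₚ.*-distribʳ-+ a c d) (scaleP-+ℚ c d p)

  +P-inverseˡ : ∀ p → ((-P p) +P p) ≋ []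
  +P-inverseˡ []      = ≋-refl
  +P-inverseˡ (a ∷ p) = ≋-trans (∷-cong eq (+P-inverseˡ p)) 0∷[]≋[]
    where
    eq : ℚ.- 1ℚ ℚ.* a ℚ.+ a ≡ 0ℚ
    eq = ≡.trans (≡.cong (ℚ._+ a) (≡.trans (≡.sym (ℚₚ.neg-distribˡ-* 1ℚ a)) (≡.cong ℚ.-_ (ℚₚ.*-identityˡ a))))
                 (ℚₚ.+-inverseˡ a)

  +P-commutativeMonoid : CommutativeMonoid 0ℓ 0ℓ
  +P-commutativeMonoid = record
    { Carrier = Poly
    ; _≈_ = _≋_
    ; _∙_ = _+P_
    ; ε = []
    ; isCommutativeMonoid = record
      { isMonoid = record
        { isSemigroup = record
          { isMagma = record
            { isEquivalence = record { refl = ≋-refl ; sym = ≋-sym ; trans = ≋-trans }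
            ; ∙-cong = +P-cong
            }
          ; assoc = +P-assoc
          }
        ; identity = (λ p → ≋-refl) , +P-identityʳ
        }
      ; comm = +P-comm
      }
    }

  open CommutativeMonoid +P-commutativeMonoid using (setoid; commutativeSemigroup)
  open Algebra.Properties.CommutativeSemigroup commutativeSemigroup using (interchange; x∙yz≈y∙xz)
  open SetoidReasoning setoid

  shift-+P : ∀ p r → (0ℚ ∷ (p +P r)) ≋ ((0ℚ ∷ p) +P (0ℚ ∷ r))
  shift-+P p r = ∷-cong (≡.sym (ℚₚ.+-identityˡ 0ℚ)) ≋-refl

  *P-zeroʳ : ∀ p → (p *P []) ≋ []
  *P-zeroʳ []      = ≋-refl
  *P-zeroʳ (a ∷ p) = ≋-trans (∷-cong ≡.refl (*P-zeroʳ p)) 0∷[]≋[]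

  -- `_*P_` recurses on its left factor; this mirrored recursion makes commutativity an induction.
  *P-∷ʳ : ∀ p b r → (p *P (b ∷ r)) ≋ (scaleP b p +P (0ℚ ∷ (p *P r)))
  *P-∷ʳ []      b r = ≋-sym 0∷[]≋[]
  *P-∷ʳ (a ∷ p) b r = ∷-cong (≡.cong (ℚ._+ 0ℚ) (ℚₚ.*-comm a b)) (begin
    scaleP a r +P (p *P (b ∷ r))                  ≈⟨ +P-cong ≋-refl (*P-∷ʳ p b r) ⟩
    scaleP a r +P (scaleP b p +P (0ℚ ∷ (p *P r)))  ≈⟨ x∙yz≈y∙xz (scaleP a r) (scaleP b p) (0ℚ ∷ (p *P r)) ⟩
    scaleP b p +P (scaleP a r +P (0ℚ ∷ (p *P r)))  ∎)

  *P-comm : ∀ p r → (p *P r) ≋ (r *P p)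
  *P-comm []      r = ≋-sym (*P-zeroʳ r)
  *P-comm (a ∷ p) r = ≋-trans (+P-cong ≋-refl (∷-cong ≡.refl (*P-comm p r))) (≋-sym (*P-∷ʳ r a p))

  *P-congˡ : ∀ p {r s} → r ≋ s → (p *P r) ≋ (p *P s)
  *P-congˡ []      r≋s = ≋-refl
  *P-congˡ (a ∷ p) r≋s = +P-cong (scaleP-cong a r≋s) (∷-cong ≡.refl (*P-congˡ p r≋s))

  *P-cong : ∀ {p p′ r r′} → p ≋ p′ → r ≋ r′ → (p *P r) ≋ (p′ *P r′)
  *P-cong {p} {p′} {r} {r′} e f = begin
    p *P r    ≈⟨ *P-congˡ p f ⟩
    p *P r′   ≈⟨ *P-comm p r′ ⟩
    r′ *P p   ≈⟨ *P-congˡ r′ e ⟩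
    r′ *P p′  ≈⟨ *P-comm r′ p′ ⟩
    p′ *P r′  ∎

  *P-distribʳ : ∀ s p r → ((p +P r) *P s) ≋ ((p *P s) +P (r *P s))
  *P-distribʳ s []      r       = ≋-refl
  *P-distribʳ s (a ∷ p) []      = ≋-sym (+P-identityʳ _)
  *P-distribʳ s (a ∷ p) (b ∷ r) = begin
    scaleP (a ℚ.+ b) s +P (0ℚ ∷ ((p +P r) *P s))
      ≈⟨ +P-cong (scaleP-+ℚ a b s) (∷-cong ≡.refl (*P-distribʳ s p r)) ⟩
    (scaleP a s +P scaleP b s) +P (0ℚ ∷ ((p *P s) +P (r *P s)))
      ≈⟨ +P-cong ≋-refl (shift-+P (p *P s) (r *P s)) ⟩
    (scaleP a s +P scaleP b s) +P ((0ℚ ∷ (p *P s)) +P (0ℚ ∷ (r *P s)))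
      ≈⟨ interchange (scaleP a s) (scaleP b s) (0ℚ ∷ (p *P s)) (0ℚ ∷ (r *P s)) ⟩
    (scaleP a s +P (0ℚ ∷ (p *P s))) +P (scaleP b s +P (0ℚ ∷ (r *P s)))  ∎

  *P-distribˡ : ∀ s p r → (s *P (p +P r)) ≋ ((s *P p) +P (s *P r))
  *P-distribˡ s p r = begin
    s *P (p +P r)         ≈⟨ *P-comm s (p +P r) ⟩
    (p +P r) *P s         ≈⟨ *P-distribʳ s p r ⟩
    (p *P s) +P (r *P s)  ≈⟨ +P-cong (*P-comm p s) (*P-comm r s) ⟩
    (s *P p) +P (s *P r)  ∎

  scaleP-*P : ∀ c p r → (scaleP c p *P r) ≋ scaleP c (p *P r)
  scaleP-*P c []      r = ≋-refl
  scaleP-*P c (a ∷ p) r = begin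
    scaleP (c ℚ.* a) r +P (0ℚ ∷ (scaleP c p *P r))
      ≈⟨ +P-cong (scaleP-*ℚ c a r) (∷-cong (≡.sym (ℚₚ.*-zeroʳ c)) (scaleP-*P c p r)) ⟩
    scaleP c (scaleP a r) +P scaleP c (0ℚ ∷ (p *P r))
      ≈⟨ scaleP-+P c (scaleP a r) (0ℚ ∷ (p *P r)) ⟨
    scaleP c (scaleP a r +P (0ℚ ∷ (p *P r)))  ∎

  shift-*P : ∀ p r → ((0ℚ ∷ p) *P r) ≋ (0ℚ ∷ (p *P r))
  shift-*P p r = +P-cong (scaleP-zero r) ≋-refl

  *P-assoc : ∀ p r s → ((p *P r) *P s) ≋ (p *P (r *P s))
  *P-assoc []      r s = ≋-refl
  *P-assoc (a ∷ p) r s = begin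
    (scaleP a r +P (0ℚ ∷ (p *P r))) *P s
      ≈⟨ *P-distribʳ s (scaleP a r) (0ℚ ∷ (p *P r)) ⟩
    (scaleP a r *P s) +P ((0ℚ ∷ (p *P r)) *P s)
      ≈⟨ +P-cong (scaleP-*P a r s) (shift-*P (p *P r) s) ⟩
    scaleP a (r *P s) +P (0ℚ ∷ ((p *P r) *P s))
      ≈⟨ +P-cong ≋-refl (∷-cong ≡.refl (*P-assoc p r s)) ⟩
    scaleP a (r *P s) +P (0ℚ ∷ (p *P (r *P s)))  ∎

  constP-*P : ∀ c p → (constP c *P p) ≋ scaleP c p
  constP-*P c p = ≋-trans (+P-cong ≋-refl 0∷[]≋[]) (+P-identityʳ _)

  *P-identityˡ : ∀ p → (oneP *P p) ≋ p
  *P-identityˡ p = ≋-trans (constP-*P 1ℚ p) (scaleP-one p)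

  polynomialRing : CommutativeRing 0ℓ 0ℓ
  polynomialRing = record
    { Carrier = Poly
    ; _≈_ = _≋_
    ; _+_ = _+P_
    ; _*_ = _*P_
    ; -_  = -P_
    ; 0#  = []
    ; 1#  = oneP
    ; isCommutativeRing = record
      { isRing = record
        { +-isAbelianGroup = record
          { isGroup = record
            { isMonoid = CommutativeMonoid.isMonoid +P-commutativeMonoid
            ; inverse = +P-inverseˡ , (λ p → ≋-trans (+P-comm p (-P p)) (+P-inverseˡ p))
            ; ⁻¹-cong = scaleP-cong (ℚ.- 1ℚ)
            }
          ; comm = +P-comm
          }
        ; *-cong = *P-cong
        ; *-assoc = *P-assoc
        ; *-identity = *P-identityˡ , (λ p → ≋-trans (*P-comm p oneP) (*P-identityˡ p))
        ; distrib = *P-distribˡ , *P-distribʳ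
        }
      ; *-comm = *P-comm
      }
    }

open PolynomialArithmetic
open _≋_

record RationalAlgebra (S : CommutativeRing 0ℓ 0ℓ) : Set where
  open CommutativeRing S
  field
    ι   : ℚ → Carrier
    ι-+ : ∀ a b → ι (a ℚ.+ b) ≈ ι a + ι b
    ι-* : ∀ a b → ι (a ℚ.* b) ≈ ι a * ι b
    ι-0 : ι 0ℚ ≈ 0#
    ι-1 : ι 1ℚ ≈ 1#

module Evaluation (S : CommutativeRing 0ℓ 0ℓ) (A : RationalAlgebra S) (x : CommutativeRing.Carrier S) where
  open CommutativeRing S
  open RationalAlgebra A
  open IntegerCoefficients S
  open Algebra.Properties.Semiring.Exp semiring using (_^_)
  open Algebra.Properties.Ring ring using (+-inverseˡ-unique)
  open SetoidReasoning setoid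

  -- Horner's scheme in an arbitrary ℚ-algebra, so that the point may be a dual number, where
  -- evaluation also differentiates.
  eval : Poly → Carrier
  eval []      = 0#
  eval (a ∷ p) = ι a + x * eval p

  eval-≋[] : ∀ p → p ≋ [] → eval p ≈ 0#
  eval-≋[] []      _ = refl
  eval-≋[] (a ∷ p) e = begin
    ι a + x * eval p  ≈⟨ +-cong (reflexive (≡.cong ι (coeffs e 0))) (*-congˡ (eval-≋[] p (mk≋ λ i → coeffs e (suc i)))) ⟩
    ι 0ℚ + x * 0#     ≈⟨ +-cong ι-0 (zeroʳ x) ⟩
    0# + 0#           ≈⟨ +-identityˡ 0# ⟩
    0#                ∎

  eval-cong : ∀ p r → p ≋ r → eval p ≈ eval r
  eval-cong []      r       e = sym (eval-≋[] r (≋-sym e))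
  eval-cong (a ∷ p) []      e = eval-≋[] (a ∷ p) e
  eval-cong (a ∷ p) (b ∷ r) e =
    +-cong (reflexive (≡.cong ι (coeffs e 0))) (*-congˡ (eval-cong p r (mk≋ λ i → coeffs e (suc i))))

  eval-+ : ∀ p r → eval (p +P r) ≈ eval p + eval r
  eval-+ []      r       = sym (+-identityˡ _)
  eval-+ (a ∷ p) []      = sym (+-identityʳ _)
  eval-+ (a ∷ p) (b ∷ r) = begin
    ι (a ℚ.+ b) + x * eval (p +P r)
      ≈⟨ +-cong (ι-+ a b) (*-congˡ (eval-+ p r)) ⟩
    ι a + ι b + x * (eval p + eval r)
      ≈⟨ solve 5 (λ a b x u v → a :+ b :+ x :* (u :+ v) := a :+ x :* u :+ (b :+ x :* v)) refl (ι a) (ι b) x (eval p) (eval r) ⟩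
    ι a + x * eval p + (ι b + x * eval r)  ∎

  eval-scale : ∀ c p → eval (scaleP c p) ≈ ι c * eval p
  eval-scale c []      = sym (zeroʳ _)
  eval-scale c (a ∷ p) = begin
    ι (c ℚ.* a) + x * eval (scaleP c p)
      ≈⟨ +-cong (ι-* c a) (*-congˡ (eval-scale c p)) ⟩
    ι c * ι a + x * (ι c * eval p)
      ≈⟨ solve 4 (λ c a x u → c :* a :+ x :* (c :* u) := c :* (a :+ x :* u)) refl (ι c) (ι a) x (eval p) ⟩
    ι c * (ι a + x * eval p)  ∎

  eval-shift : ∀ p → eval (0ℚ ∷ p) ≈ x * eval p
  eval-shift p = trans (+-congʳ ι-0) (+-identityˡ _)

  eval-* : ∀ p r → eval (p *P r) ≈ eval p * eval r
  eval-* []      r = sym (zeroˡ _)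
  eval-* (a ∷ p) r = begin
    eval (scaleP a r +P (0ℚ ∷ (p *P r)))
      ≈⟨ eval-+ (scaleP a r) (0ℚ ∷ (p *P r)) ⟩
    eval (scaleP a r) + eval (0ℚ ∷ (p *P r))
      ≈⟨ +-cong (eval-scale a r) (trans (eval-shift (p *P r)) (*-congˡ (eval-* p r))) ⟩
    ι a * eval r + x * (eval p * eval r)
      ≈⟨ solve 4 (λ a r x u → a :* r :+ x :* (u :* r) := (a :+ x :* u) :* r) refl (ι a) (eval r) x (eval p) ⟩
    (ι a + x * eval p) * eval r  ∎

  eval-one : eval oneP ≈ 1#
  eval-one = trans (+-cong ι-1 (zeroʳ x)) (+-identityʳ 1#)

  eval-qpow : ∀ k → eval (qpow k) ≈ x ^ k
  eval-qpow zero    = eval-one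
  eval-qpow (suc k) = trans (eval-shift (qpow k)) (*-congˡ (eval-qpow k))

  eval-neg : ∀ p → eval (-P p) ≈ - eval p
  eval-neg p = +-inverseˡ-unique (eval (-P p)) (eval p)
    (trans (sym (eval-+ (-P p) p)) (eval-cong ((-P p) +P p) [] (+P-inverseˡ p)))

-- Residues modulo 3 and pentagonal exponents.

data Residue : Set where
  r0 r1 r2 : Residue

next neg : Residue → Residue
next r0 = r1
next r1 = r2
next r2 = r0
neg r0 = r0
neg r1 = r2
neg r2 = r1

infixl 6 _⊕_
_⊕_ : Residue → Residue → Residue
r0 ⊕ y = y
r1 ⊕ y = next y
r2 ⊕ y = next (next y)

residue : ℕ → Residue
residue 0 = r0
residue 1 = r1
residue 2 = r2
residue (suc (suc (suc k))) = residue k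

residue-suc : ∀ k → residue (suc k) ≡ next (residue k)
residue-suc 0 = ≡.refl
residue-suc 1 = ≡.refl
residue-suc 2 = ≡.refl
residue-suc (suc (suc (suc k))) = residue-suc k

residue-+ : ∀ k m → residue (k ℕ.+ m) ≡ residue k ⊕ residue m
residue-+ 0 m = ≡.refl
residue-+ 1 m = residue-suc m
residue-+ 2 m = ≡.trans (residue-suc (suc m)) (≡.cong next (residue-suc m))
residue-+ (suc (suc (suc k))) m = residue-+ k m

-- The class of k - m modulo 3, formed from residues because subtraction on ℕ truncates.
residueΔ : ℕ → ℕ → Residue
residueΔ k m = residue k ⊕ neg (residue m)

residueΔ-sucˡ : ∀ k m → residueΔ (suc k) m ≡ next (residueΔ k m)
residueΔ-sucˡ k m = ≡.trans (≡.cong (_⊕ neg (residue m)) (residue-suc k)) (lemma (residue k) (neg (residue m)))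
  where
  lemma : ∀ x y → next x ⊕ y ≡ next (x ⊕ y)
  lemma r0 y = ≡.refl
  lemma r1 y = ≡.refl
  lemma r2 r0 = ≡.refl
  lemma r2 r1 = ≡.refl
  lemma r2 r2 = ≡.refl

residueΔ-sucʳ : ∀ k m → residueΔ k (suc m) ≡ next (next (residueΔ k m))
residueΔ-sucʳ k m = ≡.trans (≡.cong (λ r → residue k ⊕ neg r) (residue-suc m)) (lemma (residue k) (residue m))
  where
  lemma : ∀ x y → x ⊕ neg (next y) ≡ next (next (x ⊕ neg y))
  lemma r0 r0 = ≡.refl
  lemma r0 r1 = ≡.refl
  lemma r0 r2 = ≡.refl
  lemma r1 r0 = ≡.refl
  lemma r1 r1 = ≡.refl
  lemma r1 r2 = ≡.refl
  lemma r2 r0 = ≡.refl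
  lemma r2 r1 = ≡.refl
  lemma r2 r2 = ≡.refl

next³ : ∀ r → next (next (next r)) ≡ r
next³ r0 = ≡.refl
next³ r1 = ≡.refl
next³ r2 = ≡.refl

next-injective : ∀ {r s} → next r ≡ next s → r ≡ s
next-injective {r} {s} e = ≡.trans (≡.sym (next³ r)) (≡.trans (≡.cong (λ x → next (next x)) e) (next³ s))

residueΔ-suc : ∀ k m → residueΔ (suc k) (suc m) ≡ residueΔ k m
residueΔ-suc k m = ≡.trans (residueΔ-sucˡ k (suc m)) (≡.trans (≡.cong next (residueΔ-sucʳ k m)) (next³ _))

residueΔ-zeroʳ : ∀ k → residueΔ k 0 ≡ residue k
residueΔ-zeroʳ k with residue k
... | r0 = ≡.refl
... | r1 = ≡.refl
... | r2 = ≡.refl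

pred-residue : ∀ k {r} → residue (suc k) ≡ next r → residue k ≡ r
pred-residue k e = next-injective (≡.trans (≡.sym (residue-suc k)) e)

-- Raising t by 3 takes j to j + 1 and adds 3j + 2 to j(3j + 1)/2; this is t + 2 for t = 3j and t +
-- 1 for t = 3j + 1. For negative differences put j = -i: the value is i(3i - 1)/2 at m = 3i and m =
-- 3i - 1, and it grows by 3i + 1. The remaining residue class gets the junk value 0.
posExp negExp : ℕ → ℕ
posExp 0 = 0
posExp 1 = 0
posExp 2 = 0
posExp (suc (suc (suc k))) with residue k
... | r0 = 2 ℕ.+ k ℕ.+ posExp k
... | r1 = 1 ℕ.+ k ℕ.+ posExp k
... | r2 = 0
negExp 0 = 0
negExp 1 = 0
negExp 2 = 1
negExp (suc (suc (suc m))) with residue m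
... | r0 = 1 ℕ.+ m ℕ.+ negExp m
... | r1 = 0
... | r2 = 2 ℕ.+ m ℕ.+ negExp m

posExp-r0 : ∀ k → residue k ≡ r0 → posExp (3 ℕ.+ k) ≡ 2 ℕ.+ k ℕ.+ posExp k
posExp-r0 k e rewrite e = ≡.refl

posExp-r1 : ∀ k → residue k ≡ r1 → posExp (3 ℕ.+ k) ≡ 1 ℕ.+ k ℕ.+ posExp k
posExp-r1 k e rewrite e = ≡.refl

negExp-r0 : ∀ m → residue m ≡ r0 → negExp (3 ℕ.+ m) ≡ 1 ℕ.+ m ℕ.+ negExp m
negExp-r0 m e rewrite e = ≡.refl

negExp-r2 : ∀ m → residue m ≡ r2 → negExp (3 ℕ.+ m) ≡ 2 ℕ.+ m ℕ.+ negExp m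
negExp-r2 m e rewrite e = ≡.refl

posExp-flat : ∀ k → residue k ≡ r0 → posExp (suc k) ≡ posExp k
posExp-flat 0 e = ≡.refl
posExp-flat (suc (suc (suc k))) e = begin
  posExp (4 ℕ.+ k)                  ≡⟨ posExp-r1 (suc k) (≡.trans (residue-suc k) (≡.cong next e)) ⟩
  1 ℕ.+ suc k ℕ.+ posExp (suc k)    ≡⟨ ≡.cong (2 ℕ.+ k ℕ.+_) (posExp-flat k e) ⟩
  2 ℕ.+ k ℕ.+ posExp k              ≡⟨ posExp-r0 k e ⟨
  posExp (3 ℕ.+ k)                  ∎
  where open ≡.≡-Reasoning

posExp-step : ∀ k → residue k ≡ r1 → posExp (2 ℕ.+ k) ≡ suc k ℕ.+ posExp k
posExp-step 1 e = ≡.refl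
posExp-step (suc (suc (suc k))) e = begin
  posExp (5 ℕ.+ k)                                    ≡⟨ posExp-r0 (2 ℕ.+ k) (≡.trans (residue-+ 2 k) (≡.cong (λ r → next (next r)) e)) ⟩
  4 ℕ.+ k ℕ.+ posExp (2 ℕ.+ k)                        ≡⟨ ≡.cong (4 ℕ.+ k ℕ.+_) (posExp-step k e) ⟩
  4 ℕ.+ k ℕ.+ (1 ℕ.+ k ℕ.+ posExp k)                  ≡⟨ ≡.cong (4 ℕ.+ k ℕ.+_) (posExp-r1 k e) ⟨
  4 ℕ.+ k ℕ.+ posExp (3 ℕ.+ k)                        ∎
  where open ≡.≡-Reasoning

negExp-step : ∀ m → residue m ≡ r0 → negExp (2 ℕ.+ m) ≡ suc m ℕ.+ negExp m
negExp-step 0 e = ≡.refl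
negExp-step (suc (suc (suc m))) e = begin
  negExp (5 ℕ.+ m)                                    ≡⟨ negExp-r2 (2 ℕ.+ m) (≡.trans (residue-+ 2 m) (≡.cong (λ r → next (next r)) e)) ⟩
  4 ℕ.+ m ℕ.+ negExp (2 ℕ.+ m)                        ≡⟨ ≡.cong (4 ℕ.+ m ℕ.+_) (negExp-step m e) ⟩
  4 ℕ.+ m ℕ.+ (1 ℕ.+ m ℕ.+ negExp m)                  ≡⟨ ≡.cong (4 ℕ.+ m ℕ.+_) (negExp-r0 m e) ⟨
  4 ℕ.+ m ℕ.+ negExp (3 ℕ.+ m)                        ∎
  where open ≡.≡-Reasoning

negExp-flat : ∀ m → residue m ≡ r2 → negExp (suc m) ≡ negExp m
negExp-flat 2 e = ≡.refl
negExp-flat (suc (suc (suc m))) e = begin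
  negExp (4 ℕ.+ m)                  ≡⟨ negExp-r0 (suc m) (≡.trans (residue-suc m) (≡.cong next e)) ⟩
  2 ℕ.+ m ℕ.+ negExp (suc m)        ≡⟨ ≡.cong (2 ℕ.+ m ℕ.+_) (negExp-flat m e) ⟩
  2 ℕ.+ m ℕ.+ negExp m              ≡⟨ negExp-r2 m e ⟨
  negExp (3 ℕ.+ m)                  ∎
  where open ≡.≡-Reasoning

residue-1+3* : ∀ j → residue (1 ℕ.+ j ℕ.* 3) ≡ r1
residue-1+3* zero    = ≡.refl
residue-1+3* (suc j) = residue-1+3* j

residue-2+3* : ∀ j → residue (2 ℕ.+ j ℕ.* 3) ≡ r2
residue-2+3* zero    = ≡.refl
residue-2+3* (suc j) = residue-2+3* j

2*posExp : ∀ j → 2 ℕ.* posExp (1 ℕ.+ j ℕ.* 3) ≡ (1 ℕ.+ j ℕ.* 3) ℕ.* j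
2*posExp zero    = ≡.refl
2*posExp (suc j) = begin
  2 ℕ.* posExp (4 ℕ.+ j ℕ.* 3)
    ≡⟨ ≡.cong (2 ℕ.*_) (posExp-r1 (1 ℕ.+ j ℕ.* 3) (residue-1+3* j)) ⟩
  2 ℕ.* (2 ℕ.+ j ℕ.* 3 ℕ.+ posExp (1 ℕ.+ j ℕ.* 3))
    ≡⟨ ℕₚ.*-distribˡ-+ 2 (2 ℕ.+ j ℕ.* 3) _ ⟩
  2 ℕ.* (2 ℕ.+ j ℕ.* 3) ℕ.+ 2 ℕ.* posExp (1 ℕ.+ j ℕ.* 3)
    ≡⟨ ≡.cong (2 ℕ.* (2 ℕ.+ j ℕ.* 3) ℕ.+_) (2*posExp j) ⟩
  2 ℕ.* (2 ℕ.+ j ℕ.* 3) ℕ.+ (1 ℕ.+ j ℕ.* 3) ℕ.* j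
    ≡⟨ solve 1 (λ j → con 2 :* (con 2 :+ j :* con 3) :+ (con 1 :+ j :* con 3) :* j
                   := (con 4 :+ j :* con 3) :* (con 1 :+ j)) ≡.refl j ⟩
  (4 ℕ.+ j ℕ.* 3) ℕ.* suc j  ∎
  where
  open ≡.≡-Reasoning
  open +-*-Solver

2*negExp : ∀ j → 2 ℕ.* negExp (2 ℕ.+ j ℕ.* 3) ≡ (2 ℕ.+ j ℕ.* 3) ℕ.* suc j
2*negExp zero    = ≡.refl
2*negExp (suc j) = begin
  2 ℕ.* negExp (5 ℕ.+ j ℕ.* 3)
    ≡⟨ ≡.cong (2 ℕ.*_) (negExp-r2 (2 ℕ.+ j ℕ.* 3) (residue-2+3* j)) ⟩
  2 ℕ.* (4 ℕ.+ j ℕ.* 3 ℕ.+ negExp (2 ℕ.+ j ℕ.* 3))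
    ≡⟨ ℕₚ.*-distribˡ-+ 2 (4 ℕ.+ j ℕ.* 3) _ ⟩
  2 ℕ.* (4 ℕ.+ j ℕ.* 3) ℕ.+ 2 ℕ.* negExp (2 ℕ.+ j ℕ.* 3)
    ≡⟨ ≡.cong (2 ℕ.* (4 ℕ.+ j ℕ.* 3) ℕ.+_) (2*negExp j) ⟩
  2 ℕ.* (4 ℕ.+ j ℕ.* 3) ℕ.+ (2 ℕ.+ j ℕ.* 3) ℕ.* suc j
    ≡⟨ solve 1 (λ j → con 2 :* (con 4 :+ j :* con 3) :+ (con 2 :+ j :* con 3) :* (con 1 :+ j)
                   := (con 5 :+ j :* con 3) :* (con 2 :+ j)) ≡.refl j ⟩
  (5 ℕ.+ j ℕ.* 3) ℕ.* suc (suc j)  ∎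
  where
  open ≡.≡-Reasoning
  open +-*-Solver

-- j (3j + 1) / 2 when k - m is 3j or 3j + 1, and a junk value when k - m is 3j + 2;
-- posExp t and negExp t are its values at k - m = t and at k - m = -t.
pentagonal : ℕ → ℕ → ℕ
pentagonal (suc k) (suc m) = pentagonal k m
pentagonal zero    m       = negExp m
pentagonal (suc k) zero    = posExp (suc k)

pentagonal-zeroʳ : ∀ k → pentagonal k 0 ≡ posExp k
pentagonal-zeroʳ zero    = ≡.refl
pentagonal-zeroʳ (suc k) = ≡.refl

-- The differences 3j and 3j + 1 belong to the same j.
pentagonal-flat : ∀ k m → residueΔ k m ≡ r0 → pentagonal (suc k) m ≡ pentagonal k m
pentagonal-flat k       zero    e = ≡.trans (posExp-flat k (≡.trans (≡.sym (residueΔ-zeroʳ k)) e)) (≡.sym (pentagonal-zeroʳ k))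
pentagonal-flat zero    (suc m) e = ≡.sym (negExp-flat m (pred-residue m (neg-r0 _ e)))
  where
  neg-r0 : ∀ r → neg r ≡ r0 → r ≡ r0
  neg-r0 r0 _ = ≡.refl
pentagonal-flat (suc k) (suc m) e = pentagonal-flat k m (≡.trans (≡.sym (residueΔ-suc k m)) e)

-- If k - m = 3j + 2, the two neighbouring differences are 3(j + 1) and 3j + 1. Their exponents
-- belong to consecutive values of j and differ by 3j + 2 = k - m; the terms m and k stand on
-- opposite sides to avoid subtraction.
pentagonal-step : ∀ k m → residueΔ k m ≡ r2 → m ℕ.+ pentagonal (suc k) m ≡ k ℕ.+ pentagonal k (suc m)
pentagonal-step zero    zero    ()
pentagonal-step (suc k) zero    e = ≡.trans
  (posExp-step k (pred-residue k (≡.trans (≡.sym (residueΔ-zeroʳ (suc k))) e)))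
  (≡.cong (suc k ℕ.+_) (≡.sym (pentagonal-zeroʳ k)))
pentagonal-step zero    (suc m) e = ≡.sym (negExp-step m (pred-residue m (neg-r2 _ e)))
  where
  neg-r2 : ∀ r → neg r ≡ r2 → r ≡ r1
  neg-r2 r1 _ = ≡.refl
pentagonal-step (suc k) (suc m) e = ≡.cong suc (pentagonal-step k m (≡.trans (≡.sym (residueΔ-suc k m)) e))

-- Gaussian binomials and the finite pentagonal number theorem.

module AntidiagonalSums (R : CommutativeRing 0ℓ 0ℓ) where
  open CommutativeRing R hiding (zero)
  open IntegerCoefficients R
  open SetoidReasoning setoid

  -- Summing over pairs with k + m = n keeps n - k available as a natural number and fits the
  -- indexing of `binom` by such pairs.
  diag : ℕ → (ℕ → ℕ → Carrier) → Carrier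
  diag zero    f = f 0 0
  diag (suc n) f = f 0 (suc n) + diag n (λ k m → f (suc k) m)

  diag-cong : ∀ n {f h : ℕ → ℕ → Carrier} → (∀ k m → k ℕ.+ m ≡ n → f k m ≈ h k m) → diag n f ≈ diag n h
  diag-cong zero    e = e 0 0 ≡.refl
  diag-cong (suc n) e = +-cong (e 0 (suc n) ≡.refl) (diag-cong n λ k m k+m≡n → e (suc k) m (≡.cong suc k+m≡n))

  diag-+ : ∀ n (f h : ℕ → ℕ → Carrier) → diag n (λ k m → f k m + h k m) ≈ diag n f + diag n h
  diag-+ zero    f h = refl
  diag-+ (suc n) f h = begin
    a + b + diag n (λ k m → f (suc k) m + h (suc k) m)
      ≈⟨ +-congˡ (diag-+ n (λ k m → f (suc k) m) (λ k m → h (suc k) m)) ⟩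
    a + b + (c + d)
      ≈⟨ solve 4 (λ a b c d → a :+ b :+ (c :+ d) := a :+ c :+ (b :+ d)) refl a b c d ⟩
    a + c + (b + d)  ∎
    where
    a b c d : Carrier
    a = f 0 (suc n)
    b = h 0 (suc n)
    c = diag n (λ k m → f (suc k) m)
    d = diag n (λ k m → h (suc k) m)

  diag-* : ∀ n c (f : ℕ → ℕ → Carrier) → diag n (λ k m → c * f k m) ≈ c * diag n f
  diag-* zero    c f = refl
  diag-* (suc n) c f = trans (+-congˡ (diag-* n c (λ k m → f (suc k) m))) (sym (distribˡ c _ _))

  diag-last : ∀ n (f : ℕ → ℕ → Carrier) → diag (suc n) f ≈ diag n (λ k m → f k (suc m)) + f (suc n) 0
  diag-last zero    f = refl
  diag-last (suc n) f = begin
    f 0 (2 ℕ.+ n) + diag (suc n) (λ k m → f (suc k) m)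
      ≈⟨ +-congˡ (diag-last n (λ k m → f (suc k) m)) ⟩
    f 0 (2 ℕ.+ n) + (diag n (λ k m → f (suc k) (suc m)) + f (2 ℕ.+ n) 0)
      ≈⟨ +-assoc _ _ _ ⟨
    f 0 (2 ℕ.+ n) + diag n (λ k m → f (suc k) (suc m)) + f (2 ℕ.+ n) 0  ∎

  diag-flip : ∀ n (f : ℕ → ℕ → Carrier) → diag n (λ k m → f m k) ≈ diag n f
  diag-flip zero    f = refl
  diag-flip (suc n) f = begin
    f (suc n) 0 + diag n (λ k m → f m (suc k))    ≈⟨ +-comm _ _ ⟩
    diag n (λ k m → f m (suc k)) + f (suc n) 0    ≈⟨ +-congʳ (diag-flip n (λ k m → f k (suc m))) ⟩
    diag n (λ k m → f k (suc m)) + f (suc n) 0    ≈⟨ diag-last n f ⟨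
    diag (suc n) f                                ∎

module QBinomials (R : CommutativeRing 0ℓ 0ℓ) (q : CommutativeRing.Carrier R) where
  open CommutativeRing R hiding (zero)
  open IntegerCoefficients R
  open AntidiagonalSums R
  open Algebra.Properties.Semiring.Exp semiring using (_^_; ^-homo-*; ^-congʳ)
  open Algebra.Properties.Ring ring using (-0#≈0#)
  open SetoidReasoning setoid

  -- [k + m choose k], not [k choose m]
  binom : ℕ → ℕ → Carrier
  binom zero    m       = 1#
  binom (suc k) zero    = 1#
  binom (suc k) (suc m) = binom k (suc m) + q ^ suc k * binom (suc k) m

  binom-zeroʳ : ∀ k → binom k 0 ≈ 1#
  binom-zeroʳ zero    = refl
  binom-zeroʳ (suc k) = refl

  -- The ratio of neighbouring Gaussian binomials, cross-multiplied so that it holds even where 1 -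
  -- q^k is a zero divisor. It gives the mirrored Pascal rule, hence symmetry, and also absorption.
  binom-shift : ∀ k m → (1# - q ^ suc k) * binom (suc k) m ≈ (1# - q ^ suc m) * binom k (suc m)
  binom-shift zero    zero    = refl
  binom-shift zero    (suc m) = begin
    (1# - q * 1#) * (1# + q * 1# * binom 1 m)
      ≈⟨ solve 2 (λ q b → (con (+ 1) :- q :* con (+ 1)) :* (con (+ 1) :+ q :* con (+ 1) :* b)
                       := con (+ 1) :- q :+ q :* ((con (+ 1) :- q :* con (+ 1)) :* b)) refl q (binom 1 m) ⟩
    1# - q + q * ((1# - q * 1#) * binom 1 m)
      ≈⟨ +-congˡ (*-congˡ (binom-shift zero m)) ⟩
    1# - q + q * ((1# - q ^ suc m) * 1#)
      ≈⟨ solve 2 (λ q x → con (+ 1) :- q :+ q :* ((con (+ 1) :- x) :* con (+ 1))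
                       := (con (+ 1) :- q :* x) :* con (+ 1)) refl q (q ^ suc m) ⟩
    (1# - q ^ (2 ℕ.+ m)) * 1#  ∎
  binom-shift (suc k) zero    = begin
    (1# - q * x) * 1#
      ≈⟨ solve 2 (λ q x → (con (+ 1) :- q :* x) :* con (+ 1)
                       := (con (+ 1) :- x) :* con (+ 1) :+ (con (+ 1) :- q) :* x) refl q x ⟩
    (1# - x) * 1# + (1# - q) * x
      ≈⟨ +-congʳ (binom-shift k zero) ⟩
    (1# - q * 1#) * binom k 1 + (1# - q) * x
      ≈⟨ solve 3 (λ q x b → (con (+ 1) :- q :* con (+ 1)) :* b :+ (con (+ 1) :- q) :* x
                       := (con (+ 1) :- q :* con (+ 1)) :* (b :+ x :* con (+ 1))) refl q x (binom k 1) ⟩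
    (1# - q * 1#) * (binom k 1 + x * 1#)  ∎
    where
    x : Carrier
    x = q ^ suc k
  binom-shift (suc k) (suc m) = begin
    (1# - q * x) * (b + q * x * c)
      ≈⟨ solve 4 (λ q x b c → (con (+ 1) :- q :* x) :* (b :+ q :* x :* c)
                           := (con (+ 1) :- q :* x) :* b :+ q :* x :* ((con (+ 1) :- q :* x) :* c)) refl q x b c ⟩
    (1# - q * x) * b + q * x * ((1# - q * x) * c)
      ≈⟨ +-congˡ (*-congˡ (binom-shift (suc k) m)) ⟩
    (1# - q * x) * b + q * x * ((1# - y) * b)
      ≈⟨ solve 4 (λ q x y b → (con (+ 1) :- q :* x) :* b :+ q :* x :* ((con (+ 1) :- y) :* b)
                           := (con (+ 1) :- x) :* b :+ x :* ((con (+ 1) :- q :* y) :* b)) refl q x y b ⟩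
    (1# - x) * b + x * ((1# - q * y) * b)
      ≈⟨ +-congʳ (binom-shift k (suc m)) ⟩
    (1# - q * y) * d + x * ((1# - q * y) * b)
      ≈⟨ solve 5 (λ q x y b d → (con (+ 1) :- q :* y) :* d :+ x :* ((con (+ 1) :- q :* y) :* b)
                             := (con (+ 1) :- q :* y) :* (d :+ x :* b)) refl q x y b d ⟩
    (1# - q * y) * (d + x * b)  ∎
    where
    x y b c d : Carrier
    x = q ^ suc k
    y = q ^ suc m
    b = binom (suc k) (suc m)
    c = binom (suc (suc k)) m
    d = binom k (suc (suc m))

  pascal : ∀ k m → binom (suc k) (suc m) ≈ q ^ suc m * binom k (suc m) + binom (suc k) m
  pascal k m = begin
    b + x * c
      ≈⟨ solve 3 (λ b c x → b :+ x :* c := b :+ c :- (con (+ 1) :- x) :* c) refl b c x ⟩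
    b + c - (1# - x) * c
      ≈⟨ +-congˡ (-‿cong (binom-shift k m)) ⟩
    b + c - (1# - y) * b
      ≈⟨ solve 3 (λ b c y → b :+ c :- (con (+ 1) :- y) :* b := y :* b :+ c) refl b c y ⟩
    y * b + c  ∎
    where
    x y b c : Carrier
    x = q ^ suc k
    y = q ^ suc m
    b = binom k (suc m)
    c = binom (suc k) m

  binom-sym : ∀ k m → binom k m ≈ binom m k
  binom-sym zero    m       = sym (binom-zeroʳ m)
  binom-sym (suc k) zero    = refl
  binom-sym (suc k) (suc m) = begin
    binom (suc k) (suc m)                             ≈⟨ pascal k m ⟩
    q ^ suc m * binom k (suc m) + binom (suc k) m     ≈⟨ +-cong (*-congˡ (binom-sym k (suc m))) (binom-sym (suc k) m) ⟩
    q ^ suc m * binom (suc m) k + binom m (suc k)     ≈⟨ +-comm _ _ ⟩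
    binom (suc m) (suc k)                             ∎

  absorption : ∀ k m → (1# - q ^ suc k) * binom (suc k) m ≈ (1# - q ^ (suc k ℕ.+ m)) * binom k m
  absorption k zero    = *-cong (+-congˡ (-‿cong (^-congʳ q (≡.sym (ℕₚ.+-identityʳ (suc k)))))) (sym (binom-zeroʳ k))
  absorption k (suc m) = begin
    (1# - x) * (b + x * c)
      ≈⟨ solve 3 (λ x b c → (con (+ 1) :- x) :* (b :+ x :* c)
                         := (con (+ 1) :- x) :* b :+ x :* ((con (+ 1) :- x) :* c)) refl x b c ⟩
    (1# - x) * b + x * ((1# - x) * c)
      ≈⟨ +-congˡ (*-congˡ (binom-shift k m)) ⟩
    (1# - x) * b + x * ((1# - y) * b)
      ≈⟨ solve 3 (λ x y b → (con (+ 1) :- x) :* b :+ x :* ((con (+ 1) :- y) :* b)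
                         := (con (+ 1) :- x :* y) :* b) refl x y b ⟩
    (1# - x * y) * b
      ≈⟨ *-congʳ (+-congˡ (-‿cong (^-homo-* q (suc k) (suc m)))) ⟨
    (1# - q ^ (suc k ℕ.+ suc m)) * b  ∎
    where
    x y b c : Carrier
    x = q ^ suc k
    y = q ^ suc m
    b = binom k (suc m)
    c = binom (suc k) m

  -- These are the signs (-1)^n (-1)^j: since k - m and n = k + m have the same parity, j has the
  -- parity of n when k - m = 3j and the opposite one when k - m = 3j + 1. The weight thus depends
  -- on k - m alone, and the total becomes `sign n` instead of 1.
  signed : Residue → Carrier → Carrier
  signed r0 x = x
  signed r1 x = - x
  signed r2 x = 0#

  weight : ℕ → ℕ → Carrier
  weight k m = signed (residueΔ k m) (q ^ pentagonal k m)

  weight-val : ∀ k m {r} → residueΔ k m ≡ r → weight k m ≈ signed r (q ^ pentagonal k m)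
  weight-val k m ≡.refl = refl

  weight-suc : ∀ k m → weight (suc k) (suc m) ≈ weight k m
  weight-suc k m = weight-val (suc k) (suc m) (residueΔ-suc k m)

  weight-flat : ∀ k m → residueΔ k m ≡ r0 → weight (suc k) m ≈ - weight k m
  weight-flat k m e = begin
    weight (suc k) m             ≈⟨ weight-val (suc k) m (≡.trans (residueΔ-sucˡ k m) (≡.cong next e)) ⟩
    - (q ^ pentagonal (suc k) m) ≈⟨ -‿cong (^-congʳ q (pentagonal-flat k m e)) ⟩
    - (q ^ pentagonal k m)       ≈⟨ -‿cong (weight-val k m e) ⟨
    - weight k m                 ∎

  weight-r2 : ∀ k m → residueΔ k m ≡ r2 → weight k m ≈ 0#
  weight-r2 k m e = weight-val k m e

  weight-step : ∀ k m → residueΔ k m ≡ r2 → q ^ m * weight (suc k) m + q ^ k * weight k (suc m) ≈ 0#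
  weight-step k m e = begin
    q ^ m * weight (suc k) m + q ^ k * weight k (suc m)
      ≈⟨ +-cong (*-congˡ (weight-val (suc k) m (≡.trans (residueΔ-sucˡ k m) (≡.cong next e))))
                (*-congˡ (weight-val k (suc m) (≡.trans (residueΔ-sucʳ k m) (≡.cong (λ r → next (next r)) e)))) ⟩
    q ^ m * q ^ pentagonal (suc k) m + q ^ k * - (q ^ pentagonal k (suc m))
      ≈⟨ +-congʳ (trans (sym (^-homo-* q m _)) (trans (^-congʳ q (pentagonal-step k m e)) (^-homo-* q k _))) ⟩
    q ^ k * q ^ pentagonal k (suc m) + q ^ k * - (q ^ pentagonal k (suc m))
      ≈⟨ solve 2 (λ x y → x :* y :+ x :* :- y := con (+ 0)) refl (q ^ k) _ ⟩
    0#  ∎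

  leftPart rightPart : Residue → ℕ → Carrier
  leftPart r0 m = q ^ m
  leftPart r1 m = 1#
  leftPart r2 m = 1#
  rightPart r0 k = 1#
  rightPart r1 k = q ^ k
  rightPart r2 k = 1#

  -- The residue of k - m decides which of the two q-Pascal rules is applied to binom k m; with this
  -- choice the contributions of each binom k m to the next antidiagonal add up to - weight k m.
  leftTerm rightTerm : ℕ → ℕ → Carrier
  leftTerm zero    m = 0#
  leftTerm (suc k) m = weight (suc k) m * leftPart (residueΔ (suc k) m) m * binom k m
  rightTerm k zero    = 0#
  rightTerm k (suc m) = weight k (suc m) * rightPart (residueΔ k (suc m)) k * binom k m

  -- If k - m has residue 0 or 1, one of the two neighbours has residue 2 and weight 0; the other
  -- has minus the weight of `(k, m)`, and its Pascal rule contributes the coefficient 1. If the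
  -- residue is 2, the rules contribute q^m and q^k, and the two terms cancel by `weight-step`, in
  -- agreement with weight 0.
  weight-cancel : ∀ k m → weight (suc k) m * leftPart (residueΔ (suc k) m) m
                        + weight k (suc m) * rightPart (residueΔ k (suc m)) k ≈ - weight k m
  weight-cancel k m = trans
    (+-cong (reflexive (≡.cong left (residueΔ-sucˡ k m))) (reflexive (≡.cong right (residueΔ-sucʳ k m))))
    (cases (residueΔ k m) ≡.refl)
    where
    left right : Residue → Carrier
    left r = signed r (q ^ pentagonal (suc k) m) * leftPart r m
    right r = signed r (q ^ pentagonal k (suc m)) * rightPart r k

    resˡ : ∀ {r} → residueΔ k m ≡ r → residueΔ (suc k) m ≡ next r
    resˡ e = ≡.trans (residueΔ-sucˡ k m) (≡.cong next e)

    resʳ : ∀ {r} → residueΔ k m ≡ r → residueΔ k (suc m) ≡ next (next r)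
    resʳ e = ≡.trans (residueΔ-sucʳ k m) (≡.cong (λ r → next (next r)) e)

    cases : ∀ r → residueΔ k m ≡ r → left (next r) + right (next (next r)) ≈ - weight k m
    cases r0 e = begin
      left r1 + 0# * 1#         ≈⟨ solve 1 (λ w → w :* con (+ 1) :+ con (+ 0) :* con (+ 1) := w) refl _ ⟩
      - (q ^ pentagonal (suc k) m)  ≈⟨ weight-val (suc k) m (resˡ e) ⟨
      weight (suc k) m          ≈⟨ weight-flat k m e ⟩
      - weight k m              ∎
    cases r1 e = begin
      0# * 1# + right r0        ≈⟨ solve 1 (λ w → con (+ 0) :* con (+ 1) :+ w :* con (+ 1) := w) refl _ ⟩
      q ^ pentagonal k (suc m)  ≈⟨ weight-val k (suc m) (resʳ e) ⟨
      weight k (suc m)          ≈⟨ solve 1 (λ w → w := :- :- w) refl (weight k (suc m)) ⟩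
      - - weight k (suc m)      ≈⟨ -‿cong (weight-flat k (suc m) (resʳ e)) ⟨
      - weight (suc k) (suc m)  ≈⟨ -‿cong (weight-suc k m) ⟩
      - weight k m              ∎
    cases r2 e = begin
      left r0 + right r1
        ≈⟨ +-cong (trans (*-comm _ _) (*-congˡ (sym (weight-val (suc k) m (resˡ e)))))
                  (trans (*-comm _ _) (*-congˡ (sym (weight-val k (suc m) (resʳ e))))) ⟩
      q ^ m * weight (suc k) m + q ^ k * weight k (suc m)  ≈⟨ weight-step k m e ⟩
      0#            ≈⟨ -0#≈0# ⟨
      - 0#          ≈⟨ -‿cong (weight-r2 k m e) ⟨
      - weight k m  ∎

  weight-split : ∀ n k m → k ℕ.+ m ≡ suc n → weight k m * binom k m ≈ leftTerm k m + rightTerm k m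
  weight-split n zero (suc m) _ with residueΔ 0 (suc m)
  ... | r0 = solve 1 (λ w → w :* con (+ 1) := con (+ 0) :+ w :* con (+ 1) :* con (+ 1)) refl _
  ... | r1 = solve 1 (λ w → w :* con (+ 1) := con (+ 0) :+ w :* con (+ 1) :* con (+ 1)) refl _
  ... | r2 = solve 0 (con (+ 0) :* con (+ 1) := con (+ 0) :+ con (+ 0) :* con (+ 1) :* con (+ 1)) refl
  weight-split n (suc k) zero _ with residueΔ (suc k) 0
  ... | r0 = trans (solve 1 (λ w → w :* con (+ 1) := w :* con (+ 1) :* con (+ 1) :+ con (+ 0)) refl _)
                   (+-congʳ (*-congˡ (sym (binom-zeroʳ k))))
  ... | r1 = trans (solve 1 (λ w → w :* con (+ 1) := w :* con (+ 1) :* con (+ 1) :+ con (+ 0)) refl _)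
                   (+-congʳ (*-congˡ (sym (binom-zeroʳ k))))
  ... | r2 = solve 1 (λ b → con (+ 0) :* con (+ 1) := con (+ 0) :* con (+ 1) :* b :+ con (+ 0)) refl (binom k 0)
  weight-split n (suc k) (suc m) _ with residueΔ (suc k) (suc m)
  ... | r0 = trans (*-congˡ (pascal k m))
                   (solve 4 (λ w x b c → w :* (x :* b :+ c) := w :* x :* b :+ w :* con (+ 1) :* c) refl
                     _ (q ^ suc m) (binom k (suc m)) (binom (suc k) m))
  ... | r1 = solve 4 (λ w x b c → w :* (b :+ x :* c) := w :* con (+ 1) :* b :+ w :* x :* c) refl
                     _ (q ^ suc k) (binom k (suc m)) (binom (suc k) m)
  ... | r2 = solve 3 (λ x b c → con (+ 0) :* x := con (+ 0) :* con (+ 1) :* b :+ con (+ 0) :* con (+ 1) :* c) refl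
                     (binom (suc k) (suc m)) (binom k (suc m)) (binom (suc k) m)

  sign : ℕ → Carrier
  sign zero    = 1#
  sign (suc n) = - sign n

  finitePentagonal : ∀ n → diag n (λ k m → weight k m * binom k m) ≈ sign n
  finitePentagonal zero    = *-identityʳ 1#
  finitePentagonal (suc n) = begin
    diag (suc n) (λ k m → weight k m * binom k m)
      ≈⟨ diag-cong (suc n) (weight-split n) ⟩
    diag (suc n) (λ k m → leftTerm k m + rightTerm k m)
      ≈⟨ diag-+ (suc n) leftTerm rightTerm ⟩
    diag (suc n) leftTerm + diag (suc n) rightTerm
      -- `leftTerm` is 0 at k = 0 and `rightTerm` is 0 at m = 0, so both sums shrink to antidiagonal
      -- n.
      ≈⟨ +-cong (+-identityˡ _) (trans (diag-last n rightTerm) (+-identityʳ _)) ⟩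
    diag n (λ k m → leftTerm (suc k) m) + diag n (λ k m → rightTerm k (suc m))
      ≈⟨ diag-+ n (λ k m → leftTerm (suc k) m) (λ k m → rightTerm k (suc m)) ⟨
    diag n (λ k m → leftTerm (suc k) m + rightTerm k (suc m))
      ≈⟨ diag-cong n (λ k m _ → trans (sym (distribʳ (binom k m) _ _)) (*-congʳ (weight-cancel k m))) ⟩
    diag n (λ k m → - weight k m * binom k m)
      ≈⟨ diag-cong n (λ k m _ → solve 2 (λ w b → :- w :* b := con (ℤ.- + 1) :* (w :* b)) refl (weight k m) (binom k m)) ⟩
    diag n (λ k m → - 1# * (weight k m * binom k m))
      ≈⟨ diag-* n (- 1#) (λ k m → weight k m * binom k m) ⟩
    - 1# * diag n (λ k m → weight k m * binom k m)
      ≈⟨ *-congˡ (finitePentagonal n) ⟩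
    - 1# * sign n
      ≈⟨ solve 1 (λ s → con (ℤ.- + 1) :* s := :- s) refl (sign n) ⟩
    - sign n  ∎

-- The exponents of the summands.

-- k (k - (k/3)) / 3 - (k - 1) (k - 2) / 6 for k not divisible by 3
summandExp : ℕ → ℕ
summandExp 0 = 0
summandExp 1 = 0
summandExp 2 = 2
summandExp (suc (suc (suc k))) with residue k
... | r0 = 0
... | r1 = 2 ℕ.+ k ℕ.+ summandExp k
... | r2 = 4 ℕ.+ k ℕ.+ summandExp k

summandExp-r1 : ∀ k → residue k ≡ r1 → summandExp (3 ℕ.+ k) ≡ 2 ℕ.+ k ℕ.+ summandExp k
summandExp-r1 k e rewrite e = ≡.refl

summandExp-r2 : ∀ k → residue k ≡ r2 → summandExp (3 ℕ.+ k) ≡ 4 ℕ.+ k ℕ.+ summandExp k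
summandExp-r2 k e rewrite e = ≡.refl

-- The exponent is (k - 1)(k + 2)/6 for k ≡ 1 and (k² + 5k - 2)/6 for k ≡ 2. This step and
-- `summandExp-step₂` run through the indices prime to 3 in order and give the recursion for `L`.
summandExp-step₁ : ∀ k → residue k ≡ r1 → summandExp (suc k) ≡ suc k ℕ.+ summandExp k
summandExp-step₁ 1 e = ≡.refl
summandExp-step₁ (suc (suc (suc k))) e = begin
  summandExp (4 ℕ.+ k)                            ≡⟨ summandExp-r2 (suc k) (≡.trans (residue-suc k) (≡.cong next e)) ⟩
  5 ℕ.+ k ℕ.+ summandExp (suc k)                  ≡⟨ ≡.cong (5 ℕ.+ k ℕ.+_) (summandExp-step₁ k e) ⟩
  5 ℕ.+ k ℕ.+ (suc k ℕ.+ summandExp k)            ≡⟨ solve 2 (λ k x → con 5 :+ k :+ (con 1 :+ k :+ x) := con 4 :+ k :+ (con 2 :+ k :+ x)) ≡.refl k (summandExp k) ⟩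
  4 ℕ.+ k ℕ.+ (2 ℕ.+ k ℕ.+ summandExp k)          ≡⟨ ≡.cong (4 ℕ.+ k ℕ.+_) (summandExp-r1 k e) ⟨
  4 ℕ.+ k ℕ.+ summandExp (3 ℕ.+ k)                ∎
  where
  open ≡.≡-Reasoning
  open +-*-Solver

summandExp-step₂ : ∀ k → residue k ≡ r2 → summandExp (2 ℕ.+ k) ≡ suc (summandExp k)
summandExp-step₂ 2 e = ≡.refl
summandExp-step₂ (suc (suc (suc k))) e = begin
  summandExp (5 ℕ.+ k)              ≡⟨ summandExp-r1 (2 ℕ.+ k) (≡.trans (residue-+ 2 k) (≡.cong (λ r → next (next r)) e)) ⟩
  4 ℕ.+ k ℕ.+ summandExp (2 ℕ.+ k)  ≡⟨ ≡.cong (4 ℕ.+ k ℕ.+_) (summandExp-step₂ k e) ⟩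
  4 ℕ.+ k ℕ.+ suc (summandExp k)    ≡⟨ ℕₚ.+-suc (4 ℕ.+ k) (summandExp k) ⟩
  suc (4 ℕ.+ k ℕ.+ summandExp k)    ≡⟨ ≡.cong suc (summandExp-r2 k e) ⟨
  suc (summandExp (3 ℕ.+ k))        ∎
  where open ≡.≡-Reasoning

triangular : ℕ → ℕ
triangular zero    = 0
triangular (suc k) = suc k ℕ.+ triangular k

-- With N = 3i + 1 and n = N + 2, the triangular number of n - 1 agrees with `summandExp N` modulo
-- n; this seeds the reflection in the case 3 ∣ n.
triangular-summandExp : ∀ i → triangular (2 ℕ.+ i ℕ.* 3) ≡ summandExp (1 ℕ.+ i ℕ.* 3) ℕ.+ (3 ℕ.+ i ℕ.* 3) ℕ.* suc i
triangular-summandExp zero    = ≡.refl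
triangular-summandExp (suc i) = begin
  5 ℕ.+ j ℕ.+ (4 ℕ.+ j ℕ.+ (3 ℕ.+ j ℕ.+ triangular (2 ℕ.+ j)))
    ≡⟨ ≡.cong (λ x → 5 ℕ.+ j ℕ.+ (4 ℕ.+ j ℕ.+ (3 ℕ.+ j ℕ.+ x))) (triangular-summandExp i) ⟩
  5 ℕ.+ j ℕ.+ (4 ℕ.+ j ℕ.+ (3 ℕ.+ j ℕ.+ (summandExp (1 ℕ.+ j) ℕ.+ (3 ℕ.+ j) ℕ.* suc i)))
    ≡⟨ solve 2 (λ i e → let j = i :* con 3 in
         con 5 :+ j :+ (con 4 :+ j :+ (con 3 :+ j :+ (e :+ (con 3 :+ j) :* (con 1 :+ i))))
         := (con 3 :+ j :+ e) :+ (con 6 :+ j) :* (con 2 :+ i)) ≡.refl i (summandExp (1 ℕ.+ j)) ⟩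
  (3 ℕ.+ j ℕ.+ summandExp (1 ℕ.+ j)) ℕ.+ (6 ℕ.+ j) ℕ.* suc (suc i)
    ≡⟨ ≡.cong (ℕ._+ (6 ℕ.+ j) ℕ.* suc (suc i)) (summandExp-r1 (1 ℕ.+ j) (residue-1+3* i)) ⟨
  summandExp (4 ℕ.+ j) ℕ.+ (6 ℕ.+ j) ℕ.* suc (suc i)  ∎
  where
  open ≡.≡-Reasoning
  open +-*-Solver
  j : ℕ
  j = i ℕ.* 3

-- Because k - m = 2k - (k + m), on a fixed antidiagonal the residue of k decides which weights
-- vanish.
residueΔ-sum : ∀ k m → residueΔ k m ≡ residue k ⊕ residue k ⊕ neg (residue (k ℕ.+ m))
residueΔ-sum k m = ≡.trans (lemma (residue k) (residue m)) (≡.cong (λ r → residue k ⊕ residue k ⊕ neg r) (≡.sym (residue-+ k m)))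
  where
  lemma : ∀ x y → x ⊕ neg y ≡ x ⊕ x ⊕ neg (x ⊕ y)
  lemma r0 y = ≡.refl
  lemma r1 r0 = ≡.refl
  lemma r1 r1 = ≡.refl
  lemma r1 r2 = ≡.refl
  lemma r2 r0 = ≡.refl
  lemma r2 r1 = ≡.refl
  lemma r2 r2 = ≡.refl

residueΔ-from : ∀ k m {x z} → residue k ≡ x → residue (k ℕ.+ m) ≡ z → residueΔ k m ≡ x ⊕ x ⊕ neg z
residueΔ-from k m ≡.refl ≡.refl = residueΔ-sum k m

residueΔ-flip : ∀ k m → residueΔ m k ≡ neg (residueΔ k m)
residueΔ-flip k m = lemma (residue k) (residue m)
  where
  lemma : ∀ x y → y ⊕ neg x ≡ neg (x ⊕ neg y)
  lemma r0 r0 = ≡.refl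
  lemma r0 r1 = ≡.refl
  lemma r0 r2 = ≡.refl
  lemma r1 r0 = ≡.refl
  lemma r1 r1 = ≡.refl
  lemma r1 r2 = ≡.refl
  lemma r2 r0 = ≡.refl
  lemma r2 r1 = ≡.refl
  lemma r2 r2 = ≡.refl

residueΔ-predˡ : ∀ k m {r} → residueΔ (suc k) m ≡ next r → residueΔ k m ≡ r
residueΔ-predˡ k m e = next-injective (≡.trans (≡.sym (residueΔ-sucˡ k m)) e)

residueΔ-predʳ : ∀ k m {r} → residueΔ k (suc m) ≡ next (next r) → residueΔ k m ≡ r
residueΔ-predʳ k m e = next-injective (next-injective (≡.trans (≡.sym (residueΔ-sucʳ k m)) e))

-- Powers, units and roots of unity.

module PowerFacts (R : CommutativeRing 0ℓ 0ℓ) where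
  open CommutativeRing R hiding (zero)
  open Algebra.Properties.Semiring.Exp semiring using (_^_; ^-homo-*; ^-congˡ; ^-assocʳ)
  open Algebra.Properties.Semiring.Mult semiring using (×-congʳ; ×-assoc-*) renaming (_×_ to _·_)
  open IntegerCoefficients R
  open SetoidReasoning setoid

  ·-as-* : ∀ k x → k · x ≈ (k · 1#) * x
  ·-as-* k x = sym (trans (×-assoc-* k 1# x) (×-congʳ k (*-identityˡ x)))

  1^ : ∀ k → 1# ^ k ≈ 1#
  1^ zero    = refl
  1^ (suc k) = trans (*-identityˡ _) (1^ k)

  ^-period : ∀ {x n} → x ^ n ≈ 1# → ∀ a b → x ^ (a ℕ.+ n ℕ.* b) ≈ x ^ a
  ^-period {x} {n} xⁿ≈1 a b = begin
    x ^ (a ℕ.+ n ℕ.* b)      ≈⟨ ^-homo-* x a (n ℕ.* b) ⟩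
    x ^ a * x ^ (n ℕ.* b)    ≈⟨ *-congˡ (^-assocʳ x n b) ⟨
    x ^ a * (x ^ n) ^ b      ≈⟨ *-congˡ (trans (^-congˡ b xⁿ≈1) (1^ b)) ⟩
    x ^ a * 1#               ≈⟨ *-identityʳ _ ⟩
    x ^ a                    ∎

  isUnit : Carrier → Set
  isUnit x = ∃ λ y → x * y ≈ 1#

  unit-cancel : ∀ {c} → isUnit c → ∀ {x y} → c * x ≈ c * y → x ≈ y
  unit-cancel {c} (v , cv≈1) {x} {y} e = begin
    x            ≈⟨ back x ⟨
    v * (c * x)  ≈⟨ *-congˡ e ⟩
    v * (c * y)  ≈⟨ back y ⟩
    y            ∎
    where
    back : ∀ z → v * (c * z) ≈ z
    back z = trans (sym (*-assoc v c z)) (trans (*-congʳ (trans (*-comm v c) cv≈1)) (*-identityˡ z))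

  isUnit-cong : ∀ {x y} → x ≈ y → isUnit x → isUnit y
  isUnit-cong x≈y (v , xv≈1) = v , trans (*-congʳ (sym x≈y)) xv≈1

  isUnit-factorˡ : ∀ x y → isUnit (x * y) → isUnit x
  isUnit-factorˡ x y (v , e) = y * v , trans (sym (*-assoc x y v)) e

  isUnit-neg : ∀ x → isUnit (- x) → isUnit x
  isUnit-neg x (v , e) = - v , trans (solve 2 (λ x v → x :* :- v := :- x :* v) refl x v) e

  1-x∣1-x^ : ∀ x k → ∃ λ s → 1# - x ^ k ≈ (1# - x) * s
  1-x∣1-x^ x zero    = 0# , trans (-‿inverseʳ 1#) (sym (zeroʳ _))
  1-x∣1-x^ x (suc k) with 1-x∣1-x^ x k
  ... | s , e = 1# + x * s , (begin
    1# - x * x ^ k                ≈⟨ solve 2 (λ x y → con (+ 1) :- x :* y := con (+ 1) :- x :+ x :* (con (+ 1) :- y)) refl x (x ^ k) ⟩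
    1# - x + x * (1# - x ^ k)     ≈⟨ +-congˡ (*-congˡ e) ⟩
    1# - x + x * ((1# - x) * s)   ≈⟨ solve 2 (λ x s → con (+ 1) :- x :+ x :* ((con (+ 1) :- x) :* s) := (con (+ 1) :- x) :* (con (+ 1) :+ x :* s)) refl x s ⟩
    (1# - x) * (1# + x * s)       ∎)

  ^-unit : ∀ {x} n → x ^ suc n ≈ 1# → ∀ a → isUnit (x ^ a)
  ^-unit {x} n e a = x ^ (n ℕ.* a) , (begin
    x ^ a * x ^ (n ℕ.* a)    ≈⟨ ^-homo-* x a (n ℕ.* a) ⟨
    x ^ (suc n ℕ.* a)        ≈⟨ ^-period {x} {suc n} e 0 a ⟩
    1#                       ∎)

-- The properties of ℚ[q]/(Φₙ) from which the sum is computed. Writing n = N + 2 lets `diag N` range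
-- over 0 < k < n with k and n - k both successors.
record PrimitiveRoot (R : CommutativeRing 0ℓ 0ℓ) : Set where
  open CommutativeRing R
  open Algebra.Properties.Semiring.Exp semiring using (_^_)
  open Algebra.Properties.Semiring.Mult semiring using () renaming (_×_ to _·_)
  field
    torsionFree : ∀ m x → suc m · x ≈ 0# → x ≈ 0#
    q           : Carrier
    N           : ℕ
    qⁿ≈1        : q ^ (2 ℕ.+ N) ≈ 1#
    u           : ℕ → Carrier
    u-inverse   : ∀ k m → k ℕ.+ m ≡ N → (1# - q ^ suc k) * u (suc k) ≈ 1#

-- The ε-component of the pentagonal identity at a root of unity.

module RootOfUnity (R : CommutativeRing 0ℓ 0ℓ) (ζ : PrimitiveRoot R) where
  open CommutativeRing R hiding (zero)
  open Algebra.Properties.Semiring.Exp semiring using (_^_)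
  open Algebra.Properties.Semiring.Mult semiring using () renaming (_×_ to _·_)
  open PrimitiveRoot ζ

  open IntegerCoefficients R
  open PowerFacts R
  open Algebra.Properties.Semiring.Exp semiring using (^-homo-*; ^-congʳ)
  open Algebra.Properties.Semiring.Mult semiring using (×-congʳ; ×-comm-*; ×-assocˡ)
  open Algebra.Properties.Ring ring using (-0#≈0#; x∙y⁻¹≈ε⇒x≈y; -‿involutive; +-inverseˡ-unique; +-inverseʳ-unique)
  open AntidiagonalSums R
  open QBinomials R q
  open DualNumbers R
  open SetoidReasoning setoid

  private
    n : ℕ
    n = 2 ℕ.+ N

    module D = CommutativeRing dualNumbers
    module DExp = Algebra.Properties.Semiring.Exp D.semiring

    q̂ : D.Carrier
    q̂ = q , q

    module DB = QBinomials dualNumbers q̂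
    module DS = AntidiagonalSums dualNumbers

  q-period : ∀ a b → a ≡ n ℕ.+ b → q ^ a ≈ q ^ b
  q-period _ b ≡.refl = trans (^-homo-* q n b) (trans (*-congʳ qⁿ≈1) (*-identityˡ _))

  proj₁-^ : ∀ k → proj₁ (q̂ DExp.^ k) ≈ q ^ k
  proj₁-^ k = proj₁ (dual-^ q k)

  proj₁-binom : ∀ k m → proj₁ (DB.binom k m) ≈ binom k m
  proj₁-binom zero    m       = refl
  proj₁-binom (suc k) zero    = refl
  proj₁-binom (suc k) (suc m) = +-cong (proj₁-binom k (suc m)) (*-cong (proj₁-^ (suc k)) (proj₁-binom (suc k) m))

  proj₁-weight : ∀ k m → proj₁ (DB.weight k m) ≈ weight k m
  proj₁-weight k m with residueΔ k m
  ... | r0 = proj₁-^ (pentagonal k m)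
  ... | r1 = -‿cong (proj₁-^ (pentagonal k m))
  ... | r2 = refl

  proj₁-diag : ∀ l f → proj₁ (DS.diag l f) ≈ diag l (λ k m → proj₁ (f k m))
  proj₁-diag zero    f = refl
  proj₁-diag (suc l) f = +-congˡ (proj₁-diag l (λ k m → f (suc k) m))

  proj₂-diag : ∀ l f → proj₂ (DS.diag l f) ≈ diag l (λ k m → proj₂ (f k m))
  proj₂-diag zero    f = refl
  proj₂-diag (suc l) f = +-congˡ (proj₂-diag l (λ k m → f (suc k) m))

  sign-constant : ∀ k → DB.sign k D.≈ (sign k , 0#)
  sign-constant zero    = D.refl
  sign-constant (suc k) = D.trans (D.-‿cong (sign-constant k)) (refl , -0#≈0#)

  binom-interior : ∀ k m → k ℕ.+ m ≡ N →
    DB.binom (suc k) (suc m) D.≈ (0# , - (n · 1#) * (u (suc k) * binom k (suc m)))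
  binom-interior k m k+m≡N = b₁≈0 , b₂≈
    where
    b₁ b₂ c : Carrier
    b₁ = proj₁ (DB.binom (suc k) (suc m))
    b₂ = proj₂ (DB.binom (suc k) (suc m))
    c = binom k (suc m)

    v-inverse : (1# - q ^ suc k) * u (suc k) ≈ 1#
    v-inverse = u-inverse k m k+m≡N

    -- Absorption over the dual numbers: the right-hand factor 1 - q̂^n is -nε, so only the ε-free
    -- part of the lower binomial enters.
    product : (1# - q ^ suc k , 0# - suc k · q ^ suc k) D.* (b₁ , b₂) D.≈ (0# , - (n · 1#) * c)
    product = D.trans (D.*-congʳ (D.+-congˡ {D.1#} (D.-‿cong (D.sym (dual-^ q (suc k))))))
      (D.trans (DB.absorption k (suc m))
      (D.trans (D.*-congʳ (D.+-congˡ {D.1#} (D.-‿cong (dual-^ q (suc k ℕ.+ suc m)))))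
      ( trans (*-congʳ (trans (+-congˡ (-‿cong qᵉ≈1)) (-‿inverseʳ 1#))) (zeroˡ _)
      , trans (+-cong (trans (*-congʳ (trans (+-congˡ (-‿cong qᵉ≈1)) (-‿inverseʳ 1#))) (zeroˡ _))
              (*-cong (trans (+-identityˡ _) (-‿cong (trans (×-congʳ (suc k ℕ.+ suc m) qᵉ≈1)
                                                            (reflexive (≡.cong (_· 1#) index))))) (proj₁-binom k (suc m))))
              (+-identityˡ _))))
      where
      index : suc k ℕ.+ suc m ≡ n
      index = ≡.cong suc (≡.trans (ℕₚ.+-suc k m) (≡.cong suc k+m≡N))
      qᵉ≈1 : q ^ (suc k ℕ.+ suc m) ≈ 1#
      qᵉ≈1 = trans (^-congʳ q index) qⁿ≈1

    b₁≈0 : b₁ ≈ 0#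
    b₁≈0 = unit-cancel (u (suc k) , v-inverse) (trans (proj₁ product) (sym (zeroʳ _)))

    b₂≈ : b₂ ≈ - (n · 1#) * (u (suc k) * c)
    b₂≈ = unit-cancel (u (suc k) , v-inverse) (begin
      w * b₂                          ≈⟨ +-identityʳ _ ⟨
      w * b₂ + 0#                     ≈⟨ +-congˡ (trans (*-congˡ b₁≈0) (zeroʳ _)) ⟨
      w * b₂ + (0# - suc k · q ^ suc k) * b₁  ≈⟨ proj₂ product ⟩
      - (n · 1#) * c                  ≈⟨ solve 2 (λ a c → a :* c := con (+ 1) :* (a :* c)) refl (- (n · 1#)) c ⟩
      1# * (- (n · 1#) * c)           ≈⟨ *-congʳ v-inverse ⟨
      w * u (suc k) * (- (n · 1#) * c)  ≈⟨ solve 4 (λ w v a c → w :* v :* (a :* c) := w :* (a :* (v :* c))) refl w (u (suc k)) (- (n · 1#)) c ⟩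
      w * (- (n · 1#) * (u (suc k) * c))  ∎)
      where
      w : Carrier
      w = 1# - q ^ suc k

  -- The Pascal rule for [n choose k + 1], whose left-hand side vanishes at the root: consecutive
  -- [n-1 choose k] differ by the factor -q^(-k-1).
  binom-step : ∀ k m → k ℕ.+ m ≡ N → q ^ suc k * binom (suc k) m ≈ - binom k (suc m)
  binom-step k m k+m≡N = begin
    x                                     ≈⟨ solve 2 (λ x b → x := b :+ x :- b) refl x (binom k (suc m)) ⟩
    binom (suc k) (suc m) - binom k (suc m)
      ≈⟨ +-congʳ (trans (sym (proj₁-binom (suc k) (suc m))) (proj₁ (binom-interior k m k+m≡N))) ⟩
    0# - binom k (suc m)                  ≈⟨ +-identityˡ _ ⟩
    - binom k (suc m)                     ∎
    where
    x : Carrier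
    x = q ^ suc k * binom (suc k) m

  -- L k = - (k/3) (-1)^k q^(summandExp k)
  L : ℕ → Carrier
  L k with residue k
  ... | r0 = 0#
  ... | r1 = - (sign k * q ^ summandExp k)
  ... | r2 = sign k * q ^ summandExp k

  L-r0 : ∀ k → residue k ≡ r0 → L k ≈ 0#
  L-r0 k e rewrite e = refl

  L-r1 : ∀ k → residue k ≡ r1 → L k ≈ - (sign k * q ^ summandExp k)
  L-r1 k e rewrite e = refl

  L-r2 : ∀ k → residue k ≡ r2 → L k ≈ sign k * q ^ summandExp k
  L-r2 k e rewrite e = refl

  residue-next : ∀ k {r} → residue k ≡ r → residue (suc k) ≡ next r
  residue-next k e = ≡.trans (residue-suc k) (≡.cong next e)

  L-step₁ : ∀ k → residue k ≡ r1 → L (suc k) ≈ q ^ suc k * L k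
  L-step₁ k e = begin
    L (suc k)
      ≈⟨ L-r2 (suc k) (residue-next k e) ⟩
    - sign k * q ^ summandExp (suc k)
      ≈⟨ *-congˡ (trans (^-congʳ q (summandExp-step₁ k e)) (^-homo-* q (suc k) (summandExp k))) ⟩
    - sign k * (q ^ suc k * q ^ summandExp k)
      ≈⟨ solve 3 (λ s x y → :- s :* (x :* y) := x :* :- (s :* y)) refl (sign k) (q ^ suc k) (q ^ summandExp k) ⟩
    q ^ suc k * - (sign k * q ^ summandExp k)
      ≈⟨ *-congˡ (L-r1 k e) ⟨
    q ^ suc k * L k  ∎

  L-step₂ : ∀ k → residue k ≡ r2 → L (2 ℕ.+ k) ≈ - (q * L k)
  L-step₂ k e = begin
    L (2 ℕ.+ k)
      ≈⟨ L-r1 (2 ℕ.+ k) (residue-next (suc k) (residue-next k e)) ⟩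
    - (- - sign k * q ^ summandExp (2 ℕ.+ k))
      ≈⟨ -‿cong (*-congˡ (^-congʳ q (summandExp-step₂ k e))) ⟩
    - (- - sign k * (q * q ^ summandExp k))
      ≈⟨ solve 3 (λ s q x → :- (:- :- s :* (q :* x)) := :- (q :* (s :* x))) refl (sign k) q (q ^ summandExp k) ⟩
    - (q * (sign k * q ^ summandExp k))
      ≈⟨ -‿cong (*-congˡ (L-r2 k e)) ⟨
    - (q * L k)  ∎

  -- For n ≡ 1 (mod 3) these are the pentagonal weights, for n ≡ 2 their transpose.
  record Weights : Set where
    field
      V̂     : ℕ → ℕ → D.Carrier
      V     : ℕ → ℕ → Carrier
      V̂↦V   : ∀ k m → proj₁ (V̂ k m) ≈ V k m
      -- The weights vanish at the multiples of 3; the next two fields pass from one index prime to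
      -- 3 to the next, from 3i + 1 to 3i + 2 and from 3i + 2 to 3i + 4.
      V-r0  : ∀ k m → k ℕ.+ m ≡ n → residue k ≡ r0 → V k m ≈ 0#
      V-r1  : ∀ k m → k ℕ.+ suc m ≡ n → residue k ≡ r1 → q ^ m * V (suc k) m ≈ - (q ^ k * V k (suc m))
      V-r2  : ∀ k m → k ℕ.+ (2 ℕ.+ m) ≡ n → residue k ≡ r2 → q ^ m * V (2 ℕ.+ k) m ≈ - (q ^ k * V k (2 ℕ.+ m))
      total : DS.diag n (λ k m → V̂ k m D.* DB.binom k m) D.≈ DB.sign n
      end₀  : V̂ 0 n D.≈ D.0#
      -- The outermost exponent is n · `ratio` / 2, and `ratio` may be odd; hence the factor 2 in
      -- the results below.
      p     : ℕ
      endₙ  : V̂ n 0 D.≈ D.- (q̂ DExp.^ p)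
      ratio : ℕ
      2p≡   : 2 ℕ.* p ≡ n ℕ.* ratio

  LSum : Carrier
  LSum = diag N (λ k _ → L (suc k) * u (suc k))

  module FromWeights (W : Weights) where
    open Weights W

    interiorSum : Carrier
    interiorSum = diag N (λ k m → V (suc k) (suc m) * (u (suc k) * binom k (suc m)))

    dualTerm : ℕ → ℕ → D.Carrier
    dualTerm k m = V̂ k m D.* DB.binom k m

    dualInterior : D.Carrier
    dualInterior = DS.diag N (λ k m → dualTerm (suc k) (suc m))

    dual-sum : dualInterior D.+ V̂ n 0 D.≈ (sign n , 0#)
    dual-sum =
      D.trans (D.+-congˡ {dualInterior} (D.sym (D.*-identityʳ (V̂ n 0))))
      (D.trans (D.sym (DS.diag-last N (λ k m → dualTerm (suc k) m)))
      (D.trans (D.sym (D.+-identityˡ _))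
      (D.trans (D.+-congʳ (D.sym (D.trans (D.*-congʳ end₀) (D.zeroˡ (DB.binom 0 n)))))
      (D.trans total (sign-constant n)))))

    interior-term : ∀ k m → k ℕ.+ m ≡ N → V̂ (suc k) (suc m) D.* DB.binom (suc k) (suc m)
      D.≈ (0# , - (n · 1#) * (V (suc k) (suc m) * (u (suc k) * binom k (suc m))))
    interior-term k m k+m≡N = D.trans (D.*-congˡ {V̂ (suc k) (suc m)} (binom-interior k m k+m≡N))
      ( zeroʳ _
      , trans (+-cong (*-congʳ (V̂↦V (suc k) (suc m))) (zeroʳ _))
          (solve 3 (λ v a y → v :* (a :* y) :+ con (+ 0) := a :* (v :* y)) refl
            (V (suc k) (suc m)) (- (n · 1#)) (u (suc k) * binom k (suc m))) )

    interior-dual : dualInterior D.≈ (0# , - (n · 1#) * interiorSum)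
    interior-dual = D.trans (DS.diag-cong N interior-term)
      ( trans (proj₁-diag N _) (diag-zero N)
      , trans (proj₂-diag N _) (diag-* N (- (n · 1#)) (λ k m → V (suc k) (suc m) * (u (suc k) * binom k (suc m)))) )
      where
      diag-zero : ∀ l → diag l (λ _ _ → 0#) ≈ 0#
      diag-zero zero    = refl
      diag-zero (suc l) = trans (+-identityˡ _) (diag-zero l)

    endₙ-dual : V̂ n 0 D.≈ (- (q ^ p) , - (p · q ^ p))
    endₙ-dual = D.trans endₙ (D.-‿cong (dual-^ q p))

    -- The ε-free component, in which the interior binomials vanish and only the outermost term
    -- remains.
    sign-n : sign n ≈ - (q ^ p)
    sign-n = begin
      sign n                          ≈⟨ proj₁ dual-sum ⟨
      proj₁ (dualInterior) + proj₁ (V̂ n 0)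
                                      ≈⟨ +-cong (proj₁ interior-dual) (proj₁ endₙ-dual) ⟩
      0# + - (q ^ p)                  ≈⟨ +-identityˡ _ ⟩
      - (q ^ p)                       ∎

    V-end : V n 0 ≈ - (q ^ p)
    V-end = trans (sym (V̂↦V n 0)) (proj₁ endₙ-dual)

    -- The ε-component of the identity, divided by n.
    2·interiorSum : 2 · interiorSum ≈ - (ratio · q ^ p)
    2·interiorSum = x∙y⁻¹≈ε⇒x≈y _ _ (torsionFree (suc N) _ (begin
      n · (2 · Z - - (ratio · x))
        ≈⟨ ·-as-* n _ ⟩
      ν * (2 · Z - - (ratio · x))
        ≈⟨ *-congˡ (+-cong (·-as-* 2 Z) (trans (-‿involutive _) (·-as-* ratio x))) ⟩
      ν * ((1# + (1# + 0#)) * Z + ratio · 1# * x)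
        ≈⟨ solve 4 (λ ν Z r x → ν :* ((con (+ 1) :+ (con (+ 1) :+ con (+ 0))) :* Z :+ r :* x)
                             := con (+ 2) :* (ν :* Z) :+ ν :* (r :* x)) refl ν Z (ratio · 1#) x ⟩
      (1# + 1#) * (ν * Z) + ν * (ratio · 1# * x)
        ≈⟨ +-congˡ (trans (*-congˡ (sym (·-as-* ratio x))) (trans (sym (·-as-* n _)) (×-assocˡ x n ratio))) ⟩
      (1# + 1#) * (ν * Z) + (n ℕ.* ratio) · x
        ≈⟨ +-congˡ (reflexive (≡.cong (_· x) (≡.sym 2p≡))) ⟩
      (1# + 1#) * (ν * Z) + (2 ℕ.* p) · x
        ≈⟨ +-congˡ (sym (×-assocˡ x 2 p)) ⟩
      (1# + 1#) * (ν * Z) + (p · x + (p · x + 0#))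
        ≈⟨ solve 3 (λ ν Z y → con (+ 2) :* (ν :* Z) :+ (y :+ (y :+ con (+ 0)))
                           := con (ℤ.- + 2) :* (:- ν :* Z :+ :- y)) refl ν Z (p · x) ⟩
      - (1# + 1#) * (- ν * Z + - (p · x))
        ≈⟨ *-congˡ (+-cong (proj₂ interior-dual) (proj₂ endₙ-dual)) ⟨
      - (1# + 1#) * (proj₂ (dualInterior) + proj₂ (V̂ n 0))
        ≈⟨ *-congˡ (proj₂ dual-sum) ⟩
      - (1# + 1#) * 0#
        ≈⟨ zeroʳ _ ⟩
      0#  ∎))
      where
      ν x Z : Carrier
      ν = n · 1#
      x = q ^ p
      Z = interiorSum

    K : Carrier
    K = V 1 (suc N)

    -- Both sides satisfy the same recursion from one index prime to 3 to the next.
    Chain : ℕ → ℕ → Set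
    Chain k m = V (suc k) m * binom k m ≈ K * L (suc k)

    chain-zero : ∀ k m → suc k ℕ.+ m ≡ n → residue (suc k) ≡ r0 → Chain k m
    chain-zero k m k+m e = begin
      V (suc k) m * binom k m  ≈⟨ *-congʳ (V-r0 (suc k) m k+m e) ⟩
      0# * binom k m           ≈⟨ zeroˡ _ ⟩
      0#                       ≈⟨ zeroʳ K ⟨
      K * 0#                   ≈⟨ *-congˡ (L-r0 (suc k) e) ⟨
      K * L (suc k)            ∎

    chain-step₁ : ∀ k m → k ℕ.+ m ≡ N → residue (suc k) ≡ r1 → Chain k (suc m) → Chain (suc k) m
    chain-step₁ k m k+m≡N e ih = begin
      v′ * b′
        -- Insert q^n = 1 in the form q · q^m · q^(k+1): the recursion of the weights takes q^m, and
        -- `binom-step` takes q^(k+1).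
        ≈⟨ trans (*-congʳ (trans (^-congʳ q index) qⁿ≈1)) (*-identityˡ _) ⟨
      q ^ (suc m ℕ.+ suc k) * (v′ * b′)
        ≈⟨ *-congʳ (^-homo-* q (suc m) (suc k)) ⟩
      q * q ^ m * q ^ suc k * (v′ * b′)
        ≈⟨ solve 5 (λ q x y v b → q :* x :* y :* (v :* b) := q :* ((x :* v) :* (y :* b))) refl q (q ^ m) (q ^ suc k) v′ b′ ⟩
      q * ((q ^ m * v′) * (q ^ suc k * b′))
        ≈⟨ *-congˡ (*-cong (V-r1 (suc k) m (≡.trans (ℕₚ.+-suc (suc k) m) (≡.cong (λ x → suc (suc x)) k+m≡N)) e) (binom-step k m k+m≡N)) ⟩
      q * (- (q ^ suc k * v) * - b)
        ≈⟨ solve 4 (λ q y v b → q :* (:- (y :* v) :* :- b) := q :* y :* (v :* b)) refl q (q ^ suc k) v b ⟩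
      q * q ^ suc k * (v * b)
        ≈⟨ *-congˡ ih ⟩
      q * q ^ suc k * (K * L (suc k))
        ≈⟨ solve 3 (λ x K l → x :* (K :* l) := K :* (x :* l)) refl (q ^ (2 ℕ.+ k)) K (L (suc k)) ⟩
      K * (q ^ (2 ℕ.+ k) * L (suc k))
        ≈⟨ *-congˡ (L-step₁ (suc k) e) ⟨
      K * L (2 ℕ.+ k)  ∎
      where
      v v′ b b′ : Carrier
      v = V (suc k) (suc m)
      v′ = V (2 ℕ.+ k) m
      b = binom k (suc m)
      b′ = binom (suc k) m
      index : suc m ℕ.+ suc k ≡ n
      index = ≡.cong suc (≡.trans (ℕₚ.+-suc m k) (≡.cong suc (≡.trans (ℕₚ.+-comm m k) k+m≡N)))

    chain-step₂ : ∀ k m → k ℕ.+ suc m ≡ N → residue (suc k) ≡ r2 → Chain k (2 ℕ.+ m) → Chain (2 ℕ.+ k) m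
    -- Jumping over a multiple of 3 applies `binom-step` twice, which consumes q^(k+2) and q^(k+1).
    -- The first is supplied by q^n = 1; the second is an extra factor, cancelled as a unit.
    chain-step₂ k m k+m≡N e ih = unit-cancel (^-unit (suc N) qⁿ≈1 (suc k)) (begin
      y * (v′ * b″)
        ≈⟨ *-congˡ (trans (*-congʳ (trans (^-congʳ q index) qⁿ≈1)) (*-identityˡ _)) ⟨
      y * (q ^ (suc m ℕ.+ (2 ℕ.+ k)) * (v′ * b″))
        ≈⟨ *-congˡ (*-congʳ (^-homo-* q (suc m) (2 ℕ.+ k))) ⟩
      y * (q * q ^ m * q ^ (2 ℕ.+ k) * (v′ * b″))
        ≈⟨ solve 6 (λ q x y z v b → y :* (q :* x :* z :* (v :* b)) := q :* ((x :* v) :* (y :* (z :* b)))) refl q (q ^ m) y (q ^ (2 ℕ.+ k)) v′ b″ ⟩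
      q * ((q ^ m * v′) * (y * (q ^ (2 ℕ.+ k) * b″)))
        ≈⟨ *-congˡ (*-cong
             (V-r2 (suc k) m (≡.trans (ℕₚ.+-suc (suc k) (suc m)) (≡.cong (λ x → suc (suc x)) k+m≡N)) e)
             (trans (*-congˡ (binom-step (suc k) m (≡.trans (≡.sym (ℕₚ.+-suc k m)) k+m≡N)))
                    (trans (solve 2 (λ y b → y :* :- b := :- (y :* b)) refl y b′)
                           (-‿cong (binom-step k (suc m) k+m≡N))))) ⟩
      q * (- (y * v) * - - b)
        ≈⟨ solve 4 (λ q y v b → q :* (:- (y :* v) :* :- :- b) := :- (q :* (y :* (v :* b)))) refl q y v b ⟩
      - (q * (y * (v * b)))
        ≈⟨ -‿cong (*-congˡ (*-congˡ ih)) ⟩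
      - (q * (y * (K * L (suc k))))
        ≈⟨ solve 4 (λ q y K l → :- (q :* (y :* (K :* l))) := y :* (K :* :- (q :* l))) refl q y K (L (suc k)) ⟩
      y * (K * - (q * L (suc k)))
        ≈⟨ *-congˡ (*-congˡ (L-step₂ (suc k) e)) ⟨
      y * (K * L (3 ℕ.+ k))  ∎)
      where
      y v v′ b b′ b″ : Carrier
      y = q ^ suc k
      v = V (suc k) (2 ℕ.+ m)
      v′ = V (3 ℕ.+ k) m
      b = binom k (2 ℕ.+ m)
      b′ = binom (suc k) (suc m)
      b″ = binom (2 ℕ.+ k) m
      index : suc m ℕ.+ (2 ℕ.+ k) ≡ n
      index = ≡.trans (ℕₚ.+-comm (suc m) (2 ℕ.+ k)) (≡.cong (λ x → suc (suc x)) k+m≡N)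

    chain-next : ∀ k m → k ℕ.+ suc m ≡ N → Chain k (2 ℕ.+ m) → Chain (suc k) (suc m) → Chain (2 ℕ.+ k) m
    chain-next k m k+m ih₂ ih₁ = byResidue (residue (suc k)) ≡.refl
      where
      k+m′ : suc k ℕ.+ m ≡ N
      k+m′ = ≡.trans (≡.sym (ℕₚ.+-suc k m)) k+m
      byResidue : ∀ r → residue (suc k) ≡ r → Chain (2 ℕ.+ k) m
      byResidue r0 e = chain-step₁ (suc k) m k+m′ (residue-next (suc k) e) ih₁
      byResidue r1 e = chain-zero (2 ℕ.+ k) m (≡.cong (λ x → suc (suc x)) k+m′)
        (residue-next (2 ℕ.+ k) (residue-next (suc k) e))
      byResidue r2 e = chain-step₂ k m k+m e ih₂

    chain : ∀ k m → k ℕ.+ m ≡ suc N → Chain k m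
    -- The sign in `L` makes `L 1` equal to 1, so `K` is the weight at index 1.
    chain zero m ≡.refl = *-congˡ (sym (begin
      - (- 1# * 1#)  ≈⟨ solve 0 (:- (:- con (+ 1) :* con (+ 1)) := con (+ 1)) refl ⟩
      1#             ∎))
    chain (suc zero) m k+m = chain-step₁ 0 m (ℕₚ.suc-injective k+m) ≡.refl (chain zero (suc m) k+m)
    chain (suc (suc k)) m k+m = chain-next k m (≡.trans (ℕₚ.+-suc k m) (ℕₚ.suc-injective k+m))
      (chain k (suc (suc m)) (≡.trans (ℕₚ.+-suc k (suc m)) (≡.trans (≡.cong suc (ℕₚ.+-suc k m)) k+m)))
      (chain (suc k) (suc m) (≡.trans (≡.cong suc (ℕₚ.+-suc k m)) k+m))

    K-L-end : K * L n ≈ - (q ^ p)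
    K-L-end = trans (sym (chain (suc N) 0 (ℕₚ.+-identityʳ (suc N)))) (trans (*-identityʳ _) V-end)

    -- The chain at its last index makes K · `L n` equal to -q^p, and powers of q are units; this
    -- avoids evaluating K.
    K-unit : isUnit K
    K-unit = L n * - proj₁ unit , (begin
      K * (L n * - proj₁ unit)   ≈⟨ *-assoc _ _ _ ⟨
      K * L n * - proj₁ unit     ≈⟨ *-congʳ K-L-end ⟩
      - (q ^ p) * - proj₁ unit   ≈⟨ solve 2 (λ x y → :- x :* :- y := x :* y) refl (q ^ p) (proj₁ unit) ⟩
      q ^ p * proj₁ unit         ≈⟨ proj₂ unit ⟩
      1#                         ∎)
      where
      unit : isUnit (q ^ p)
      unit = ^-unit (suc N) qⁿ≈1 p

    interiorSum-K : interiorSum ≈ K * LSum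
    interiorSum-K = trans (diag-cong N term) (diag-* N K (λ k _ → L (suc k) * u (suc k)))
      where
      term : ∀ k m → k ℕ.+ m ≡ N → V (suc k) (suc m) * (u (suc k) * binom k (suc m)) ≈ K * (L (suc k) * u (suc k))
      term k m k+m≡N = begin
        V (suc k) (suc m) * (u (suc k) * binom k (suc m))
          ≈⟨ solve 3 (λ v u b → v :* (u :* b) := v :* b :* u) refl (V (suc k) (suc m)) (u (suc k)) (binom k (suc m)) ⟩
        V (suc k) (suc m) * binom k (suc m) * u (suc k)
          ≈⟨ *-congʳ (chain k (suc m) (≡.trans (ℕₚ.+-suc k m) (≡.cong suc k+m≡N))) ⟩
        K * L (suc k) * u (suc k)
          ≈⟨ *-assoc _ _ _ ⟩
        K * (L (suc k) * u (suc k))  ∎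

    -- Both the interior sum and the outermost term -q^p are K times something, namely `LSum` and
    -- `L n`, so K cancels.
    2·LSum : 2 · LSum ≈ ratio · L n
    2·LSum = unit-cancel K-unit (begin
      K * (2 · LSum)         ≈⟨ ×-comm-* 2 K LSum ⟩
      2 · (K * LSum)         ≈⟨ ×-congʳ 2 interiorSum-K ⟨
      2 · interiorSum        ≈⟨ 2·interiorSum ⟩
      - (ratio · q ^ p)      ≈⟨ solve 1 (λ x → :- x := con (ℤ.- + 1) :* x) refl _ ⟩
      - 1# * (ratio · q ^ p) ≈⟨ ×-comm-* ratio (- 1#) (q ^ p) ⟩
      ratio · (- 1# * q ^ p) ≈⟨ ×-congʳ ratio (solve 1 (λ x → con (ℤ.- + 1) :* x := :- x) refl (q ^ p)) ⟩
      ratio · - (q ^ p)      ≈⟨ ×-congʳ ratio K-L-end ⟨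
      ratio · (K * L n)      ≈⟨ ×-comm-* ratio K (L n) ⟨
      K * (ratio · L n)      ∎)

  weight-step₁ : ∀ k m → residueΔ k m ≡ r2 → q ^ m * weight (suc k) m ≈ - (q ^ k * weight k (suc m))
  weight-step₁ k m e = +-inverseˡ-unique _ _ (weight-step k m e)

  -- Both ends of `weight-step` are moved outwards by one index within the same j; each move costs a
  -- sign.
  weight-step₂ : ∀ k m → residueΔ k m ≡ r2 → q ^ m * weight (2 ℕ.+ k) m ≈ - (q ^ k * weight k (2 ℕ.+ m))
  weight-step₂ k m e = begin
    q ^ m * weight (2 ℕ.+ k) m
      ≈⟨ *-congˡ (weight-flat (suc k) m (≡.trans (residueΔ-sucˡ k m) (≡.cong next e))) ⟩
    q ^ m * - weight (suc k) m
      ≈⟨ solve 2 (λ x w → x :* :- w := :- (x :* w)) refl (q ^ m) (weight (suc k) m) ⟩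
    - (q ^ m * weight (suc k) m)
      ≈⟨ -‿cong (weight-step₁ k m e) ⟩
    - - (q ^ k * weight k (suc m))
      ≈⟨ -‿cong (-‿cong (*-congˡ (weight-suc k (suc m)))) ⟨
    - - (q ^ k * weight (suc k) (2 ℕ.+ m))
      ≈⟨ -‿cong (-‿cong (*-congˡ (weight-flat k (2 ℕ.+ m) flat))) ⟩
    - - (q ^ k * - weight k (2 ℕ.+ m))
      ≈⟨ solve 2 (λ x w → :- :- (x :* :- w) := :- (x :* w)) refl (q ^ k) (weight k (2 ℕ.+ m)) ⟩
    - (q ^ k * weight k (2 ℕ.+ m))  ∎
    where
    flat : residueΔ k (2 ℕ.+ m) ≡ r0
    flat = ≡.trans (residueΔ-sucʳ k (suc m)) (≡.cong (λ r → next (next r))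
             (≡.trans (residueΔ-sucʳ k m) (≡.cong (λ r → next (next r)) e)))

  residueΔ-n : ∀ k m {x z} → k ℕ.+ m ≡ n → residue k ≡ x → residue n ≡ z → residueΔ k m ≡ x ⊕ x ⊕ neg z
  residueΔ-n k m k+m x z = residueΔ-from k m x (≡.trans (≡.cong residue k+m) z)

  weights₁ : residue n ≡ r1 → ∀ M → 2 ℕ.* posExp n ≡ n ℕ.* M → Weights
  weights₁ n≡1 M 2p = record
    { V̂ = DB.weight
    ; V = weight
    ; V̂↦V = proj₁-weight
    ; V-r0 = λ k m k+m e → weight-r2 k m (residueΔ-n k m k+m e n≡1)
    ; V-r1 = λ k m k+m e → weight-step₁ k m (residueΔ-predʳ k m (residueΔ-n k (suc m) k+m e n≡1))
    ; V-r2 = λ k m k+m e → weight-step₂ k m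
        (residueΔ-predʳ k m (residueΔ-predʳ k (suc m) (residueΔ-n k (2 ℕ.+ m) k+m e n≡1)))
    ; total = DB.finitePentagonal n
    ; end₀ = DB.weight-val 0 n (≡.cong neg n≡1)
    ; p = posExp n
    ; endₙ = DB.weight-val n 0 (≡.trans (residueΔ-zeroʳ n) n≡1)
    ; ratio = M
    ; 2p≡ = 2p
    }

  -- For n ≡ 2, m - k = n - 2k is ≡ 2 exactly when 3 ∣ k. Swapping the two indices therefore puts
  -- the zero weights at the multiples of 3, as in the case n ≡ 1, and symmetry of the binomials
  -- preserves the total.
  weights₂ : residue n ≡ r2 → ∀ M → 2 ℕ.* negExp n ≡ n ℕ.* M → Weights
  weights₂ n≡2 M 2p = record
    { V̂ = λ k m → DB.weight m k
    ; V = λ k m → weight m k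
    ; V̂↦V = λ k m → proj₁-weight m k
    ; V-r0 = λ k m k+m e → weight-r2 m k (flip k m (residueΔ-n k m k+m e n≡2))
    ; V-r1 = λ k m k+m e → +-inverseʳ-unique _ _ (weight-step m k
        (residueΔ-predˡ m k (flip k (suc m) (residueΔ-n k (suc m) k+m e n≡2))))
    ; V-r2 = λ k m k+m e → trans (sym (-‿involutive _)) (-‿cong (sym (weight-step₂ m k
        (residueΔ-predˡ m k (residueΔ-predˡ (suc m) k (flip k (2 ℕ.+ m) (residueΔ-n k (2 ℕ.+ m) k+m e n≡2)))))))
    ; total = D.trans (DS.diag-cong n (λ k m _ → D.*-congˡ {DB.weight m k} (DB.binom-sym k m)))
        (D.trans (DS.diag-flip n (λ k m → DB.weight k m D.* DB.binom k m)) (DB.finitePentagonal n))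
    ; end₀ = DB.weight-val n 0 (≡.trans (residueΔ-zeroʳ n) n≡2)
    ; p = negExp n
    ; endₙ = DB.weight-val 0 n (≡.cong neg n≡2)
    ; ratio = M
    ; 2p≡ = 2p
    }
    where
    flip : ∀ k m {r} → residueΔ k m ≡ r → residueΔ m k ≡ neg r
    flip k m e = ≡.trans (residueΔ-flip k m) (≡.cong neg e)

  -- `sign-n` trades the sign (-1)^n in `L n` for -q^p, which leaves a pure power of q.
  2·LSum-r1 : residue n ≡ r1 → ∀ M → 2 ℕ.* posExp n ≡ n ℕ.* M → 2 · LSum ≈ M · q ^ (posExp n ℕ.+ summandExp n)
  2·LSum-r1 n≡1 M 2p = trans 2·LSum (×-congʳ M (begin
    L n                                     ≈⟨ L-r1 n n≡1 ⟩
    - (sign n * q ^ summandExp n)           ≈⟨ -‿cong (*-congʳ sign-n) ⟩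
    - (- (q ^ posExp n) * q ^ summandExp n) ≈⟨ solve 2 (λ x y → :- (:- x :* y) := x :* y) refl _ _ ⟩
    q ^ posExp n * q ^ summandExp n         ≈⟨ ^-homo-* q (posExp n) (summandExp n) ⟨
    q ^ (posExp n ℕ.+ summandExp n)         ∎))
    where open FromWeights (weights₁ n≡1 M 2p) using (2·LSum; sign-n)

  2·LSum-r2 : residue n ≡ r2 → ∀ M → 2 ℕ.* negExp n ≡ n ℕ.* M → 2 · LSum ≈ M · - (q ^ (negExp n ℕ.+ summandExp n))
  2·LSum-r2 n≡2 M 2p = trans 2·LSum (×-congʳ M (begin
    L n                                     ≈⟨ L-r2 n n≡2 ⟩
    sign n * q ^ summandExp n               ≈⟨ *-congʳ sign-n ⟩
    - (q ^ negExp n) * q ^ summandExp n     ≈⟨ solve 2 (λ x y → :- x :* y := :- (x :* y)) refl _ _ ⟩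
    - (q ^ negExp n * q ^ summandExp n)     ≈⟨ -‿cong (^-homo-* q (negExp n) (summandExp n)) ⟨
    - (q ^ (negExp n ℕ.+ summandExp n))     ∎))
    where open FromWeights (weights₂ n≡2 M 2p) using (2·LSum; sign-n)

  -- The case 3 ∣ n: reflection k ↦ n - k.

  binom-closed : ∀ k m → k ℕ.+ m ≡ suc N → q ^ triangular k * binom k m ≈ sign k
  binom-closed zero    m k+m = *-identityʳ 1#
  binom-closed (suc k) m k+m = begin
    q ^ triangular (suc k) * binom (suc k) m
      ≈⟨ *-congʳ (^-homo-* q (suc k) (triangular k)) ⟩
    q ^ suc k * q ^ triangular k * binom (suc k) m
      ≈⟨ solve 3 (λ x y b → x :* y :* b := y :* (x :* b)) refl (q ^ suc k) (q ^ triangular k) (binom (suc k) m) ⟩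
    q ^ triangular k * (q ^ suc k * binom (suc k) m)
      ≈⟨ *-congˡ (binom-step k m (ℕₚ.suc-injective k+m)) ⟩
    q ^ triangular k * - binom k (suc m)
      ≈⟨ solve 2 (λ y b → y :* :- b := :- (y :* b)) refl (q ^ triangular k) (binom k (suc m)) ⟩
    - (q ^ triangular k * binom k (suc m))
      ≈⟨ -‿cong (binom-closed k (suc m) (≡.trans (ℕₚ.+-suc k m) k+m)) ⟩
    - sign k  ∎

  q^triangular : q ^ triangular (suc N) ≈ sign (suc N)
  q^triangular = trans (sym (*-identityʳ _)) (binom-closed (suc N) 0 (ℕₚ.+-identityʳ (suc N)))

  sign² : ∀ k → sign k * sign k ≈ 1#
  sign² zero    = *-identityˡ 1#
  sign² (suc k) = trans (solve 1 (λ s → :- s :* :- s := s :* s) refl (sign k)) (sign² k)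

  module DivisibleByThree (i : ℕ) (N≡ : N ≡ 1 ℕ.+ i ℕ.* 3) where

    -- The reflection at the pair N and 2, where q^N q² = 1; it comes from [n-1 choose n-1] = 1 in
    -- closed form.
    reflectionBase : sign N * q ^ summandExp N ≈ - 1#
    reflectionBase = begin
      sign N * q ^ summandExp N
        ≈⟨ *-congˡ (^-period {q} {n} qⁿ≈1 (summandExp N) (suc i)) ⟨
      sign N * q ^ (summandExp N ℕ.+ n ℕ.* suc i)
        ≈⟨ *-congˡ (^-congʳ q index) ⟨
      sign N * q ^ triangular (suc N)
        ≈⟨ *-congˡ q^triangular ⟩
      sign N * - sign N
        ≈⟨ solve 1 (λ s → s :* :- s := :- (s :* s)) refl (sign N) ⟩
      - (sign N * sign N)
        ≈⟨ -‿cong (sign² N) ⟩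
      - 1#  ∎
      where
      index : triangular (suc N) ≡ summandExp N ℕ.+ n ℕ.* suc i
      index = ≡.subst (λ N → triangular (suc N) ≡ summandExp N ℕ.+ (2 ℕ.+ N) ℕ.* suc i) (≡.sym N≡) (triangular-summandExp i)

    n≡0 : residue n ≡ r0
    n≡0 = ≡.subst (λ N → residue (2 ℕ.+ N) ≡ r0) (≡.sym N≡) (lemma i)
      where
      lemma : ∀ i → residue (3 ℕ.+ i ℕ.* 3) ≡ r0
      lemma zero    = ≡.refl
      lemma (suc i) = lemma i

    Reflection : ℕ → ℕ → Set
    Reflection k m = q ^ k * (sign m * q ^ summandExp m) ≈ - (sign k * q ^ summandExp k)

    -- Induction on m in steps of 3, with k moving the opposite way, down to the pair N and 2.
    reflection : ∀ k m → residue k ≡ r1 → residue m ≡ r2 → k ℕ.+ m ≡ n → Reflection k m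
    reflection k 0 k≡1 ()
    reflection k 1 k≡1 ()
    reflection k 2 k≡1 m≡2 k+m = begin
      q ^ k * (- - 1# * q ^ 2)
        ≈⟨ solve 2 (λ x y → x :* (:- :- con (+ 1) :* y) := x :* y) refl (q ^ k) (q ^ 2) ⟩
      q ^ k * q ^ 2
        ≈⟨ ^-homo-* q k 2 ⟨
      q ^ (k ℕ.+ 2)
        ≈⟨ trans (^-congʳ q k+m) qⁿ≈1 ⟩
      1#
        ≈⟨ -‿involutive 1# ⟨
      - - 1#
        ≈⟨ -‿cong reflectionBase ⟨
      - (sign N * q ^ summandExp N)
        ≡⟨ ≡.cong (λ k → - (sign k * q ^ summandExp k)) (≡.sym k≡N) ⟩
      - (sign k * q ^ summandExp k)  ∎
      where
      k≡N : k ≡ N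
      k≡N = ℕₚ.+-cancelʳ-≡ 2 k N (≡.trans k+m (ℕₚ.+-comm 2 N))
    reflection k (suc (suc (suc m))) k≡1 m≡2 k+m = begin
      q ^ k * (- - - sign m * q ^ summandExp (3 ℕ.+ m))
        ≈⟨ *-congˡ (*-congˡ (trans (^-congʳ q (summandExp-r2 m m≡2)) (^-homo-* q (4 ℕ.+ m) (summandExp m)))) ⟩
      q ^ k * (- - - s * (q * (q * (q * (q * q ^ m))) * x))
        ≈⟨ solve 5 (λ q k s m x → k :* (:- :- :- s :* (q :* (q :* (q :* (q :* m))) :* x))
                               := :- (q :* m :* (q :* (q :* (q :* k)) :* (s :* x)))) refl q (q ^ k) s (q ^ m) x ⟩
      - (q * q ^ m * (q ^ (3 ℕ.+ k) * (s * x)))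
        ≈⟨ -‿cong (*-congˡ (reflection (3 ℕ.+ k) m k≡1 m≡2 shifted)) ⟩
      - (q * q ^ m * - (- - - t * q ^ summandExp (3 ℕ.+ k)))
        ≈⟨ -‿cong (*-congˡ (-‿cong (*-congˡ (trans (^-congʳ q (summandExp-r1 k k≡1)) (^-homo-* q (2 ℕ.+ k) (summandExp k)))))) ⟩
      - (q * q ^ m * - (- - - t * (q * (q * q ^ k) * y)))
        ≈⟨ solve 5 (λ q k t m y → :- (q :* m :* :- (:- :- :- t :* (q :* (q :* k) :* y)))
                               := :- (k :* (q :* (q :* (q :* m))) :* (t :* y))) refl q (q ^ k) t (q ^ m) y ⟩
      - (q ^ k * q ^ (3 ℕ.+ m) * (t * y))
        ≈⟨ -‿cong (*-congʳ (trans (sym (^-homo-* q k (3 ℕ.+ m))) (trans (^-congʳ q k+m) qⁿ≈1))) ⟩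
      - (1# * (t * y))
        ≈⟨ -‿cong (*-identityˡ _) ⟩
      - (t * y)  ∎
      where
      s t x y : Carrier
      s = sign m
      t = sign k
      x = q ^ summandExp m
      y = q ^ summandExp k
      shifted : 3 ℕ.+ k ℕ.+ m ≡ n
      shifted = ≡.trans (≡.sym (≡.trans (ℕₚ.+-suc k (2 ℕ.+ m)) (≡.cong suc (≡.trans (ℕₚ.+-suc k (suc m)) (≡.cong suc (ℕₚ.+-suc k m)))))) k+m

    L-reflect₁ : ∀ k m → residue k ≡ r1 → residue m ≡ r2 → k ℕ.+ m ≡ n → q ^ k * L m ≈ L k
    L-reflect₁ k m k≡1 m≡2 k+m = begin
      q ^ k * L m                           ≈⟨ *-congˡ (L-r2 m m≡2) ⟩
      q ^ k * (sign m * q ^ summandExp m)   ≈⟨ reflection k m k≡1 m≡2 k+m ⟩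
      - (sign k * q ^ summandExp k)         ≈⟨ L-r1 k k≡1 ⟨
      L k                                   ∎

    L-reflect : ∀ k m → k ℕ.+ m ≡ n → q ^ k * L m ≈ L k
    L-reflect k m k+m = cases (residue k) (residue m) ≡.refl ≡.refl (≡.trans (≡.sym (residue-+ k m)) (≡.trans (≡.cong residue k+m) n≡0))
      where
      cases : ∀ x y → residue k ≡ x → residue m ≡ y → residue k ⊕ residue m ≡ r0 → q ^ k * L m ≈ L k
      cases r0 r0 x y _ = trans (*-congˡ (L-r0 m y)) (trans (zeroʳ _) (sym (L-r0 k x)))
      cases r1 r2 x y _ = L-reflect₁ k m x y k+m
      cases r2 r1 x y _ = begin
        q ^ k * L m              ≈⟨ *-congˡ (L-reflect₁ m k y x (≡.trans (ℕₚ.+-comm m k) k+m)) ⟨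
        q ^ k * (q ^ m * L k)    ≈⟨ *-assoc _ _ _ ⟨
        q ^ k * q ^ m * L k      ≈⟨ *-congʳ (trans (sym (^-homo-* q k m)) (trans (^-congʳ q k+m) qⁿ≈1)) ⟩
        1# * L k                 ≈⟨ *-identityˡ _ ⟩
        L k                      ∎
      cases r0 r1 x y e rewrite x | y with e
      ... | ()
      cases r0 r2 x y e rewrite x | y with e
      ... | ()
      cases r1 r0 x y e rewrite x | y with e
      ... | ()
      cases r1 r1 x y e rewrite x | y with e
      ... | ()
      cases r2 r0 x y e rewrite x | y with e
      ... | ()
      cases r2 r2 x y e rewrite x | y with e
      ... | ()

    -- This is 1/(1 - q^(-j)) = -q^j/(1 - q^j) with j = k + 1, because q^(m+1) = q^(-j).
    u-reflect : ∀ k m → k ℕ.+ m ≡ N → u (suc m) ≈ - (q ^ suc k * u (suc k))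
    u-reflect k m k+m = unit-cancel (u (suc m) , u-inverse m k m+k) (begin
      (1# - y) * u (suc m)
        ≈⟨ u-inverse m k m+k ⟩
      1#
        ≈⟨ u-inverse k m k+m ⟨
      (1# - x) * v
        ≈⟨ solve 2 (λ x v → (con (+ 1) :- x) :* v := :- (x :* v) :+ con (+ 1) :* v) refl x v ⟩
      - (x * v) + 1# * v
        ≈⟨ +-congˡ (*-congʳ (trans (sym (^-homo-* q (suc k) (suc m))) (trans (^-congʳ q index) qⁿ≈1))) ⟨
      - (x * v) + x * y * v
        ≈⟨ solve 3 (λ x y v → :- (x :* v) :+ x :* y :* v := (con (+ 1) :- y) :* :- (x :* v)) refl x y v ⟩
      (1# - y) * - (x * v)  ∎)
      where
      x y v : Carrier
      x = q ^ suc k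
      y = q ^ suc m
      v = u (suc k)
      m+k : m ℕ.+ k ≡ N
      m+k = ≡.trans (ℕₚ.+-comm m k) k+m
      index : suc k ℕ.+ suc m ≡ n
      index = ≡.cong suc (≡.trans (ℕₚ.+-suc k m) (≡.cong suc k+m))

    LSum≈0 : LSum ≈ 0#
    -- Reversing the sum negates it, and 2 can be cancelled; this also covers a middle index k =
    -- n/2, which is paired with itself.
    LSum≈0 = torsionFree 1 LSum (begin
      LSum + (LSum + 0#)   ≈⟨ +-congˡ (trans (+-identityʳ _) antisymmetric) ⟩
      LSum - LSum          ≈⟨ -‿inverseʳ LSum ⟩
      0#                   ∎)
      where
      term : ∀ k m → k ℕ.+ m ≡ N → L (suc m) * u (suc m) ≈ - 1# * (L (suc k) * u (suc k))
      term k m k+m = begin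
        L (suc m) * u (suc m)                 ≈⟨ *-congˡ (u-reflect k m k+m) ⟩
        L (suc m) * - (q ^ suc k * u (suc k)) ≈⟨ solve 3 (λ l x v → l :* :- (x :* v) := con (ℤ.- + 1) :* (x :* l :* v)) refl (L (suc m)) (q ^ suc k) (u (suc k)) ⟩
        - 1# * (q ^ suc k * L (suc m) * u (suc k))
          ≈⟨ *-congˡ (*-congʳ (L-reflect (suc k) (suc m) (≡.cong suc (≡.trans (ℕₚ.+-suc k m) (≡.cong suc k+m))))) ⟩
        - 1# * (L (suc k) * u (suc k))        ∎
      antisymmetric : LSum ≈ - LSum
      antisymmetric = begin
        LSum                                        ≈⟨ diag-flip N (λ k _ → L (suc k) * u (suc k)) ⟨
        diag N (λ _ m → L (suc m) * u (suc m))      ≈⟨ diag-cong N term ⟩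
        diag N (λ k _ → - 1# * (L (suc k) * u (suc k)))  ≈⟨ diag-* N (- 1#) (λ k _ → L (suc k) * u (suc k)) ⟩
        - 1# * LSum                                 ≈⟨ solve 1 (λ x → con (ℤ.- + 1) :* x := :- x) refl LSum ⟩
        - LSum                                      ∎

-- Rational constants and products over divisors.

toℚᵘ-/ : ∀ i d → ℚ.toℚᵘ (i ℚ./ suc d) ℚᵘ.≃ mkℚᵘ i d
toℚᵘ-/ i d = ℚₚ.toℚᵘ-fromℚᵘ (mkℚᵘ i d)


suc/1 : ∀ m → (+ suc m) ℚ./ 1 ≡ 1ℚ ℚ.+ (+ m) ℚ./ 1
suc/1 m = ℚₚ.toℚᵘ-injective (begin
  ℚ.toℚᵘ (+ suc m ℚ./ 1)                 ≈⟨ toℚᵘ-/ (+ suc m) 0 ⟩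
  mkℚᵘ (+ suc m) 0                       ≈⟨ *≡* (solve 1 (λ m → (con (+ 1) :+ m) :* con (+ 1) := (con (+ 1) :* con (+ 1) :+ m :* con (+ 1)) :* con (+ 1)) ≡.refl (+ m)) ⟩
  mkℚᵘ (+ 1) 0 ℚᵘ.+ mkℚᵘ (+ m) 0         ≈⟨ ℚᵘₚ.+-congʳ (mkℚᵘ (+ 1) 0) (toℚᵘ-/ (+ m) 0) ⟨
  ℚ.toℚᵘ 1ℚ ℚᵘ.+ ℚ.toℚᵘ (+ m ℚ./ 1)      ≈⟨ ℚₚ.toℚᵘ-homo-+ 1ℚ (+ m ℚ./ 1) ⟨
  ℚ.toℚᵘ (1ℚ ℚ.+ + m ℚ./ 1)              ∎)
  where
  open SetoidReasoning ℚᵘₚ.≃-setoid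
  open ℤ-Solver

1/suc*suc/1 : ∀ m → (+ 1 ℚ./ suc m) ℚ.* (+ suc m ℚ./ 1) ≡ 1ℚ
1/suc*suc/1 m = ℚₚ.toℚᵘ-injective (begin
  ℚ.toℚᵘ ((+ 1 ℚ./ suc m) ℚ.* (+ suc m ℚ./ 1))         ≈⟨ ℚₚ.toℚᵘ-homo-* (+ 1 ℚ./ suc m) (+ suc m ℚ./ 1) ⟩
  ℚ.toℚᵘ (+ 1 ℚ./ suc m) ℚᵘ.* ℚ.toℚᵘ (+ suc m ℚ./ 1)   ≈⟨ ℚᵘₚ.*-cong (toℚᵘ-/ (+ 1) m) (toℚᵘ-/ (+ suc m) 0) ⟩
  mkℚᵘ (+ 1) m ℚᵘ.* mkℚᵘ (+ suc m) 0                   ≈⟨ *≡* (≡.trans (solve 1 (λ x → con (+ 1) :* x :* con (+ 1) := con (+ 1) :* x) ≡.refl (+ suc m)) (≡.cong (λ x → + 1 ℤ.* + suc x) (≡.sym (ℕₚ.*-identityʳ m)))) ⟩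
  ℚ.toℚᵘ 1ℚ                                            ∎)
  where
  open SetoidReasoning ℚᵘₚ.≃-setoid
  open ℤ-Solver

-- The numerator (n/3)((n/3) - n) is a multiple of 3, so doubling the coefficient of the right-hand
-- side makes it an integer.
/6+/6 : ∀ {z} w → z ≡ + 3 ℤ.* w → (z ℚ./ 6) ℚ.+ (z ℚ./ 6) ≡ w ℚ./ 1
/6+/6 w ≡.refl = ℚₚ.toℚᵘ-injective (begin
  ℚ.toℚᵘ (c ℚ.+ c)                      ≈⟨ ℚₚ.toℚᵘ-homo-+ c c ⟩
  ℚ.toℚᵘ c ℚᵘ.+ ℚ.toℚᵘ c                ≈⟨ ℚᵘₚ.+-cong (toℚᵘ-/ (+ 3 ℤ.* w) 5) (toℚᵘ-/ (+ 3 ℤ.* w) 5) ⟩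
  mkℚᵘ (+ 3 ℤ.* w) 5 ℚᵘ.+ mkℚᵘ (+ 3 ℤ.* w) 5  ≈⟨ *≡* (solve 1 (λ w → (con (+ 3) :* w :* con (+ 6) :+ con (+ 3) :* w :* con (+ 6)) :* con (+ 1) := w :* con (+ 36)) ≡.refl w) ⟩
  mkℚᵘ w 0                              ≈⟨ toℚᵘ-/ w 0 ⟨
  ℚ.toℚᵘ (w ℚ./ 1)                      ∎)
  where
  open SetoidReasoning ℚᵘₚ.≃-setoid
  open ℤ-Solver
  c : ℚ
  c = (+ 3 ℤ.* w) ℚ./ 6

neg/1 : ∀ m → (ℤ.- + m) ℚ./ 1 ≡ ℚ.- (+ m ℚ./ 1)
neg/1 zero    = ≡.refl
neg/1 (suc m) = ≡.refl

constP-algebra : RationalAlgebra polynomialRing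
constP-algebra = record
  { ι   = constP
  ; ι-+ = λ _ _ → ≋-refl
  ; ι-* = λ a b → ∷-cong (≡.sym (ℚₚ.+-identityʳ (a ℚ.* b))) ≋-refl
  ; ι-0 = 0∷[]≋[]
  ; ι-1 = ≋-refl
  }

module _ {P : Pred ℕ 0ℓ} {Q : Pred ℕ 0ℓ} (P? : Decidable P) (Q? : Decidable Q) (P⊆Q : ∀ {k} → P k → Q k) (Φ : ℕ → Poly) where
  open CommutativeRing polynomialRing
  open IntegerCoefficients polynomialRing

  -- Used for the divisors of d among the divisors of n; the cofactor collects the indices that only
  -- `Q?` accepts.
  prodP-filter-mono : ∀ xs → ∃ λ r → prodP (map Φ (filter Q? xs)) ≋ (prodP (map Φ (filter P? xs)) *P r)
  prodP-filter-mono [] = oneP , sym (*-identityʳ oneP)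
  prodP-filter-mono (k ∷ xs) with P? k | Q? k | prodP-filter-mono xs
  ... | yes p | no ¬q | _ = ⊥-elim (¬q (P⊆Q p))
  ... | yes _ | yes _ | r , e = r , trans (*-congˡ {Φ k} e) (sym (*-assoc (Φ k) _ r))
  ... | no _  | yes _ | r , e = Φ k * r , trans (*-congˡ {Φ k} e)
    (solve 3 (λ a b r → a :* (b :* r) := b :* (a :* r)) refl (Φ k) (prodP (map Φ (filter P? xs))) r)
  ... | no _  | no _  | r , e = r , e

prodP-++ : ∀ ps rs → prodP (ps ++ rs) ≋ (prodP ps *P prodP rs)
prodP-++ []       rs = ≋-sym (*P-identityˡ (prodP rs))
prodP-++ (p ∷ ps) rs = ≋-trans (*P-congˡ p (prodP-++ ps rs)) (≋-sym (*P-assoc p (prodP ps) (prodP rs)))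

module _ {P : Pred ℕ 0ℓ} (P? : Decidable P) (Φ : ℕ → Poly) where
  prodFilter : List ℕ → Poly
  prodFilter xs = prodP (map Φ (filter P? xs))

  prodFilter-++ : ∀ xs ys → prodFilter (xs ++ ys) ≋ (prodFilter xs *P prodFilter ys)
  prodFilter-++ xs ys = ≋-trans
    (reflexive (≡.cong prodP (≡.trans (≡.cong (map Φ) (Listₚ.filter-++ P? xs ys)) (Listₚ.map-++ Φ (filter P? xs) (filter P? ys)))))
    (prodP-++ (map Φ (filter P? xs)) (map Φ (filter P? ys)))
    where open CommutativeRing polynomialRing using (reflexive)

  prodFilter-∷ʳ : ∀ m → prodFilter (applyUpTo suc (suc m)) ≋ (prodFilter (applyUpTo suc m) *P prodFilter (suc m ∷ []))
  prodFilter-∷ʳ m = ≋-trans (reflexive (≡.cong prodFilter (≡.sym (Listₚ.applyUpTo-∷ʳ suc m))))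
    (prodFilter-++ (applyUpTo suc m) (suc m ∷ []))
    where open CommutativeRing polynomialRing using (reflexive)

  prodFilter-upTo : ∀ d j → ∃ λ r → prodFilter (applyUpTo suc (j ℕ.+ d)) ≋ (prodFilter (applyUpTo suc d) *P r)
  prodFilter-upTo d zero    = oneP , ≋-trans (≋-sym (*P-identityˡ _)) (*P-comm oneP _)
  prodFilter-upTo d (suc j) with prodFilter-upTo d j
  ... | r , e = r *P rest , ≋-trans (prodFilter-∷ʳ (j ℕ.+ d)) (≋-trans (*P-cong e (≋-refl {rest})) (*P-assoc (prodFilter (applyUpTo suc d)) r rest))
    where
    rest : Poly
    rest = prodFilter (suc (j ℕ.+ d) ∷ [])

divisorsOf-applyUpTo : ∀ m → divisorsOf m ≡ filter (λ d → d ∣? m) (applyUpTo suc m)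
divisorsOf-applyUpTo m = ≡.cong (filter (λ d → d ∣? m)) (Listₚ.map-upTo suc m)

-- The quotient ℚ[q]/(Φₙ) and the invertibility of 1 - q^k.

module CyclotomicQuotient (Φ : ℕ → Poly) (cyclotomic : IsCyclotomicFamily Φ) (N : ℕ) where

  n : ℕ
  n = 2 ℕ.+ N

  open Quotient polynomialRing (Φ n) public using (_∼_; ≈⇒∼; d∼0; quotient)
  open CommutativeRing quotient hiding (zero)
  open IntegerCoefficients quotient
  open PowerFacts quotient
  open DualNumbers quotient
  open Algebra.Properties.Semiring.Exp semiring using (_^_; ^-homo-*; ^-congʳ; ^-assocʳ)
  open Algebra.Properties.Semiring.Mult semiring using (×-congʳ) renaming (_×_ to _·_)
  open Algebra.Properties.Ring ring using (-0#≈0#)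
  open SetoidReasoning setoid
  private module D = CommutativeRing dualNumbers

  q : Poly
  q = qpow 1

  q^≈qpow : ∀ k → q ^ k ≈ qpow k
  q^≈qpow zero    = refl
  q^≈qpow (suc k) = trans (*-congˡ {q} (q^≈qpow k))
    (≈⇒∼ (≋-trans (shift-*P oneP (qpow k)) (∷-cong ≡.refl (*P-identityˡ (qpow k)))))

  constP-+ : ∀ a b → constP (a ℚ.+ b) ≈ constP a + constP b
  constP-+ a b = refl

  constP-* : ∀ a b → constP (a ℚ.* b) ≈ constP a * constP b
  constP-* a b = ≈⇒∼ (RationalAlgebra.ι-* constP-algebra a b)

  scaleP≈ : ∀ c p → scaleP c p ≈ constP c * p
  scaleP≈ c p = ≈⇒∼ (≋-sym (constP-*P c p))

  ·1≈constP : ∀ m → m · 1# ≈ constP (+ m ℚ./ 1)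
  ·1≈constP zero    = ≈⇒∼ (≋-sym 0∷[]≋[])
  ·1≈constP (suc m) = trans (+-congˡ {1#} (·1≈constP m)) (reflexive (≡.cong constP (≡.sym (suc/1 m))))

  ·1-unit : ∀ m → isUnit (suc m · 1#)
  ·1-unit m = constP (+ 1 ℚ./ suc m) , (begin
    (suc m · 1#) * constP (+ 1 ℚ./ suc m)                 ≈⟨ *-comm (suc m · 1#) _ ⟩
    constP (+ 1 ℚ./ suc m) * (suc m · 1#)                 ≈⟨ *-congˡ {constP (+ 1 ℚ./ suc m)} (·1≈constP (suc m)) ⟩
    constP (+ 1 ℚ./ suc m) * constP (+ suc m ℚ./ 1)       ≈⟨ constP-* (+ 1 ℚ./ suc m) (+ suc m ℚ./ 1) ⟨
    constP ((+ 1 ℚ./ suc m) ℚ.* (+ suc m ℚ./ 1))          ≡⟨ ≡.cong constP (1/suc*suc/1 m) ⟩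
    1#                                                    ∎)

  torsionFree : ∀ m x → suc m · x ≈ 0# → x ≈ 0#
  torsionFree m x e = unit-cancel {suc m · 1#} (·1-unit m) {x} {0#} (trans (sym (·-as-* (suc m) x)) (trans e (sym (zeroʳ (suc m · 1#)))))

  dual-algebra : RationalAlgebra dualNumbers
  dual-algebra = record
    { ι   = λ a → constP a , 0#
    ; ι-+ = λ a b → constP-+ a b , sym (+-identityˡ 0#)
    ; ι-* = λ a b → constP-* a b , sym (trans (+-cong (zeroʳ (constP a)) (zeroˡ (constP b))) (+-identityˡ 0#))
    ; ι-0 = ≈⇒∼ 0∷[]≋[] , refl
    ; ι-1 = refl , refl
    }

  open Evaluation dualNumbers dual-algebra (q , q)

  -- In the quotient `q` is the class of the variable, so evaluation there gives the polynomial
  -- back; consequently `Φ n` evaluates to a multiple of ε.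
  proj₁-eval : ∀ p → proj₁ (eval p) ≈ p
  proj₁-eval []      = refl
  proj₁-eval (a ∷ p) = trans (+-congˡ {constP a} (*-congˡ {q} (proj₁-eval p))) (≈⇒∼
    (≋-trans (+P-cong (≋-refl {constP a}) (≋-trans (shift-*P oneP p) (∷-cong ≡.refl (*P-identityˡ p))))
             (∷-cong (ℚₚ.+-identityʳ a) ≋-refl)))

  prodDivisors : ∀ m → 1 ℕ.≤ m → prodFilter (_∣? m) Φ (applyUpTo suc m) ≋ (qpow m -P oneP)
  prodDivisors m 1≤m = mk≋ λ i → ≡.trans
    (≡.cong (λ l → coeff (prodP (map Φ l)) i) (≡.sym (divisorsOf-applyUpTo m))) (cyclotomic m 1≤m i)

  -- The cofactor G of Φₙ in q^n - 1: the range ends at n - 1, so only proper divisors of n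
  -- contribute.
  properPart : Poly
  properPart = prodFilter (_∣? n) Φ (applyUpTo suc (suc N))

  factorisation : (properPart *P Φ n) ≋ (qpow n -P oneP)
  factorisation = ≋-trans (*P-congˡ properPart (≋-sym last)) (≋-trans
    (≋-sym (prodFilter-∷ʳ (_∣? n) Φ (suc N))) (prodDivisors n (s≤s z≤n)))
    where
    last : prodFilter (_∣? n) Φ (n ∷ []) ≋ Φ n
    last = ≋-trans (mk≋ λ i → ≡.cong (λ l → coeff (prodP (map Φ l)) i) (Listₚ.filter-accept (_∣? n) {n} {[]} ∣-refl))
      (≋-trans (*P-comm (Φ n) oneP) (*P-identityˡ (Φ n)))

  qⁿ≈1 : q ^ n ≈ 1#
  qⁿ≈1 = x∙y⁻¹≈ε⇒x≈y (q ^ n) 1# (begin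
    q ^ n - 1#          ≈⟨ +-congʳ (q^≈qpow n) ⟩
    qpow n - 1#         ≈⟨ ≈⇒∼ factorisation ⟨
    properPart * Φ n    ≈⟨ *-congˡ {properPart} d∼0 ⟩
    properPart * 0#     ≈⟨ zeroʳ properPart ⟩
    0#                  ∎)
    where open Algebra.Properties.Ring ring using (x∙y⁻¹≈ε⇒x≈y)

  -- Evaluating the factorisation at q (1 + ε) amounts to differentiating it; at a root of Φ n
  -- this gives  n = properPart · qΦ′.
  properPart-unit : isUnit properPart
  properPart-unit = isUnit-factorˡ properPart φ (isUnit-cong (sym derivative) (·1-unit (suc N)))
    where
    φ : Poly
    φ = proj₂ (eval (Φ n))

    evaluated : eval properPart D.* eval (Φ n) D.≈ (q ^ n - 1# , n · q ^ n - 0#)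
    evaluated = D.trans (D.sym (eval-* properPart (Φ n)))
      (D.trans (eval-cong (properPart *P Φ n) (qpow n -P oneP) factorisation)
      (D.trans (eval-+ (qpow n) (-P oneP))
      (D.+-cong (D.trans (eval-qpow n) (dual-^ q n)) (D.trans (eval-neg oneP) (D.-‿cong eval-one)))))

    derivative : properPart * φ ≈ n · 1#
    derivative = begin
      properPart * φ
        ≈⟨ +-identityʳ (properPart * φ) ⟨
      properPart * φ + 0#
        -- The zero just added is the other term of the product rule, the derivative of G times
        -- `Φ n`.
        ≈⟨ +-cong (*-congʳ (sym (proj₁-eval properPart)))
             (trans (sym (zeroʳ g′)) (*-congˡ {g′} (sym (trans (proj₁-eval (Φ n)) d∼0)))) ⟩
      proj₁ (eval properPart) * φ + g′ * proj₁ (eval (Φ n))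
        ≈⟨ proj₂ evaluated ⟩
      n · q ^ n - 0#
        ≈⟨ trans (+-congˡ {n · q ^ n} -0#≈0#) (+-identityʳ (n · q ^ n)) ⟩
      n · q ^ n
        ≈⟨ ×-congʳ n qⁿ≈1 ⟩
      n · 1#  ∎
      where
      g′ : Poly
      g′ = proj₂ (eval properPart)

  -- For a proper divisor d of n, every factor of q^d - 1 = ∏ Φ_c (c ∣ d) occurs in properPart.
  1-qᵈ-unit : ∀ d → suc d ∣ n → suc d ℕ.≤ suc N → isUnit (1# - q ^ suc d)
  1-qᵈ-unit d d∣n d≤ = isUnit-neg (1# - q ^ suc d) (isUnit-cong eq
    (isUnit-factorˡ (qpow (suc d) - 1#) r′ (isUnit-factorˡ ((qpow (suc d) - 1#) * r′) r
      (isUnit-cong (≈⇒∼ divisible) properPart-unit))))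
    where
    part : ∃ λ r → prodFilter (_∣? n) Φ (applyUpTo suc ((suc N ∸ suc d) ℕ.+ suc d)) ≋ (prodFilter (_∣? n) Φ (applyUpTo suc (suc d)) *P r)
    part = prodFilter-upTo (_∣? n) Φ (suc d) (suc N ∸ suc d)

    part′ : ∃ λ r → prodFilter (_∣? n) Φ (applyUpTo suc (suc d)) ≋ (prodFilter (_∣? suc d) Φ (applyUpTo suc (suc d)) *P r)
    part′ = prodP-filter-mono (_∣? suc d) (_∣? n) (λ k∣d → ∣-trans k∣d d∣n) Φ (applyUpTo suc (suc d))

    r r′ : Poly
    r = proj₁ part
    r′ = proj₁ part′

    divisible : properPart ≋ (((qpow (suc d) -P oneP) *P r′) *P r)
    divisible = ≋-trans
      (≡.subst (λ m → prodFilter (_∣? n) Φ (applyUpTo suc m) ≋ (prodFilter (_∣? n) Φ (applyUpTo suc (suc d)) *P r))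
        (ℕₚ.m∸n+n≡m d≤) (proj₂ part))
      (*P-cong (≋-trans (proj₂ part′) (*P-cong (prodDivisors (suc d) (s≤s z≤n)) (≋-refl {r′}))) (≋-refl {r}))

    eq : qpow (suc d) - 1# ≈ - (1# - q ^ suc d)
    eq = trans (+-congʳ (sym (q^≈qpow (suc d)))) (solve 1 (λ x → x :- con (+ 1) := :- (con (+ 1) :- x)) refl (q ^ suc d))

  -- Let d = gcd(k + 1, n). By Bézout and q^n = 1, the element 1 - q^(k+1) divides 1 - q^d. Since d
  -- ≤ k + 1 < n, d is a proper divisor of n, and 1 - q^d is a unit by `1-qᵈ-unit`.
  1-qᵏ-unit : ∀ k → k ℕ.≤ N → isUnit (1# - q ^ suc k)
  1-qᵏ-unit k k≤N = fromGCD (gcd (suc k) n) (gcd-GCD (suc k) n)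
    where
    fromBézout : ∀ d → Bézout.Identity d (suc k) n → isUnit (1# - q ^ d) → isUnit (1# - q ^ suc k)
    fromBézout d (Bézout.+- x y eq) unit with 1-x∣1-x^ (q ^ suc k) x
    ... | s , e = isUnit-factorˡ (1# - q ^ suc k) s (isUnit-cong (begin
      1# - q ^ d               ≈⟨ +-congˡ {1#} (-‿cong (^-period {q} {n} qⁿ≈1 d y)) ⟨
      1# - q ^ (d ℕ.+ n ℕ.* y) ≈⟨ +-congˡ {1#} (-‿cong (^-congʳ q index)) ⟩
      1# - q ^ (suc k ℕ.* x)   ≈⟨ +-congˡ {1#} (-‿cong (^-assocʳ q (suc k) x)) ⟨
      1# - (q ^ suc k) ^ x     ≈⟨ e ⟩
      (1# - q ^ suc k) * s     ∎) unit)
      where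
      index : d ℕ.+ n ℕ.* y ≡ suc k ℕ.* x
      index = ≡.trans (≡.cong (d ℕ.+_) (ℕₚ.*-comm n y)) (≡.trans eq (ℕₚ.*-comm x (suc k)))
    fromBézout d (Bézout.-+ x y eq) unit with 1-x∣1-x^ (q ^ suc k) x
    ... | s , e = isUnit-factorˡ (1# - q ^ suc k) (s * - (q ^ d)) (isUnit-cong (begin
      1# - q ^ d                             ≈⟨ +-congʳ { - (q ^ d) } (^-period {q} {n} qⁿ≈1 0 y) ⟨
      q ^ (n ℕ.* y) - q ^ d                  ≈⟨ +-congʳ { - (q ^ d) } (^-congʳ q index) ⟨
      q ^ (d ℕ.+ suc k ℕ.* x) - q ^ d        ≈⟨ +-congʳ { - (q ^ d) } (trans (^-homo-* q d (suc k ℕ.* x)) (*-congˡ {q ^ d} (sym (^-assocʳ q (suc k) x)))) ⟩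
      q ^ d * (q ^ suc k) ^ x - q ^ d        ≈⟨ solve 2 (λ a b → a :* b :- a := (con (+ 1) :- b) :* :- a) refl (q ^ d) ((q ^ suc k) ^ x) ⟩
      (1# - (q ^ suc k) ^ x) * - (q ^ d)     ≈⟨ *-congʳ { - (q ^ d) } e ⟩
      (1# - q ^ suc k) * s * - (q ^ d)       ≈⟨ *-assoc (1# - q ^ suc k) s (- (q ^ d)) ⟩
      (1# - q ^ suc k) * (s * - (q ^ d))     ∎) unit)
      where
      index : d ℕ.+ suc k ℕ.* x ≡ n ℕ.* y
      index = ≡.trans (≡.cong (d ℕ.+_) (ℕₚ.*-comm (suc k) x)) (≡.trans eq (ℕₚ.*-comm y n))

    fromGCD : ∀ d → GCD.GCD (suc k) n d → isUnit (1# - q ^ suc k)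
    fromGCD zero    g with 0∣⇒≡0 (proj₁ (GCD.GCD.commonDivisor g))
    ... | ()
    fromGCD (suc d) g = fromBézout (suc d) (Bézout.identity g)
      (1-qᵈ-unit d (proj₂ (GCD.GCD.commonDivisor g)) (ℕₚ.≤-trans (∣⇒≤ (proj₁ (GCD.GCD.commonDivisor g))) (s≤s k≤N)))

  u : ℕ → Poly
  u zero    = 0#
  u (suc k) with k ℕ.≤? N
  ... | yes k≤N = proj₁ (1-qᵏ-unit k k≤N)
  ... | no  _   = 0#

  u-inverse : ∀ k m → k ℕ.+ m ≡ N → (1# - q ^ suc k) * u (suc k) ≈ 1#
  u-inverse k m k+m≡N with k ℕ.≤? N
  ... | yes k≤N = proj₂ (1-qᵏ-unit k k≤N)
  ... | no  k≰N = ⊥-elim (k≰N (ℕₚ.m+n≤o⇒m≤o k (ℕₚ.≤-reflexive k+m≡N)))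

  root : PrimitiveRoot quotient
  root = record
    { torsionFree = torsionFree
    ; q = q
    ; N = N
    ; qⁿ≈1 = qⁿ≈1
    ; u = u
    ; u-inverse = u-inverse
    }

-- Symbols and floor divisions of the statement in terms of residues.

toℕ : Residue → ℕ
toℕ r0 = 0
toℕ r1 = 1
toℕ r2 = 2

%3≡residue : ∀ k → k % 3 ≡ toℕ (residue k)
%3≡residue 0 = ≡.refl
%3≡residue 1 = ≡.refl
%3≡residue 2 = ≡.refl
%3≡residue (suc (suc (suc k))) = %3≡residue k

leg3-residue : ∀ k {r} → residue k ≡ r → leg3 k ≡ leg3 (toℕ r)
leg3-residue k {r} e rewrite %3≡residue k | e with r
... | r0 = ≡.refl
... | r1 = ≡.refl
... | r2 = ≡.refl

kMinusLeg-r1 : ∀ k → residue k ≡ r1 → kMinusLeg k ≡ k ∸ 1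
kMinusLeg-r1 k e rewrite %3≡residue k | e = ≡.refl

kMinusLeg-r2 : ∀ k → residue k ≡ r2 → kMinusLeg k ≡ suc k
kMinusLeg-r2 k e rewrite %3≡residue k | e = ≡.refl

residue⇒quotient : ∀ k → ∃ λ j → k ≡ toℕ (residue k) ℕ.+ j ℕ.* 3
residue⇒quotient 0 = 0 , ≡.refl
residue⇒quotient 1 = 0 , ≡.refl
residue⇒quotient 2 = 0 , ≡.refl
residue⇒quotient (suc (suc (suc k))) with residue⇒quotient k
... | j , e = suc j , ≡.trans (≡.cong (3 ℕ.+_) e) (lemma (toℕ (residue k)) (j ℕ.* 3))
  where
  open +-*-Solver
  lemma : ∀ a b → 3 ℕ.+ (a ℕ.+ b) ≡ a ℕ.+ (3 ℕ.+ b)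
  lemma = solve 2 (λ a b → con 3 :+ (a :+ b) := a :+ (con 3 :+ b)) ≡.refl

exact-/3 : ∀ {x} y → x ≡ y ℕ.* 3 → x ℕ./ 3 ≡ y
exact-/3 y ≡.refl = m*n/n≡m y 3

exact-/6 : ∀ {x} y → x ≡ y ℕ.* 6 → x ℕ./ 6 ≡ y
exact-/6 y ≡.refl = m*n/n≡m y 6

-- j (3j - 1) / 2 and j (3j + 1) / 2, the values of expoB at 3j + 1 and 3j + 2
pent⁻ pent⁺ : ℕ → ℕ
pent⁻ zero    = 0
pent⁻ (suc j) = 1 ℕ.+ j ℕ.* 3 ℕ.+ pent⁻ j
pent⁺ zero    = 0
pent⁺ (suc j) = 2 ℕ.+ j ℕ.* 3 ℕ.+ pent⁺ j

pent⁻*6 : ∀ j → (j ℕ.* 3) ℕ.* (j ℕ.* 3 ∸ 1) ≡ pent⁻ j ℕ.* 6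
pent⁻*6 zero          = ≡.refl
pent⁻*6 (suc zero)    = ≡.refl
pent⁻*6 (suc (suc j)) = begin
  (6 ℕ.+ j ℕ.* 3) ℕ.* (5 ℕ.+ j ℕ.* 3)
    ≡⟨ solve 1 (λ j → (con 6 :+ j :* con 3) :* (con 5 :+ j :* con 3)
                   := (con 4 :+ j :* con 3) :* con 6 :+ (con 3 :+ j :* con 3) :* (con 2 :+ j :* con 3)) ≡.refl j ⟩
  (4 ℕ.+ j ℕ.* 3) ℕ.* 6 ℕ.+ (3 ℕ.+ j ℕ.* 3) ℕ.* (2 ℕ.+ j ℕ.* 3)
    ≡⟨ ≡.cong ((4 ℕ.+ j ℕ.* 3) ℕ.* 6 ℕ.+_) (pent⁻*6 (suc j)) ⟩
  (4 ℕ.+ j ℕ.* 3) ℕ.* 6 ℕ.+ pent⁻ (suc j) ℕ.* 6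
    ≡⟨ ℕₚ.*-distribʳ-+ 6 (4 ℕ.+ j ℕ.* 3) (pent⁻ (suc j)) ⟨
  pent⁻ (suc (suc j)) ℕ.* 6  ∎
  where
  open ≡.≡-Reasoning
  open +-*-Solver

pent⁺*6 : ∀ j → (1 ℕ.+ j ℕ.* 3) ℕ.* (j ℕ.* 3) ≡ pent⁺ j ℕ.* 6
pent⁺*6 zero    = ≡.refl
pent⁺*6 (suc j) = begin
  (4 ℕ.+ j ℕ.* 3) ℕ.* (3 ℕ.+ j ℕ.* 3)
    ≡⟨ solve 1 (λ j → (con 4 :+ j :* con 3) :* (con 3 :+ j :* con 3)
                   := (con 2 :+ j :* con 3) :* con 6 :+ (con 1 :+ j :* con 3) :* (j :* con 3)) ≡.refl j ⟩
  (2 ℕ.+ j ℕ.* 3) ℕ.* 6 ℕ.+ (1 ℕ.+ j ℕ.* 3) ℕ.* (j ℕ.* 3)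
    ≡⟨ ≡.cong ((2 ℕ.+ j ℕ.* 3) ℕ.* 6 ℕ.+_) (pent⁺*6 j) ⟩
  (2 ℕ.+ j ℕ.* 3) ℕ.* 6 ℕ.+ pent⁺ j ℕ.* 6
    ≡⟨ ℕₚ.*-distribʳ-+ 6 (2 ℕ.+ j ℕ.* 3) (pent⁺ j) ⟨
  pent⁺ (suc j) ℕ.* 6  ∎
  where
  open ≡.≡-Reasoning
  open +-*-Solver

pent⁻+summandExp : ∀ j → (1 ℕ.+ j ℕ.* 3) ℕ.* j ≡ pent⁻ j ℕ.+ summandExp (1 ℕ.+ j ℕ.* 3)
pent⁻+summandExp zero    = ≡.refl
pent⁻+summandExp (suc j) = begin
  (4 ℕ.+ j ℕ.* 3) ℕ.* suc j
    ≡⟨ solve 1 (λ j → (con 4 :+ j :* con 3) :* (con 1 :+ j) := con 4 :+ j :* con 6 :+ (con 1 :+ j :* con 3) :* j) ≡.refl j ⟩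
  4 ℕ.+ j ℕ.* 6 ℕ.+ (1 ℕ.+ j ℕ.* 3) ℕ.* j
    ≡⟨ ≡.cong (4 ℕ.+ j ℕ.* 6 ℕ.+_) (pent⁻+summandExp j) ⟩
  4 ℕ.+ j ℕ.* 6 ℕ.+ (pent⁻ j ℕ.+ summandExp (1 ℕ.+ j ℕ.* 3))
    ≡⟨ solve 3 (λ j p e → con 4 :+ j :* con 6 :+ (p :+ e) := con 1 :+ j :* con 3 :+ p :+ (con 3 :+ j :* con 3 :+ e)) ≡.refl j (pent⁻ j) (summandExp (1 ℕ.+ j ℕ.* 3)) ⟩
  pent⁻ (suc j) ℕ.+ (3 ℕ.+ j ℕ.* 3 ℕ.+ summandExp (1 ℕ.+ j ℕ.* 3))
    ≡⟨ ≡.cong (pent⁻ (suc j) ℕ.+_) (summandExp-r1 (1 ℕ.+ j ℕ.* 3) (residue-1+3* j)) ⟨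
  pent⁻ (suc j) ℕ.+ summandExp (4 ℕ.+ j ℕ.* 3)  ∎
  where
  open ≡.≡-Reasoning
  open +-*-Solver

pent⁺+summandExp : ∀ j → (2 ℕ.+ j ℕ.* 3) ℕ.* suc j ≡ pent⁺ j ℕ.+ summandExp (2 ℕ.+ j ℕ.* 3)
pent⁺+summandExp zero    = ≡.refl
pent⁺+summandExp (suc j) = begin
  (5 ℕ.+ j ℕ.* 3) ℕ.* suc (suc j)
    ≡⟨ solve 1 (λ j → (con 5 :+ j :* con 3) :* (con 2 :+ j) := con 8 :+ j :* con 6 :+ (con 2 :+ j :* con 3) :* (con 1 :+ j)) ≡.refl j ⟩
  8 ℕ.+ j ℕ.* 6 ℕ.+ (2 ℕ.+ j ℕ.* 3) ℕ.* suc j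
    ≡⟨ ≡.cong (8 ℕ.+ j ℕ.* 6 ℕ.+_) (pent⁺+summandExp j) ⟩
  8 ℕ.+ j ℕ.* 6 ℕ.+ (pent⁺ j ℕ.+ summandExp (2 ℕ.+ j ℕ.* 3))
    ≡⟨ solve 3 (λ j p e → con 8 :+ j :* con 6 :+ (p :+ e) := con 2 :+ j :* con 3 :+ p :+ (con 6 :+ j :* con 3 :+ e)) ≡.refl j (pent⁺ j) (summandExp (2 ℕ.+ j ℕ.* 3)) ⟩
  pent⁺ (suc j) ℕ.+ (6 ℕ.+ j ℕ.* 3 ℕ.+ summandExp (2 ℕ.+ j ℕ.* 3))
    ≡⟨ ≡.cong (pent⁺ (suc j) ℕ.+_) (summandExp-r2 (2 ℕ.+ j ℕ.* 3) (residue-2+3* j)) ⟨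
  pent⁺ (suc j) ℕ.+ summandExp (5 ℕ.+ j ℕ.* 3)  ∎
  where
  open ≡.≡-Reasoning
  open +-*-Solver

-- For k = 3j + 1 both divisions are exact, with values kj and j(3j - 1)/2; so q^(`expoB k`) in the
-- denominator of the summand cancels against its numerator.
expoA-expoB-r1 : ∀ k → residue k ≡ r1 → expoA k ≡ expoB k ℕ.+ summandExp k
expoA-expoB-r1 k e with residue⇒quotient k
... | j , k≡ rewrite e | k≡ = begin
  expoA (1 ℕ.+ j ℕ.* 3)
    ≡⟨ exact-/3 ((1 ℕ.+ j ℕ.* 3) ℕ.* j) (≡.trans (≡.cong ((1 ℕ.+ j ℕ.* 3) ℕ.*_) (kMinusLeg-r1 (1 ℕ.+ j ℕ.* 3) (residue-1+3* j)))
         (≡.sym (ℕₚ.*-assoc (1 ℕ.+ j ℕ.* 3) j 3))) ⟩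
  (1 ℕ.+ j ℕ.* 3) ℕ.* j
    ≡⟨ pent⁻+summandExp j ⟩
  pent⁻ j ℕ.+ summandExp (1 ℕ.+ j ℕ.* 3)
    ≡⟨ ≡.cong (ℕ._+ summandExp (1 ℕ.+ j ℕ.* 3)) (exact-/6 (pent⁻ j) (pent⁻*6 j)) ⟨
  expoB (1 ℕ.+ j ℕ.* 3) ℕ.+ summandExp (1 ℕ.+ j ℕ.* 3)  ∎
  where open ≡.≡-Reasoning

expoA-expoB-r2 : ∀ k → residue k ≡ r2 → expoA k ≡ expoB k ℕ.+ summandExp k
expoA-expoB-r2 k e with residue⇒quotient k
... | j , k≡ rewrite e | k≡ = begin
  expoA (2 ℕ.+ j ℕ.* 3)
    ≡⟨ exact-/3 ((2 ℕ.+ j ℕ.* 3) ℕ.* suc j) (≡.trans (≡.cong ((2 ℕ.+ j ℕ.* 3) ℕ.*_) (kMinusLeg-r2 (2 ℕ.+ j ℕ.* 3) (residue-2+3* j)))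
         (≡.sym (ℕₚ.*-assoc (2 ℕ.+ j ℕ.* 3) (suc j) 3))) ⟩
  (2 ℕ.+ j ℕ.* 3) ℕ.* suc j
    ≡⟨ pent⁺+summandExp j ⟩
  pent⁺ j ℕ.+ summandExp (2 ℕ.+ j ℕ.* 3)
    ≡⟨ ≡.cong (ℕ._+ summandExp (2 ℕ.+ j ℕ.* 3)) (exact-/6 (pent⁺ j) (pent⁺*6 j)) ⟨
  expoB (2 ℕ.+ j ℕ.* 3) ℕ.+ summandExp (2 ℕ.+ j ℕ.* 3)  ∎
  where open ≡.≡-Reasoning

2*summandExp-1 : ∀ j → 2 ℕ.* summandExp (1 ℕ.+ j ℕ.* 3) ≡ j ℕ.* 3 ℕ.* suc j
2*summandExp-1 zero    = ≡.refl
2*summandExp-1 (suc j) = begin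
  2 ℕ.* summandExp (4 ℕ.+ j ℕ.* 3)
    ≡⟨ ≡.cong (2 ℕ.*_) (summandExp-r1 (1 ℕ.+ j ℕ.* 3) (residue-1+3* j)) ⟩
  2 ℕ.* (3 ℕ.+ j ℕ.* 3 ℕ.+ summandExp (1 ℕ.+ j ℕ.* 3))
    ≡⟨ ℕₚ.*-distribˡ-+ 2 (3 ℕ.+ j ℕ.* 3) _ ⟩
  2 ℕ.* (3 ℕ.+ j ℕ.* 3) ℕ.+ 2 ℕ.* summandExp (1 ℕ.+ j ℕ.* 3)
    ≡⟨ ≡.cong (2 ℕ.* (3 ℕ.+ j ℕ.* 3) ℕ.+_) (2*summandExp-1 j) ⟩
  2 ℕ.* (3 ℕ.+ j ℕ.* 3) ℕ.+ j ℕ.* 3 ℕ.* suc j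
    ≡⟨ solve 1 (λ j → con 2 :* (con 3 :+ j :* con 3) :+ j :* con 3 :* (con 1 :+ j) := (con 3 :+ j :* con 3) :* (con 2 :+ j)) ≡.refl j ⟩
  suc j ℕ.* 3 ℕ.* suc (suc j)  ∎
  where
  open ≡.≡-Reasoning
  open +-*-Solver

finalExp-1 : ∀ j → let n = 1 ℕ.+ j ℕ.* 3 in posExp n ℕ.+ summandExp n ≡ (n ℕ.* n ∸ 1) ℕ./ 3
finalExp-1 j = ≡.trans (ℕₚ.*-cancelˡ-≡ _ _ 2 (begin
  2 ℕ.* (posExp n ℕ.+ summandExp n)          ≡⟨ ℕₚ.*-distribˡ-+ 2 (posExp n) (summandExp n) ⟩
  2 ℕ.* posExp n ℕ.+ 2 ℕ.* summandExp n      ≡⟨ ≡.cong₂ ℕ._+_ (2*posExp j) (2*summandExp-1 j) ⟩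
  n ℕ.* j ℕ.+ j ℕ.* 3 ℕ.* suc j              ≡⟨ solve 1 (λ j → (con 1 :+ j :* con 3) :* j :+ j :* con 3 :* (con 1 :+ j) := con 2 :* (j :* con 2 :+ j :* j :* con 3)) ≡.refl j ⟩
  2 ℕ.* (j ℕ.* 2 ℕ.+ j ℕ.* j ℕ.* 3)          ∎))
  (≡.sym (exact-/3 (j ℕ.* 2 ℕ.+ j ℕ.* j ℕ.* 3) (≡.cong (_∸ 1)
    (solve 1 (λ j → (con 1 :+ j :* con 3) :* (con 1 :+ j :* con 3) := con 1 :+ (j :* con 2 :+ j :* j :* con 3) :* con 3) ≡.refl j))))
  where
  open ≡.≡-Reasoning
  open +-*-Solver
  n : ℕ
  n = 1 ℕ.+ j ℕ.* 3

-- The surplus n is a full period and disappears through q^n = 1. Doubling first removes the halves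
-- of the pentagonal numbers.
finalExp-2 : ∀ j → let n = 2 ℕ.+ j ℕ.* 3 in negExp n ℕ.+ summandExp n ≡ n ℕ.+ (n ℕ.* n ∸ 1) ℕ./ 3
finalExp-2 j = ≡.trans (ℕₚ.*-cancelˡ-≡ _ _ 2 (begin
  2 ℕ.* (negExp n ℕ.+ summandExp n)
    ≡⟨ ≡.cong (λ x → 2 ℕ.* (negExp n ℕ.+ x)) (summandExp-step₁ (1 ℕ.+ j ℕ.* 3) (residue-1+3* j)) ⟩
  2 ℕ.* (negExp n ℕ.+ (n ℕ.+ e))
    ≡⟨ solve 3 (λ a n e → con 2 :* (a :+ (n :+ e)) := con 2 :* a :+ con 2 :* n :+ con 2 :* e) ≡.refl (negExp n) n e ⟩
  2 ℕ.* negExp n ℕ.+ 2 ℕ.* n ℕ.+ 2 ℕ.* e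
    ≡⟨ ≡.cong₂ (λ x y → x ℕ.+ 2 ℕ.* n ℕ.+ y) (2*negExp j) (2*summandExp-1 j) ⟩
  n ℕ.* suc j ℕ.+ 2 ℕ.* n ℕ.+ j ℕ.* 3 ℕ.* suc j
    ≡⟨ solve 1 (λ j → let n = con 2 :+ j :* con 3 in
         n :* (con 1 :+ j) :+ con 2 :* n :+ j :* con 3 :* (con 1 :+ j)
         := con 2 :* (n :+ (con 1 :+ j :* con 4 :+ j :* j :* con 3))) ≡.refl j ⟩
  2 ℕ.* (n ℕ.+ (1 ℕ.+ j ℕ.* 4 ℕ.+ j ℕ.* j ℕ.* 3))  ∎))
  (≡.cong (n ℕ.+_) (≡.sym (exact-/3 (1 ℕ.+ j ℕ.* 4 ℕ.+ j ℕ.* j ℕ.* 3) (≡.cong (_∸ 1)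
    (solve 1 (λ j → (con 2 :+ j :* con 3) :* (con 2 :+ j :* con 3) := con 1 :+ (con 1 :+ j :* con 4 :+ j :* j :* con 3) :* con 3) ≡.refl j)))))
  where
  open ≡.≡-Reasoning
  open +-*-Solver
  n e : ℕ
  n = 2 ℕ.+ j ℕ.* 3
  e = summandExp (1 ℕ.+ j ℕ.* 3)

-- Values of the formal fractions and the final comparison.

sumF-applyUpTo : ∀ m f → sumF (suc m) f ≡ foldr _+F_ zeroF (applyUpTo (λ k → f (suc k)) m)
sumF-applyUpTo m f = ≡.cong (foldr _+F_ zeroF) (≡.trans
  (≡.cong (map f) (filter-positive m (λ k → k))) (Listₚ.map-applyUpTo suc f m))
  where
  filter-positive : ∀ m (g : ℕ → ℕ) → filter (λ k → 1 ℕ.≤? k) (applyUpTo (λ k → suc (g k)) m) ≡ applyUpTo (λ k → suc (g k)) m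
  filter-positive zero    g = ≡.refl
  filter-positive (suc m) g = ≡.cong (suc (g 0) ∷_) (filter-positive m (λ k → g (suc k)))

module Congruence (Φ : ℕ → Poly) (cyclotomic : IsCyclotomicFamily Φ) (N : ℕ) where
  open CyclotomicQuotient Φ cyclotomic N
  open CommutativeRing quotient hiding (zero)
  open IntegerCoefficients quotient
  open PowerFacts quotient
  open Algebra.Properties.Semiring.Exp semiring using (_^_; ^-homo-*; ^-congʳ)
  open Algebra.Properties.Semiring.Mult semiring using (×-congʳ) renaming (_×_ to _·_)
  open Algebra.Properties.Ring ring using (x∙y⁻¹≈ε⇒x≈y; -‿involutive)
  open AntidiagonalSums quotient
  open QBinomials quotient q using (sign)
  open RootOfUnity quotient root using (L; L-r0; L-r1; L-r2; LSum; 2·LSum-r1; 2·LSum-r2; module DivisibleByThree; q-period)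
  open SetoidReasoning setoid

  -- Cross-multiplied, like `CongMod`, so that fractions can be added without inverting their
  -- denominators.
  HasValue : Frac → Carrier → Set
  HasValue F v = num F ≈ den F * v

  sum-value : ∀ l (f : ℕ → Frac) (v : ℕ → ℕ → Carrier) → (∀ k m → k ℕ.+ m ≡ l → HasValue (f k) (v k m)) →
    HasValue (foldr _+F_ zeroF (applyUpTo f (suc l))) (diag l v)
  sum-value zero    f v fv = begin
    num (f 0) * oneP + 0# * den (f 0)
      ≈⟨ solve 2 (λ a b → a :* con (+ 1) :+ con (+ 0) :* b := a) refl (num (f 0)) (den (f 0)) ⟩
    num (f 0)
      ≈⟨ fv 0 0 ≡.refl ⟩
    den (f 0) * v 0 0
      ≈⟨ *-congʳ {v 0 0} (*-identityʳ (den (f 0))) ⟨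
    den (f 0) * oneP * v 0 0  ∎
  sum-value (suc l) f v fv = begin
    a * d + c * b              ≈⟨ +-cong (*-congʳ {d} (fv 0 (suc l) ≡.refl)) (*-congʳ {b} (sum-value l (λ k → f (suc k)) (λ k m → v (suc k) m) λ k m k+m → fv (suc k) m (≡.cong suc k+m))) ⟩
    b * x * d + d * y * b      ≈⟨ solve 4 (λ b d x y → b :* x :* d :+ d :* y :* b := b :* d :* (x :+ y)) refl b d x y ⟩
    b * d * (x + y)            ∎
    where
    rest : Frac
    rest = foldr _+F_ zeroF (applyUpTo (λ k → f (suc k)) (suc l))
    a b c d x y : Carrier
    a = num (f 0)
    b = den (f 0)
    c = num rest
    d = den rest
    x = v 0 (suc l)
    y = diag l (λ k m → v (suc k) m)

  signZ-cases : ∀ k → (signZ k ≡ + 1 × sign k ≈ 1#) ⊎ (signZ k ≡ ℤ.- + 1 × sign k ≈ - 1#)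
  signZ-cases zero = inj₁ (≡.refl , refl)
  signZ-cases (suc k) with signZ-cases k
  ... | inj₁ (e , s) = inj₂ (≡.cong ℤ.-_ e , -‿cong s)
  ... | inj₂ (e , s) = inj₁ (≡.cong ℤ.-_ e , trans (-‿cong s) (-‿involutive 1#))

  coefficient : ℕ → ℚ
  coefficient k = (leg3 k ℤ.* signZ k) ℚ./ 1

  coefficient-r1 : ∀ k → residue k ≡ r1 → constP (coefficient k) ≈ sign k
  coefficient-r1 k e rewrite leg3-residue k e with signZ-cases k
  ... | inj₁ (eq , s) rewrite eq = sym s
  ... | inj₂ (eq , s) rewrite eq = sym s

  coefficient-r2 : ∀ k → residue k ≡ r2 → constP (coefficient k) ≈ - sign k
  coefficient-r2 k e rewrite leg3-residue k e with signZ-cases k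
  ... | inj₁ (eq , s) rewrite eq = sym (-‿cong s)
  ... | inj₂ (eq , s) rewrite eq = sym (trans (-‿cong s) (-‿involutive 1#))

  constP-0 : constP 0ℚ ≈ 0#
  constP-0 = ≈⇒∼ 0∷[]≋[]

  coefficient-r0 : ∀ k → residue k ≡ r0 → constP (coefficient k) ≈ 0#
  coefficient-r0 k e rewrite leg3-residue k e = constP-0

  -- `L` has the sign opposite to the summand, and q^(`expoB k`) is the factor that also stands in
  -- the denominator of `summand k`.
  numerator≈L : ∀ k → constP (coefficient k) * q ^ expoA k ≈ q ^ expoB k * - L k
  numerator≈L k = cases (residue k) ≡.refl
    where
    c a b x s : Carrier
    c = constP (coefficient k)
    a = q ^ expoA k
    b = q ^ expoB k
    x = q ^ summandExp k
    s = sign k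
    cases : ∀ r → residue k ≡ r → c * a ≈ b * - L k
    cases r0 e = begin
      c * a        ≈⟨ *-congʳ {a} (coefficient-r0 k e) ⟩
      0# * a       ≈⟨ solve 2 (λ a b → con (+ 0) :* a := b :* :- con (+ 0)) refl a b ⟩
      b * - 0#     ≈⟨ *-congˡ {b} (-‿cong (L-r0 k e)) ⟨
      b * - L k    ∎
    cases r1 e = begin
      c * a             ≈⟨ *-cong (coefficient-r1 k e) (trans (^-congʳ q (expoA-expoB-r1 k e)) (^-homo-* q (expoB k) (summandExp k))) ⟩
      s * (b * x)       ≈⟨ solve 3 (λ s b x → s :* (b :* x) := b :* :- :- (s :* x)) refl s b x ⟩
      b * - - (s * x)   ≈⟨ *-congˡ {b} (-‿cong (L-r1 k e)) ⟨
      b * - L k         ∎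
    cases r2 e = begin
      c * a             ≈⟨ *-cong (coefficient-r2 k e) (trans (^-congʳ q (expoA-expoB-r2 k e)) (^-homo-* q (expoB k) (summandExp k))) ⟩
      - s * (b * x)     ≈⟨ solve 3 (λ s b x → :- s :* (b :* x) := b :* :- (s :* x)) refl s b x ⟩
      b * - (s * x)     ≈⟨ *-congˡ {b} (-‿cong (L-r2 k e)) ⟨
      b * - L k         ∎

  1-q : Carrier
  1-q = oneP - qpow 1

  summand-value : ∀ k m → k ℕ.+ m ≡ N → HasValue (summand (suc k)) (- 1-q * (L (suc k) * u (suc k)))
  summand-value k m k+m = begin
    scaleP c (qpow A) * 1-q * oneP
      ≈⟨ *-congʳ {oneP} (*-congʳ {1-q} (trans (scaleP≈ c (qpow A)) (trans (*-congˡ {constP c} (sym (q^≈qpow A))) (numerator≈L (suc k))))) ⟩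
    b * - l * 1-q * oneP
      ≈⟨ solve 3 (λ b l t → b :* :- l :* t :* con (+ 1) := con (+ 1) :* (b :* :- l :* t)) refl b l 1-q ⟩
    1# * (b * - l * 1-q)
      -- The factor 1 is expanded as (1 - q^(k+1)) times its inverse, which produces the denominator
      -- of the q-integer.
      ≈⟨ *-congʳ {b * - l * 1-q} (u-inverse k m k+m) ⟨
    (1# - q ^ suc k) * v * (b * - l * 1-q)
      ≈⟨ *-congʳ {b * - l * 1-q} (*-congʳ {v} (+-congˡ {1#} (-‿cong (q^≈qpow (suc k))))) ⟩
    (1# - qpow (suc k)) * v * (b * - l * 1-q)
      ≈⟨ *-congˡ {(1# - qpow (suc k)) * v} (*-congʳ {1-q} (*-congʳ { - l } (q^≈qpow B))) ⟩
    (1# - qpow (suc k)) * v * (qpow B * - l * 1-q)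
      ≈⟨ solve 5 (λ w v b l t → w :* v :* (b :* :- l :* t) := con (+ 1) :* w :* b :* (:- t :* (l :* v))) refl (1# - qpow (suc k)) v (qpow B) l 1-q ⟩
    oneP * (1# - qpow (suc k)) * qpow B * (- 1-q * (l * v))  ∎
    where
    A B : ℕ
    A = expoA (suc k)
    B = expoB (suc k)
    c : ℚ
    c = coefficient (suc k)
    b l v : Carrier
    b = q ^ B
    l = L (suc k)
    v = u (suc k)

  LHS-value : HasValue (LHS n) (- 1-q * LSum)
  LHS-value = ≡.subst (λ F → HasValue F (- 1-q * LSum)) (≡.sym (sumF-applyUpTo (suc N) summand))
    (trans (sum-value N (λ k → summand (suc k)) (λ k _ → - 1-q * (L (suc k) * u (suc k))) summand-value)
      (*-congˡ {den (foldr _+F_ zeroF (applyUpTo (λ k → summand (suc k)) (suc N)))}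
        (diag-* N (- 1-q) (λ k _ → L (suc k) * u (suc k)))))

  finalExp : ℕ
  finalExp = (n ℕ.* n ∸ 1) ℕ./ 3

  factor : ℚ
  factor = (leg3 n ℤ.* (leg3 n ℤ.- + n)) ℚ./ 6

  numRHS≈ : num (RHS n) ≈ constP factor * q ^ finalExp * 1-q
  numRHS≈ = begin
    scaleP factor (qpow finalExp * 1-q)         ≈⟨ scaleP≈ factor (qpow finalExp * 1-q) ⟩
    constP factor * (qpow finalExp * 1-q)       ≈⟨ *-assoc (constP factor) (qpow finalExp) 1-q ⟨
    constP factor * qpow finalExp * 1-q         ≈⟨ *-congʳ {1-q} (*-congˡ {constP factor} (q^≈qpow finalExp)) ⟨
    constP factor * q ^ finalExp * 1-q          ∎

  halve : ∀ x y → x + x ≈ y + y → x ≈ y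
  halve x y e = x∙y⁻¹≈ε⇒x≈y x y (torsionFree 1 (x - y) (begin
    x - y + (x - y + 0#)   ≈⟨ solve 2 (λ x y → x :- y :+ (x :- y :+ con (+ 0)) := x :+ x :- (y :+ y)) refl x y ⟩
    x + x - (y + y)        ≈⟨ +-congʳ { - (y + y) } e ⟩
    y + y - (y + y)        ≈⟨ -‿inverseʳ (y + y) ⟩
    0#                     ∎))

  double : ∀ x → x + x ≈ 2 · x
  double x = +-congˡ {x} (sym (+-identityʳ x))

  -- The comparison takes place after doubling, where the coefficient becomes the integer g and the
  -- known formula for 2 · `LSum` applies; afterwards 2 is cancelled.
  fromDoubled : ∀ g → constP factor + constP factor ≈ g → 2 · LSum ≈ - (g * q ^ finalExp) → - 1-q * LSum ≈ num (RHS n)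
  fromDoubled g 2factor 2sum = halve (- 1-q * LSum) (num (RHS n)) (begin
    - 1-q * LSum + - 1-q * LSum          ≈⟨ distribˡ (- 1-q) LSum LSum ⟨
    - 1-q * (LSum + LSum)                ≈⟨ *-congˡ { - 1-q } (trans (double LSum) 2sum) ⟩
    - 1-q * - (g * x)                    ≈⟨ solve 3 (λ t g x → :- t :* :- (g :* x) := g :* x :* t) refl 1-q g x ⟩
    g * x * 1-q                          ≈⟨ *-congʳ {1-q} (*-congʳ {x} 2factor) ⟨
    (c + c) * x * 1-q                    ≈⟨ solve 3 (λ c x t → (c :+ c) :* x :* t := c :* x :* t :+ c :* x :* t) refl c x 1-q ⟩
    c * x * 1-q + c * x * 1-q            ≈⟨ +-cong numRHS≈ numRHS≈ ⟨
    num (RHS n) + num (RHS n)            ∎)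
    where
    c x : Carrier
    c = constP factor
    x = q ^ finalExp

  2factor≈ : ∀ w → leg3 n ℤ.* (leg3 n ℤ.- + n) ≡ + 3 ℤ.* w → constP factor + constP factor ≈ constP (w ℚ./ 1)
  2factor≈ w e = trans (sym (constP-+ factor factor)) (reflexive (≡.cong constP (/6+/6 w e)))

  values-agree : - 1-q * LSum ≈ num (RHS n)
  values-agree = cases (residue n) ≡.refl (residue⇒quotient n)
    where
    cases : ∀ r → residue n ≡ r → (∃ λ j → n ≡ toℕ (residue n) ℕ.+ j ℕ.* 3) → - 1-q * LSum ≈ num (RHS n)
    cases r0 n≡0 (zero , n≡) = ⊥-elim (ℕₚ.1+n≢0 (≡.trans n≡ (≡.cong (λ r → toℕ r ℕ.+ 0) n≡0)))
    cases r0 n≡0 (suc i , n≡) = fromDoubled 0#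
      (trans (2factor≈ (+ 0) (≡.cong (λ l → l ℤ.* (l ℤ.- + n)) (leg3-residue n n≡0))) constP-0)
      (trans (×-congʳ 2 LSum≈0) (solve 1 (λ x → con (+ 0) :+ (con (+ 0) :+ con (+ 0)) := :- (con (+ 0) :* x)) refl (q ^ finalExp)))
      where
      open DivisibleByThree i (ℕₚ.suc-injective (ℕₚ.suc-injective (≡.trans n≡ (≡.cong (λ r → toℕ r ℕ.+ suc i ℕ.* 3) n≡0)))) using (LSum≈0)
    -- Here 1 · (1 - n) = -3j, so the doubled coefficient is -j.
    cases r1 n≡1 (j , n≡) = fromDoubled (- (j · 1#)) factor≈ sum≈
      where
      n≡′ : n ≡ 1 ℕ.+ j ℕ.* 3
      n≡′ = ≡.trans n≡ (≡.cong (λ r → toℕ r ℕ.+ j ℕ.* 3) n≡1)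
      factor≈ : constP factor + constP factor ≈ - (j · 1#)
      factor≈ = begin
        constP factor + constP factor    ≈⟨ 2factor≈ (ℤ.- + j) integer ⟩
        constP ((ℤ.- + j) ℚ./ 1)         ≡⟨ ≡.cong constP (neg/1 j) ⟩
        constP (ℚ.- (+ j ℚ./ 1))         ≈⟨ constP-neg (+ j ℚ./ 1) ⟩
        - constP (+ j ℚ./ 1)             ≈⟨ -‿cong (·1≈constP j) ⟨
        - (j · 1#)                       ∎
        where
        integer : leg3 n ℤ.* (leg3 n ℤ.- + n) ≡ + 3 ℤ.* ℤ.- + j
        integer = ≡.trans (≡.cong₂ (λ l m → l ℤ.* (l ℤ.- + m)) (leg3-residue n n≡1) n≡′)
          (≡.trans (≡.cong (λ m → + 1 ℤ.* (+ 1 ℤ.- (+ 1 ℤ.+ m))) (ℤₚ.pos-* j 3))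
            (ℤ-Solver.solve 1 (λ j → ℤ-Solver.con (+ 1) ℤ-Solver.:* (ℤ-Solver.con (+ 1) ℤ-Solver.:- (ℤ-Solver.con (+ 1) ℤ-Solver.:+ j ℤ-Solver.:* ℤ-Solver.con (+ 3))) ℤ-Solver.:= ℤ-Solver.con (+ 3) ℤ-Solver.:* ℤ-Solver.:- j) ≡.refl (+ j)))
        constP-neg : ∀ a → constP (ℚ.- a) ≈ - constP a
        constP-neg a = ≈⇒∼ (∷-cong (≡.trans (≡.cong ℚ.-_ (≡.sym (ℚₚ.*-identityˡ a))) (ℚₚ.neg-distribˡ-* 1ℚ a)) ≋-refl)
      sum≈ : 2 · LSum ≈ - (- (j · 1#) * q ^ finalExp)
      sum≈ = begin
        2 · LSum                            ≈⟨ 2·LSum-r1 n≡1 j (≡.subst (λ m → 2 ℕ.* posExp m ≡ m ℕ.* j) (≡.sym n≡′) (2*posExp j)) ⟩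
        j · q ^ (posExp n ℕ.+ summandExp n) ≈⟨ ·-as-* j (q ^ (posExp n ℕ.+ summandExp n)) ⟩
        (j · 1#) * q ^ (posExp n ℕ.+ summandExp n)
          ≈⟨ *-congˡ {j · 1#} (^-congʳ q (≡.subst (λ m → posExp m ℕ.+ summandExp m ≡ (m ℕ.* m ∸ 1) ℕ./ 3) (≡.sym n≡′) (finalExp-1 j))) ⟩
        (j · 1#) * q ^ finalExp             ≈⟨ solve 2 (λ a x → a :* x := :- (:- a :* x)) refl (j · 1#) (q ^ finalExp) ⟩
        - (- (j · 1#) * q ^ finalExp)       ∎
    -- Here (-1)(-1 - n) = n + 1 = 3(j + 1), so the doubled coefficient is j + 1.
    cases r2 n≡2 (j , n≡) = fromDoubled (suc j · 1#) factor≈ sum≈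
      where
      n≡′ : n ≡ 2 ℕ.+ j ℕ.* 3
      n≡′ = ≡.trans n≡ (≡.cong (λ r → toℕ r ℕ.+ j ℕ.* 3) n≡2)
      factor≈ : constP factor + constP factor ≈ suc j · 1#
      factor≈ = trans (2factor≈ (+ suc j) integer) (sym (·1≈constP (suc j)))
        where
        integer : leg3 n ℤ.* (leg3 n ℤ.- + n) ≡ + 3 ℤ.* + suc j
        integer = ≡.trans (≡.cong₂ (λ l m → l ℤ.* (l ℤ.- + m)) (leg3-residue n n≡2) n≡′)
          (≡.trans (≡.cong (λ m → -[1+ 0 ] ℤ.* (-[1+ 0 ] ℤ.- (+ 2 ℤ.+ m))) (ℤₚ.pos-* j 3))
            (ℤ-Solver.solve 1 (λ j → ℤ-Solver.con -[1+ 0 ] ℤ-Solver.:* (ℤ-Solver.con -[1+ 0 ] ℤ-Solver.:- (ℤ-Solver.con (+ 2) ℤ-Solver.:+ j ℤ-Solver.:* ℤ-Solver.con (+ 3))) ℤ-Solver.:= ℤ-Solver.con (+ 3) ℤ-Solver.:* (ℤ-Solver.con (+ 1) ℤ-Solver.:+ j)) ≡.refl (+ j)))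
      sum≈ : 2 · LSum ≈ - ((suc j · 1#) * q ^ finalExp)
      sum≈ = begin
        2 · LSum
          ≈⟨ 2·LSum-r2 n≡2 (suc j) (≡.subst (λ m → 2 ℕ.* negExp m ≡ m ℕ.* suc j) (≡.sym n≡′) (2*negExp j)) ⟩
        suc j · - (q ^ (negExp n ℕ.+ summandExp n))
          ≈⟨ ·-as-* (suc j) (- (q ^ (negExp n ℕ.+ summandExp n))) ⟩
        (suc j · 1#) * - (q ^ (negExp n ℕ.+ summandExp n))
          ≈⟨ *-congˡ {suc j · 1#} (-‿cong (q-period _ finalExp
               (≡.subst (λ m → negExp m ℕ.+ summandExp m ≡ m ℕ.+ (m ℕ.* m ∸ 1) ℕ./ 3) (≡.sym n≡′) (finalExp-2 j)))) ⟩
        (suc j · 1#) * - (q ^ finalExp)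
          ≈⟨ solve 2 (λ a x → a :* :- x := :- (a :* x)) refl (suc j · 1#) (q ^ finalExp) ⟩
        - ((suc j · 1#) * q ^ finalExp)  ∎

  congruence : CongMod (Φ n) (LHS n) (RHS n)
  congruence = _∼_.multiplier agree , coeffs (_∼_.difference agree)
    where
    agree : num (LHS n) * oneP ≈ num (RHS n) * den (LHS n)
    agree = begin
      num (LHS n) * oneP             ≈⟨ *-identityʳ (num (LHS n)) ⟩
      num (LHS n)                    ≈⟨ LHS-value ⟩
      den (LHS n) * (- 1-q * LSum)   ≈⟨ *-congˡ {den (LHS n)} values-agree ⟩
      den (LHS n) * num (RHS n)      ≈⟨ *-comm (den (LHS n)) (num (RHS n)) ⟩
      num (RHS n) * den (LHS n)      ∎

theorem1p1 : (Φ : ℕ → Poly) → IsCyclotomicFamily Φ →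
    (n : ℕ) → 1 ≤ n → CongMod (Φ n) (LHS n) (RHS n)
-- For n = 1 the sum is empty and (n/3) - n = 0, so the difference is the zero polynomial and the
-- multiplier is 0.
theorem1p1 Φ cyclotomic (suc zero)    _ = [] , λ { zero → ≡.refl ; (suc zero) → ≡.refl ; (suc (suc i)) → ≡.refl }
theorem1p1 Φ cyclotomic (suc (suc N)) _ = Congruence.congruence Φ cyclotomic N
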